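{- Let $a=u+iv$ be a root of $1+x^N=0$ (in the sense that $x+a$ is a factor of $1+x^N$). Then the contribution of $a$ and $\bar a=u-iv$ to the iterated integral of $\ln(1+x^N)$ is given by $$-\frac{1}{n!}\sum_{k=1}^{n}\frac{x^k}{k}\left[(x+a)^{n-k}+(x+\bar a)^{n-k}\right] + \frac{1}{i\,n!}\left[(x+a)^n-(x+\bar a)^n\right]\arctan\left(\frac{vx}{1+ux}\right) + \frac{(x+a)^n+(x+\bar a)^n}{2\,n!}\,\ln\left[(1+ux)^2+v^2x^2\right].$$
   Context: The iterated integrals of a function $f_0(x)$ are defined by $f_n(x)=\int_0^x f_{n-1}(t)\,dt$ for $n\ge1$. A polynomial is factored as $P(x)=\prod_{j=1}^m (x+z_j)$, and the numbers $z_j$ are what is referred to as its roots; here $P(x)=1+x^N$. Since $\ln P(x)=\sum_j \ln(x+z_j)$, the $n$-th iterated integral of $\ln P(x)$ is the sum of the $n$-th iterated integrals of the functions $\ln(x+z_j)$; the contribution of $a$ and $\bar a$ is the sum of the $n$-th iterated integrals of $\ln(x+a)$ and $\ln(x+\bar a)$.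
   Formalization: The formula is stated for real x with 1+ux > 0 where ln(x+a) and ln(x+ā) are defined; for 1+ux < 0 the printed formula with the principal arctan is off by a multiple of π[(x+a)^n−(x+ā)^n]/(i n!). -}

module Defs where

open import Level using (_⊔_) renaming (suc to lsuc)
open import Algebra.Core using (Op₁; Op₂)
open import Algebra.Bundles using (CommutativeRing; Semiring)
open import Algebra.Structures using (IsCommutativeRing)
open import Algebra.Apartness.Structures using (IsHeytingField)
open import Algebra.Apartness.Bundles using (HeytingField)
import Algebra.Apartness.Properties.HeytingCommutativeRing as HeytingProperties
import Algebra.Definitions.RawSemiring as RawSemiringDefinitions
import Algebra.Properties.Ring as RingProperties
import Algebra.Solver.Ring.NaturalCoefficients.Default as RingSolver
open import Data.Empty using (⊥-elim)
open import Data.Fin.Base using (Fin; toℕ; inject₁; fromℕ) renaming (zero to fzero; suc to fsuc)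
open import Data.List.Base using (List; []; _∷_; map; replicate; _++_)
open import Data.Nat.Base using (ℕ; zero; suc; NonZero; _!; _≥_)
open import Data.Nat.Properties using (_!≢0)
open import Data.Product.Base using (∃-syntax; _×_; _,_; proj₁; proj₂)
open import Data.Sum.Base using (_⊎_; inj₁; inj₂)
open import Relation.Binary.Core using (Rel)
open import Relation.Binary.Structures using (IsEquivalence; IsStrictPartialOrder)
open import Relation.Nullary.Negation using (¬_)

-- The real numbers, given axiomatically: a Cauchy-complete Archimedean ordered
-- field.  The axioms are the constructive ones (the order is cotransitive and
-- tight, via `isHeytingField`, rather than trichotomous), so that both the
-- Cauchy reals and the classical reals are models.
record Reals c ℓ₁ ℓ₂ : Set (lsuc (c ⊔ ℓ₁ ⊔ ℓ₂)) where
  infix  8 -_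
  infixl 7 _*_
  infixl 6 _+_
  infix  4 _≈_ _<_ _≤_ _#_ ∣_-_∣<_
  field
    Carrier : Set c
    _≈_     : Rel Carrier ℓ₁
    _<_     : Rel Carrier ℓ₂
    _+_     : Op₂ Carrier
    _*_     : Op₂ Carrier
    -_      : Op₁ Carrier
    0#      : Carrier
    1#      : Carrier

  _#_ : Rel Carrier ℓ₂
  x # y = x < y ⊎ y < x

  _≤_ : Rel Carrier ℓ₂
  x ≤ y = ¬ (y < x)

  field
    <-isStrictPartialOrder : IsStrictPartialOrder _≈_ _<_
    isHeytingField         : IsHeytingField _≈_ _#_ _+_ _*_ -_ 0# 1#
    +-monoˡ-<              : ∀ {x y} z → x < y → x + z < y + z
    *-pos                  : ∀ {x y} → 0# < x → 0# < y → 0# < x * y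

  heytingField : HeytingField c ℓ₁ ℓ₂
  heytingField = record { isHeytingField = isHeytingField }

  open HeytingField heytingField public
    using (_-_; isCommutativeRing; heytingCommutativeRing; #⇒invertible)

  commutativeRing : CommutativeRing c ℓ₁
  commutativeRing = record { isCommutativeRing = isCommutativeRing }

  open RawSemiringDefinitions (Semiring.rawSemiring (CommutativeRing.semiring commutativeRing)) public
    using (_^_) renaming (_×_ to _·_)

  fromNat : ℕ → Carrier
  fromNat n = n · 1#

  ∣_-_∣<_ : Carrier → Carrier → Carrier → Set ℓ₂
  ∣ x - y ∣< ε = x < y + ε × y < x + ε

  field
    archimedean : ∀ x → ∃[ n ] x < fromNat n
    complete    : (s : ℕ → Carrier) →
                  (∀ ε → 0# < ε → ∃[ k ] ∀ m n → m ≥ k → n ≥ k → ∣ s m - s n ∣< ε) →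
                  ∃[ l ] ∀ ε → 0# < ε → ∃[ k ] ∀ n → n ≥ k → ∣ s n - l ∣< ε

-- Polynomials as lists of coefficients, constant term first; trailing zeros are
-- allowed, so equality of polynomials is equality of all coefficients.
module Polynomial {c ℓ} (A : CommutativeRing c ℓ) where
  open CommutativeRing A

  infixl 6 _+ₚ_
  infixl 7 _*ₚ_
  infix  4 _≈ₚ_ _∣ₚ_

  Poly : Set c
  Poly = List Carrier

  coeff : Poly → ℕ → Carrier
  coeff []      _       = 0#
  coeff (a ∷ _) zero    = a
  coeff (_ ∷ p) (suc k) = coeff p k

  _≈ₚ_ : Rel Poly ℓ
  p ≈ₚ q = ∀ k → coeff p k ≈ coeff q k

  _+ₚ_ : Op₂ Poly
  []      +ₚ q       = q
  p       +ₚ []      = p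
  (a ∷ p) +ₚ (b ∷ q) = (a + b) ∷ (p +ₚ q)

  _*ₚ_ : Op₂ Poly
  []      *ₚ q = []
  (a ∷ p) *ₚ q = map (a *_) q +ₚ (0# ∷ (p *ₚ q))

  const : Carrier → Poly
  const a = a ∷ []

  X^_ : ℕ → Poly
  X^ n = replicate n 0# ++ const 1#

  X : Poly
  X = X^ 1

  _∣ₚ_ : Rel Poly (c ⊔ ℓ)
  p ∣ₚ q = ∃[ r ] q ≈ₚ p *ₚ r

module Analysis {c ℓ₁ ℓ₂} (R : Reals c ℓ₁ ℓ₂) where
  open Reals R public renaming (Carrier to ℝ)
  private
    module R = CommutativeRing commutativeRing
    module SPO = IsStrictPartialOrder <-isStrictPartialOrder
    module H = HeytingProperties heytingCommutativeRing
    module HF = HeytingField heytingField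
    open RingProperties R.ring
    open RingSolver R.commutativeSemiring using (solve) renaming (_:=_ to _⊜_; _:+_ to _⊕_; _:*_ to _⊗_)

    <-cotrans : ∀ {x y} → x < y → ∀ z → x < z ⊎ z < y
    <-cotrans x<y z with HF.#-cotrans (inj₁ x<y) z
    ... | inj₁ (inj₁ x<z) = inj₁ x<z
    ... | inj₁ (inj₂ z<x) = inj₂ (SPO.trans z<x x<y)
    ... | inj₂ (inj₁ z<y) = inj₂ z<y
    ... | inj₂ (inj₂ y<z) = inj₁ (SPO.trans x<y y<z)

    <-resp : ∀ {x x′ y y′} → x R.≈ x′ → y R.≈ y′ → x < y → x′ < y′
    <-resp p q r = SPO.<-respˡ-≈ p (SPO.<-respʳ-≈ q r)

    neg-pos : ∀ {x} → x < 0# → 0# < - x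
    neg-pos {x} x<0 = <-resp (R.-‿inverseʳ x) (R.+-identityˡ (- x)) (+-monoˡ-< (- x) x<0)

    neg*neg : ∀ x → (- x) * (- x) R.≈ x * x
    neg*neg x = R.trans (R.sym (-‿distribˡ-* x (- x)))
                  (R.trans (R.-‿cong (R.sym (-‿distribʳ-* x x))) (-‿involutive (x * x)))

    #0⇒0<sq : ∀ {x} → x # 0# → 0# < x * x
    #0⇒0<sq (inj₁ x<0) = SPO.<-respʳ-≈ (neg*neg _) (*-pos (neg-pos x<0) (neg-pos x<0))
    #0⇒0<sq (inj₂ 0<x) = *-pos 0<x 0<x

    0≤sq : ∀ x → 0# ≤ x * x
    0≤sq x xx<0 = SPO.irrefl R.refl (SPO.trans (#0⇒0<sq x#0) xx<0)
      where
      inverse = #⇒invertible {x * x} {0#} (inj₁ xx<0)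
      x#0 : x # 0#
      x#0 = H.invertibleʳ⇒# (x * proj₁ inverse ,
        R.trans (R.*-congʳ (H.x-0≈x x))
          (R.trans (R.sym (R.*-assoc x x _))
            (R.trans (R.*-congʳ (R.sym (H.x-0≈x (x * x)))) (proj₂ (proj₂ inverse)))))

    0<+ : ∀ {x y} → 0# < x → 0# ≤ y → 0# < x + y
    0<+ {x} {y} 0<x 0≤y with <-cotrans 0<x (x + y)
    ... | inj₁ 0<x+y = 0<x+y
    ... | inj₂ x+y<x = ⊥-elim (0≤y (<-resp
            (xyx⁻¹≈y x y)
            (R.-‿inverseʳ x)
            (+-monoˡ-< (- x) x+y<x)))

  0<1 : 0# < 1#
  0<1 = SPO.<-respʳ-≈ (R.*-identityˡ 1#) (#0⇒0<sq H.1#0)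

  0<fromNat : ∀ n → .{{NonZero n}} → 0# < fromNat n
  0<fromNat (suc zero)    = SPO.<-respʳ-≈ (R.sym (R.+-identityʳ 1#)) 0<1
  0<fromNat (suc (suc n)) = 0<+ 0<1 (λ q → SPO.irrefl R.refl (SPO.trans (0<fromNat (suc n)) q))

  0<y²+v²x² : ∀ {y} v x → 0# < y → 0# < y ^ 2 + v ^ 2 * x ^ 2
  0<y²+v²x² {y} v x 0<y = SPO.<-respʳ-≈
    (R.+-cong (R.*-congˡ (R.sym (R.*-identityʳ y)))
      (R.trans (solve 2 (λ v x → (v ⊗ x) ⊗ (v ⊗ x) ⊜ (v ⊗ v) ⊗ (x ⊗ x)) R.refl v x)
        (R.*-cong (R.*-congˡ (R.sym (R.*-identityʳ v))) (R.*-congˡ (R.sym (R.*-identityʳ x))))))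
    (0<+ (*-pos 0<y 0<y) (0≤sq (v * x)))

  -- The library's `#⇒invertible` inverts the difference `y - 0#`.
  recip : ∀ y → y # 0# → ℝ
  recip y y#0 = proj₁ (#⇒invertible y#0)

  infixl 7 _/_[_]
  _/_[_] : ∀ x y → y # 0# → ℝ
  x / y [ y#0 ] = x * recip y y#0

  1/_ : ∀ n → .{{NonZero n}} → ℝ
  1/ n = recip (fromNat n) (inj₂ (0<fromNat n))

  1/_! : ℕ → ℝ
  1/ n ! = (1/ (n !)) {{n !≢0}}

  infix 5 _+i_
  record ℂ : Set c where
    constructor _+i_
    field
      re im : ℝ
  open ℂ public

  infix  8 -ᶜ_
  infixl 7 _*ᶜ_
  infixl 6 _+ᶜ_ _-ᶜ_
  infix  4 _≈ᶜ_

  record _≈ᶜ_ (z w : ℂ) : Set ℓ₁ where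
    constructor _,_
    field
      re-≈ : re z ≈ re w
      im-≈ : im z ≈ im w
  open _≈ᶜ_ public

  _+ᶜ_ : Op₂ ℂ
  z +ᶜ w = re z + re w +i im z + im w

  _*ᶜ_ : Op₂ ℂ
  z *ᶜ w = re z * re w - im z * im w +i re z * im w + im z * re w

  -ᶜ_ : Op₁ ℂ
  -ᶜ z = - re z +i - im z

  _-ᶜ_ : Op₂ ℂ
  z -ᶜ w = z +ᶜ (-ᶜ w)

  ι : ℝ → ℂ
  ι x = x +i 0#

  𝕚 : ℂ
  𝕚 = 0# +i 1#

  conj : Op₁ ℂ
  conj z = re z +i - im z

  ∣_∣² : ℂ → ℝ
  ∣ z ∣² = re z * re z + im z * im z

  recipᶜ : ∀ z → ∣ z ∣² # 0# → ℂ
  recipᶜ z z#0 = conj z *ᶜ ι (recip ∣ z ∣² z#0)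

  ∣𝕚∣²#0 : ∣ 𝕚 ∣² # 0#
  ∣𝕚∣²#0 = inj₂ (SPO.<-respʳ-≈ (R.+-comm _ _) (0<+ (*-pos 0<1 0<1) (0≤sq 0#)))

  private
    ≈ᶜ-isEquivalence : IsEquivalence _≈ᶜ_
    ≈ᶜ-isEquivalence = record
      { refl  = R.refl , R.refl
      ; sym   = λ p → R.sym (re-≈ p) , R.sym (im-≈ p)
      ; trans = λ p q → R.trans (re-≈ p) (re-≈ q) , R.trans (im-≈ p) (im-≈ q)
      }

    *ᶜ-comm : ∀ z w → z *ᶜ w ≈ᶜ w *ᶜ z
    *ᶜ-comm (a +i b) (d +i e) =
        R.+-cong (R.*-comm a d) (R.-‿cong (R.*-comm b e))
      , R.trans (R.+-comm _ _) (R.+-cong (R.*-comm b d) (R.*-comm a e))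

    ⊖≈ : ∀ x y → x - y ≈ x + (- 1#) * y
    ⊖≈ x y = R.+-congˡ (R.sym (-1*x≈-x y))

    *ᶜ-assoc : ∀ z w t → (z *ᶜ w) *ᶜ t ≈ᶜ z *ᶜ (w *ᶜ t)
    *ᶜ-assoc (a +i b) (d +i e) (f +i g) =
        R.trans (R.trans (R.+-congʳ (R.*-congʳ (⊖≈ _ _))) (⊖≈ _ _))
          (R.trans
            (solve 7 (λ m a b d e f g →
              (a ⊗ d ⊕ m ⊗ (b ⊗ e)) ⊗ f ⊕ m ⊗ ((a ⊗ e ⊕ b ⊗ d) ⊗ g)
              ⊜ a ⊗ (d ⊗ f ⊕ m ⊗ (e ⊗ g)) ⊕ m ⊗ (b ⊗ (d ⊗ g ⊕ e ⊗ f)))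
              R.refl (- 1#) a b d e f g)
            (R.sym (R.trans (R.+-congʳ (R.*-congˡ (⊖≈ _ _))) (⊖≈ _ _))))
      , R.trans (R.+-congʳ (R.*-congʳ (⊖≈ _ _)))
          (R.trans
            (solve 7 (λ m a b d e f g →
              (a ⊗ d ⊕ m ⊗ (b ⊗ e)) ⊗ g ⊕ (a ⊗ e ⊕ b ⊗ d) ⊗ f
              ⊜ a ⊗ (d ⊗ g ⊕ e ⊗ f) ⊕ b ⊗ (d ⊗ f ⊕ m ⊗ (e ⊗ g)))
              R.refl (- 1#) a b d e f g)
            (R.sym (R.+-congˡ (R.*-congˡ (⊖≈ _ _)))))

    *ᶜ-identityˡ : ∀ z → ι 1# *ᶜ z ≈ᶜ z
    *ᶜ-identityˡ (a +i b) =
        R.trans (R.+-cong (R.*-identityˡ a) (R.trans (R.-‿cong (R.zeroˡ b)) -0#≈0#)) (R.+-identityʳ a)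
      , R.trans (R.+-cong (R.*-identityˡ b) (R.zeroˡ a)) (R.+-identityʳ b)

    *ᶜ-distribˡ : ∀ z w t → z *ᶜ (w +ᶜ t) ≈ᶜ (z *ᶜ w) +ᶜ (z *ᶜ t)
    *ᶜ-distribˡ (a +i b) (d +i e) (f +i g) =
        R.trans (⊖≈ _ _)
          (R.trans
            (solve 7 (λ m a b d e f g →
              a ⊗ (d ⊕ f) ⊕ m ⊗ (b ⊗ (e ⊕ g))
              ⊜ (a ⊗ d ⊕ m ⊗ (b ⊗ e)) ⊕ (a ⊗ f ⊕ m ⊗ (b ⊗ g)))
              R.refl (- 1#) a b d e f g)
            (R.sym (R.+-cong (⊖≈ _ _) (⊖≈ _ _))))
      , solve 6 (λ a b d e f g →
          a ⊗ (e ⊕ g) ⊕ b ⊗ (d ⊕ f) ⊜ (a ⊗ e ⊕ b ⊗ d) ⊕ (a ⊗ g ⊕ b ⊗ f))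
          R.refl a b d e f g

    module E = IsEquivalence ≈ᶜ-isEquivalence

    *ᶜ-cong : ∀ {z z′ w w′} → z ≈ᶜ z′ → w ≈ᶜ w′ → z *ᶜ w ≈ᶜ z′ *ᶜ w′
    *ᶜ-cong (p , q) (r , s) =
        R.+-cong (R.*-cong p r) (R.-‿cong (R.*-cong q s))
      , R.+-cong (R.*-cong p s) (R.*-cong q r)

  ℂ-isCommutativeRing : IsCommutativeRing _≈ᶜ_ _+ᶜ_ _*ᶜ_ -ᶜ_ (ι 0#) (ι 1#)
  ℂ-isCommutativeRing = record
    { isRing = record
      { +-isAbelianGroup = record
        { isGroup = record
          { isMonoid = record
            { isSemigroup = record
              { isMagma = record
                { isEquivalence = ≈ᶜ-isEquivalence
                ; ∙-cong        = λ (p , q) (r , s) → R.+-cong p r , R.+-cong q s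
                }
              ; assoc = λ z w t → R.+-assoc _ _ _ , R.+-assoc _ _ _
              }
            ; identity = (λ z → R.+-identityˡ _ , R.+-identityˡ _)
                       , (λ z → R.+-identityʳ _ , R.+-identityʳ _)
            }
          ; inverse = (λ z → R.-‿inverseˡ _ , R.-‿inverseˡ _)
                    , (λ z → R.-‿inverseʳ _ , R.-‿inverseʳ _)
          ; ⁻¹-cong = λ (p , q) → R.-‿cong p , R.-‿cong q
          }
        ; comm = λ z w → R.+-comm _ _ , R.+-comm _ _
        }
      ; *-cong     = *ᶜ-cong
      ; *-assoc    = *ᶜ-assoc
      ; *-identity = *ᶜ-identityˡ
                   , (λ z → E.trans (*ᶜ-comm z (ι 1#)) (*ᶜ-identityˡ z))
      ; distrib    = *ᶜ-distribˡ
                   , (λ z w t → E.trans (*ᶜ-comm (w +ᶜ t) z)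
                       (E.trans (*ᶜ-distribˡ z w t)
                         (re-≈ (+-cong′ (*ᶜ-comm z w) (*ᶜ-comm z t))
                         , im-≈ (+-cong′ (*ᶜ-comm z w) (*ᶜ-comm z t)))))
      }
    ; *-comm = *ᶜ-comm
    }
    where
    +-cong′ : ∀ {z z′ w w′} → z ≈ᶜ z′ → w ≈ᶜ w′ → z +ᶜ w ≈ᶜ z′ +ᶜ w′
    +-cong′ (p , q) (r , s) = R.+-cong p r , R.+-cong q s

  ℂ-commutativeRing : CommutativeRing c ℓ₁
  ℂ-commutativeRing = record { isCommutativeRing = ℂ-isCommutativeRing }

  open RawSemiringDefinitions (Semiring.rawSemiring (CommutativeRing.semiring ℂ-commutativeRing)) public
    using () renaming (_^_ to _^ᶜ_; sum to sumᶜ)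

  open Polynomial ℂ-commutativeRing public

  -- Σ_{k=1}^{n} f k
  sum₁ : (n : ℕ) → ((k : ℕ) → .{{NonZero k}} → ℂ) → ℂ
  sum₁ n f = sumᶜ {n} (λ j → f (suc (toℕ j)))

  record TaggedPartition : Set (c ⊔ ℓ₁ ⊔ ℓ₂) where
    field
      size  : ℕ
      point : Fin (suc size) → ℝ
      tag   : Fin size → ℝ
      first : point fzero ≈ 0#
      last  : point (fromℕ size) ≈ 1#
      lower : ∀ j → point (inject₁ j) ≤ tag j
      upper : ∀ j → tag j ≤ point (fsuc j)

    width : Fin size → ℝ
    width j = point (fsuc j) - point (inject₁ j)

  open TaggedPartition public using (tag; width)

  -- Partial functions ℝ ⇀ ℂ: the domain is a predicate.
  Fun : (ℝ → Set ℓ₂) → Set (c ⊔ ℓ₂)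
  Fun D = ∀ t → D t → ℂ

  -- `HasIntegral D f a b I`: the Riemann integral ∫_a^b f(t) dt exists and equals I.
  -- Partitions of [a,b] are images of partitions of [0,1] under s ↦ a + s(b - a);
  -- this covers a ≤ b and b ≤ a at once, with the usual sign convention.
  -- Closeness in ℂ is measured componentwise.  `inside` makes the universally
  -- quantified proofs `d` below available for every partition.
  record HasIntegral (D : ℝ → Set ℓ₂) (f : Fun D) (a b : ℝ) (I : ℂ) : Set (c ⊔ ℓ₁ ⊔ ℓ₂) where
    at : ℝ → ℝ
    at s = a + s * (b - a)

    riemannSum : (P : TaggedPartition) → (∀ j → D (at (tag P j))) → ℂ
    riemannSum P d = sumᶜ (λ j → f (at (tag P j)) (d j) *ᶜ ι (width P j * (b - a)))

    field
      inside    : ∀ s → 0# ≤ s → s ≤ 1# → D (at s)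
      converges : ∀ ε → 0# < ε → ∃[ δ ] 0# < δ ×
                  ((P : TaggedPartition) →
                   (∀ j → width P j < δ) → (d : ∀ j → D (at (tag P j))) →
                   ∣ re (riemannSum P d) - re I ∣< ε ×
                   ∣ im (riemannSum P d) - im I ∣< ε)

  -- The plane cut along (-∞, 0].
  Slit : ℂ → Set ℓ₂
  Slit z = 0# < re z ⊎ im z # 0#

  pos⇒slit : ∀ {x} → 0# < x → Slit (ι x)
  pos⇒slit = inj₁

  -- The principal logarithm: ln z = ∫ dζ/ζ along the segment ζ = 1 + t(z - 1), 0 ≤ t ≤ 1.
  IsLn : (∀ z → Slit z → ℂ) → Set (c ⊔ ℓ₁ ⊔ ℓ₂)
  IsLn ln = ∀ z (s : Slit z) →
    let ζ = λ t → ι 1# +ᶜ ι t *ᶜ (z -ᶜ ι 1#) in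
    HasIntegral (λ t → ∣ ζ t ∣² # 0#) (λ t p → recipᶜ (ζ t) p *ᶜ (z -ᶜ ι 1#)) 0# 1# (ln z s)

  -- arctan y = ∫_0^y dt/(1 + t²).
  IsArctan : (ℝ → ℝ) → Set (c ⊔ ℓ₁ ⊔ ℓ₂)
  IsArctan arctan = ∀ y →
    HasIntegral (λ t → 1# + t ^ 2 # 0#) (λ t p → ι (recip (1# + t ^ 2) p)) 0# y (ι (arctan y))

  record IsIteratedIntegrals (D : ℝ → Set ℓ₂) (f₀ : Fun D) (f : ℕ → Fun D) : Set (c ⊔ ℓ₁ ⊔ ℓ₂) where
    field
      start : ∀ x d → f 0 x d ≈ᶜ f₀ x d
      step  : ∀ n x d → HasIntegral D (f n) 0# x (f (suc n) x d)

  -- The real x at which both ln(x + a) and ln(x + ā) are defined and at which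
  -- the principal value of arctan(vx/(1 + ux)), with a = u + iv, is the one continued from x = 0;
  -- when 1 + ux < 0 the two values differ by ±π.
  record Domain (a : ℂ) (x : ℝ) : Set ℓ₂ where
    field
      0<1+ux : 0# < 1# + re a * x
      slit   : Slit (ι x +ᶜ a)
      slit̄   : Slit (ι x +ᶜ conj a)
  open Domain public

{-# OPTIONS --safe #-}

-- Since aā = 1, integrating ln(x + a) repeatedly gives
--   Fₙ(x) = (1/n!) ((x+a)ⁿ (ln(x+a) - ln a) - Σₖ xᵏ(x+a)ⁿ⁻ᵏ/k + xⁿ ln a),
-- and likewise for ā; the terms xⁿ ln a and xⁿ ln ā cancel because ln a + ln ā = ln 1 = 0.  All facts about the
-- logarithm come from one multiplicativity law: ln(zp) = ln z + ln p whenever the triangle 1, z, zp lies in an open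
-- half-plane whose boundary passes through 0.  It yields
--   ln(x+a) - ln a = ln(1+āx),   ln z + ln z̄ = ln ∣z∣²,   ln(1+ax) = ln(1+ux) + ln(1+iq)   with q = vx/(1+ux),
-- while ln(1+iq) - ln(1-iq) = 2i arctan q holds integrand by integrand.  The law itself is the fundamental theorem of
-- calculus along the segment from z to zp; differentiating ln there amounts to estimating, for two end points z and w,
-- the integrand (w-1)/(1+t(w-1)) - (z-1)/(1+t(z-1)) - (w-z)/(1+t(z-1))², which is O((w-z)²).

module Submission where

open import Defs
open import Level using (_⊔_)
open import Algebra.Apartness.Bundles using (HeytingField)
import Algebra.Apartness.Properties.HeytingCommutativeRing as HeytingProperties
open import Algebra.Bundles using (CommutativeRing; Semiring)
import Algebra.Definitions.RawSemiring as RawSemiringDefinitions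
import Algebra.Properties.AbelianGroup as AbelianGroupProperties
import Algebra.Properties.Ring as RingProperties
import Algebra.Properties.Semiring.Mult as MultProperties
import Algebra.Properties.Semiring.Mult.TCOptimised as OptimisedMultProperties
import Algebra.Properties.Semiring.Sum as SumProperties
import Algebra.Solver.Ring
open import Algebra.Solver.Ring.AlmostCommutativeRing using (fromCommutativeRing; _-Raw-AlmostCommutative⟶_)
import Data.Bool.Base as Bool
open import Data.Empty using (⊥; ⊥-elim)
open import Data.Fin.Base using (Fin; toℕ; inject₁; fromℕ) renaming (zero to fzero; suc to fsuc)
open import Data.Fin.Properties using (toℕ-inject₁; toℕ-fromℕ; toℕ<n)
open import Data.Integer.Base as ℤ using (ℤ; +_; -[1+_])
import Data.Integer.Properties as ℤ
open import Data.List.Base using ([]; _∷_; map)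
open import Data.Maybe.Base as Maybe using (Maybe; just; is-just)
open import Data.Nat.Base as ℕ using (ℕ; zero; suc; _∸_; NonZero)
import Data.Nat.Properties as ℕ
open import Data.Product.Base using (∃-syntax; Σ-syntax; _×_; _,_; proj₁; proj₂)
open import Data.Sum.Base using (_⊎_; inj₁; inj₂)
open import Data.Vec.N-ary using (N-ary; Eq; curryⁿ; curryⁿ-cong)
import Relation.Binary.Reflection as Reflection
import Relation.Binary.Reasoning.Setoid as SetoidReasoning
open import Relation.Binary.PropositionalEquality.Core as ≡ using (_≡_)
open import Relation.Binary.Structures using (IsStrictPartialOrder)
open import Relation.Nullary.Decidable.Core using (dec⇒maybe)

-- The order is constructive: signs and minima cannot be decided. Strict inequalities therefore
-- carry explicit margins; a half-plane condition is used through a number m > 0 lying below the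
-- slope at every end point involved. Moduli enter as squares, with `1 + M` in the role of a square
-- root of `M`. A function such as `ln` receives a proof of membership in its domain, and nothing
-- assumes that its values respect `≈` or ignore that proof; both facts are derived from uniqueness
-- of integrals. Integrands of `ln` are accordingly characterised by product equations, such as
-- ψ(t)ζ(t) = z - 1, in which no such proof occurs. That aā = 1 comes from (-a)ᴺ = -1: ∣a∣² is a
-- nonnegative real whose N-th power is 1. The same equation excludes a = -1, and this places a in
-- the cut plane, so that ln a exists.

-- Ring solver with integer coefficients

module IntegerRingSolver {c ℓ} (A : CommutativeRing c ℓ) where
  open CommutativeRing A
  open RingProperties ring
  open AbelianGroupProperties +-abelianGroup using (⁻¹-∙-comm)
  open OptimisedMultProperties semiring renaming (_×_ to _·_)
  open SetoidReasoning setoid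

  private
    ⟦_⟧ : ℤ → Carrier
    ⟦ + n ⟧      = n · 1#
    ⟦ -[1+ n ] ⟧ = - (suc n · 1#)

    suc-· : ∀ n → suc n · 1# ≈ 1# + n · 1#
    suc-· n = ×-homo-+ 1# 1 n

    cancel : ∀ x y z → (x + y) - (x + z) ≈ y - z
    cancel x y z = begin
      (x + y) - (x + z)       ≈⟨ +-cong (+-comm x y) (sym (⁻¹-∙-comm x z)) ⟩
      (y + x) + (- x + - z)   ≈⟨ +-assoc y x _ ⟩
      y + (x + (- x + - z))   ≈⟨ +-congˡ (sym (+-assoc x _ _)) ⟩
      y + ((x + - x) + - z)   ≈⟨ +-congˡ (+-congʳ (-‿inverseʳ x)) ⟩
      y + (0# + - z)          ≈⟨ +-congˡ (+-identityˡ _) ⟩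
      y - z                   ∎

    ⊖-homo : ∀ m n → ⟦ m ℤ.⊖ n ⟧ ≈ m · 1# - n · 1#
    ⊖-homo m       zero    = sym (trans (+-congˡ -0#≈0#) (+-identityʳ _))
    ⊖-homo zero    (suc n) = sym (+-identityˡ _)
    ⊖-homo (suc m) (suc n) = begin
      ⟦ suc m ℤ.⊖ suc n ⟧                   ≡⟨ ≡.cong ⟦_⟧ (ℤ.[1+m]⊖[1+n]≡m⊖n m n) ⟩
      ⟦ m ℤ.⊖ n ⟧                           ≈⟨ ⊖-homo m n ⟩
      m · 1# - n · 1#                     ≈⟨ cancel 1# _ _ ⟨
      (1# + m · 1#) - (1# + n · 1#)       ≈⟨ +-cong (suc-· m) (-‿cong (suc-· n)) ⟨
      suc m · 1# - suc n · 1#             ∎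

    -‿homo : ∀ i → ⟦ ℤ.- i ⟧ ≈ - ⟦ i ⟧
    -‿homo (+ zero)  = sym -0#≈0#
    -‿homo (+ suc n) = refl
    -‿homo -[1+ n ]  = sym (-‿involutive _)

    +-homo : ∀ i j → ⟦ i ℤ.+ j ⟧ ≈ ⟦ i ⟧ + ⟦ j ⟧
    +-homo (+ m)    (+ n)    = ×-homo-+ 1# m n
    +-homo (+ m)    -[1+ n ] = ⊖-homo m (suc n)
    +-homo -[1+ m ] (+ n)    = trans (⊖-homo n (suc m)) (+-comm _ _)
    +-homo -[1+ m ] -[1+ n ] = begin
      - (suc (suc (m ℕ.+ n)) · 1#)          ≈⟨ -‿cong (suc-· (suc m ℕ.+ n)) ⟩
      - (1# + (suc m ℕ.+ n) · 1#)           ≈⟨ -‿cong (+-congˡ (×-homo-+ 1# (suc m) n)) ⟩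
      - (1# + (suc m · 1# + n · 1#))        ≈⟨ -‿cong (sym (+-assoc _ _ _)) ⟩
      - ((1# + suc m · 1#) + n · 1#)        ≈⟨ -‿cong (+-congʳ (+-comm _ _)) ⟩
      - ((suc m · 1# + 1#) + n · 1#)        ≈⟨ -‿cong (+-assoc _ _ _) ⟩
      - (suc m · 1# + (1# + n · 1#))        ≈⟨ -‿cong (+-congˡ (suc-· n)) ⟨
      - (suc m · 1# + suc n · 1#)           ≈⟨ ⁻¹-∙-comm _ _ ⟨
      - (suc m · 1#) + - (suc n · 1#)       ∎

    *-homo-+ : ∀ m j → ⟦ + m ℤ.* j ⟧ ≈ m · 1# * ⟦ j ⟧
    *-homo-+ zero    j = trans (reflexive (≡.cong ⟦_⟧ (ℤ.*-zeroˡ j))) (sym (zeroˡ _))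
    *-homo-+ (suc m) j = begin
      ⟦ + suc m ℤ.* j ⟧              ≡⟨ ≡.cong ⟦_⟧ (ℤ.suc-* (+ m) j) ⟩
      ⟦ j ℤ.+ + m ℤ.* j ⟧            ≈⟨ +-homo j (+ m ℤ.* j) ⟩
      ⟦ j ⟧ + ⟦ + m ℤ.* j ⟧          ≈⟨ +-cong (sym (*-identityˡ _)) (*-homo-+ m j) ⟩
      1# * ⟦ j ⟧ + m · 1# * ⟦ j ⟧    ≈⟨ distribʳ _ _ _ ⟨
      (1# + m · 1#) * ⟦ j ⟧          ≈⟨ *-congʳ (suc-· m) ⟨
      suc m · 1# * ⟦ j ⟧             ∎

    *-homo : ∀ i j → ⟦ i ℤ.* j ⟧ ≈ ⟦ i ⟧ * ⟦ j ⟧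
    *-homo (+ m)    j = *-homo-+ m j
    *-homo -[1+ m ] j = begin
      ⟦ -[1+ m ] ℤ.* j ⟧         ≡⟨ ≡.cong ⟦_⟧ (ℤ.neg-distribˡ-* (+ suc m) j) ⟨
      ⟦ ℤ.- (+ suc m ℤ.* j) ⟧    ≈⟨ -‿homo (+ suc m ℤ.* j) ⟩
      - ⟦ + suc m ℤ.* j ⟧        ≈⟨ -‿cong (*-homo-+ (suc m) j) ⟩
      - (suc m · 1# * ⟦ j ⟧)     ≈⟨ -‿distribˡ-* _ _ ⟩
      - (suc m · 1#) * ⟦ j ⟧     ∎

    morphism : ℤ.+-*-rawRing -Raw-AlmostCommutative⟶ fromCommutativeRing A
    morphism = record
      { ⟦_⟧ = ⟦_⟧ ; +-homo = +-homo ; *-homo = *-homo ; -‿homo = -‿homo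
      ; 0-homo = refl ; 1-homo = refl }

    _≟_ : ∀ i j → Maybe (⟦ i ⟧ ≈ ⟦ j ⟧)
    i ≟ j = Maybe.map (λ i≡j → reflexive (≡.cong ⟦_⟧ i≡j)) (dec⇒maybe (i ℤ.≟ j))

  private module Solver = Algebra.Solver.Ring ℤ.+-*-rawRing (fromCommutativeRing A) morphism _≟_
  open Solver public using (con; _:+_; _:*_; _:-_; :-_; _:=_)
  open Solver using (Polynomial; normalise; _≟N_; correct; ⟦_⟧N-cong) renaming (⟦_⟧ to ⟦_⟧ₚ; var to varₚ)
  open Reflection setoid varₚ ⟦_⟧ₚ Solver.⟦_⟧↓ correct using (close)

  -- Unlike the library's `solve`, this compares the normal forms by evaluation of the integer
  -- coefficients; converting their denotations in `A` is too slow when `A` is not a variable.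
  solve : ∀ n (f : N-ary n (Polynomial n) (Polynomial n × Polynomial n)) →
         let p = proj₁ (close n f) ; q = proj₂ (close n f) in
         {Bool.T (is-just (normalise p ≟N normalise q))} →
         Eq n _≈_ (curryⁿ ⟦ p ⟧ₚ) (curryⁿ ⟦ q ⟧ₚ)
  solve n f {same} = curryⁿ-cong _≈_ ⟦ p ⟧ₚ ⟦ q ⟧ₚ λ ρ →
    trans (sym (correct p ρ)) (trans (same⇒≈ (normalise p ≟N normalise q) same ρ) (correct q ρ))
    where
    p = proj₁ (close n f)
    q = proj₂ (close n f)
    same⇒≈ : ∀ {p′ q′} (r : Maybe (p′ Solver.≈N q′)) → Bool.T (is-just r) → ∀ ρ → Solver.⟦ p′ ⟧N ρ ≈ Solver.⟦ q′ ⟧N ρ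
    same⇒≈ (just p′≈q′) _ = ⟦ p′≈q′ ⟧N-cong

-- Polynomial evaluation and geometric sums

module Evaluation {c ℓ} (A : CommutativeRing c ℓ) where
  open CommutativeRing A
  open Polynomial A
  open IntegerRingSolver A
  open RawSemiringDefinitions (Semiring.rawSemiring semiring) using (_^_)

  eval : Poly → Carrier → Carrier
  eval []      z = 0#
  eval (a ∷ p) z = a + z * eval p z

  abstract
    eval-0 : ∀ p z → (∀ k → coeff p k ≈ 0#) → eval p z ≈ 0#
    eval-0 []      z p≈0 = refl
    eval-0 (a ∷ p) z p≈0 = trans (+-cong (p≈0 0) (*-congˡ (eval-0 p z (λ k → p≈0 (suc k)))))
      (solve 1 (λ z → con (+ 0) :+ z :* con (+ 0) := con (+ 0)) z)

    eval-cong : ∀ p q z → p ≈ₚ q → eval p z ≈ eval q z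
    eval-cong []      q       z p≈q = sym (eval-0 q z (λ k → sym (p≈q k)))
    eval-cong (a ∷ p) []      z p≈q = eval-0 (a ∷ p) z p≈q
    eval-cong (a ∷ p) (b ∷ q) z p≈q = +-cong (p≈q 0) (*-congˡ (eval-cong p q z (λ k → p≈q (suc k))))

    eval-+ : ∀ p q z → eval (p +ₚ q) z ≈ eval p z + eval q z
    eval-+ []      q       z = sym (+-identityˡ _)
    eval-+ (a ∷ p) []      z = sym (+-identityʳ _)
    eval-+ (a ∷ p) (b ∷ q) z = trans (+-congˡ (*-congˡ (eval-+ p q z)))
      (solve 5 (λ a b z x y → (a :+ b) :+ z :* (x :+ y) := (a :+ z :* x) :+ (b :+ z :* y)) a b z (eval p z) (eval q z))

    eval-map-* : ∀ a q z → eval (map (a *_) q) z ≈ a * eval q z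
    eval-map-* a []      z = sym (zeroʳ a)
    eval-map-* a (b ∷ q) z = trans (+-congˡ (*-congˡ (eval-map-* a q z)))
      (solve 4 (λ a b z x → a :* b :+ z :* (a :* x) := a :* (b :+ z :* x)) a b z (eval q z))

    eval-* : ∀ p q z → eval (p *ₚ q) z ≈ eval p z * eval q z
    eval-* []      q z = sym (zeroˡ _)
    eval-* (a ∷ p) q z = trans (eval-+ (map (a *_) q) (0# ∷ p *ₚ q) z)
      (trans (+-cong (eval-map-* a q z) (+-congˡ (*-congˡ (eval-* p q z))))
        (solve 4 (λ a z x y → a :* y :+ (con (+ 0) :+ z :* (x :* y)) := (a :+ z :* x) :* y) a z (eval p z) (eval q z)))

    eval-X^ : ∀ n z → eval (X^ n) z ≈ z ^ n
    eval-X^ zero    z = solve 1 (λ z → con (+ 1) :+ z :* con (+ 0) := con (+ 1)) z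
    eval-X^ (suc n) z = trans (+-identityˡ _) (*-congˡ (eval-X^ n z))

    factor⇒root : ∀ a q z → (X +ₚ const a) ∣ₚ q → z ≈ - a → eval q z ≈ 0#
    factor⇒root a q z (r , q≈) z≈-a = trans (eval-cong q ((X +ₚ const a) *ₚ r) z q≈)
      (trans (eval-* (X +ₚ const a) r z)
        (trans (*-congʳ (trans (+-congˡ (*-congʳ z≈-a))
            (trans (+-congˡ (*-congˡ (+-congˡ (*-congʳ z≈-a))))
              (solve 1 (λ a → (con (+ 0) :+ a) :+ (:- a) :* (con (+ 1) :+ (:- a) :* con (+ 0)) := con (+ 0)) a))))
          (zeroˡ _)))

  -- The sum 1 + z + ... + zⁿ⁻¹ in Horner form.
  geometric : ℕ → Carrier → Carrier
  geometric zero    z = 0#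
  geometric (suc n) z = z * geometric n z + 1#

  abstract
    geometric-* : ∀ n z → (z - 1#) * geometric n z ≈ z ^ n - 1#
    geometric-* zero    z = solve 1 (λ z → (z :- con (+ 1)) :* con (+ 0) := con (+ 1) :- con (+ 1)) z
    geometric-* (suc n) z = trans
      (solve 2 (λ z g → (z :- con (+ 1)) :* (z :* g :+ con (+ 1)) := z :* ((z :- con (+ 1)) :* g) :+
        (z :- con (+ 1))) z (geometric n z))
      (trans (+-congʳ (*-congˡ (geometric-* n z)))
        (solve 2 (λ z p → z :* (p :- con (+ 1)) :+ (z :- con (+ 1)) := z :* p :- con (+ 1)) z (z ^ n)))

module _ {c ℓ₁ ℓ₂} (R : Reals c ℓ₁ ℓ₂) where
  open Analysis R
  open IntegerRingSolver commutativeRing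
  open IntegerRingSolver ℂ-commutativeRing using () renaming
    (solve to solveᶜ; con to conᶜ; _:+_ to _⊕_; _:*_ to _⊗_; _:-_ to _⊖_; :-_ to ⊝_; _:=_ to _⊜_)
  open RingProperties (CommutativeRing.ring ℂ-commutativeRing) using (-1*x≈-x)
  private
    module 𝓡 = CommutativeRing commutativeRing
    module 𝓒 = CommutativeRing ℂ-commutativeRing
    module Sumᶜ = SumProperties 𝓒.semiring
    module H = HeytingProperties heytingCommutativeRing
    module HF = HeytingField heytingField
    module SPO = IsStrictPartialOrder <-isStrictPartialOrder

  -- Inequalities in a constructive ordered field

  module OrderedField where

    abstract
      <-trans : ∀ {x y z} → x < y → y < z → x < z
      <-trans = SPO.trans

      <-irrefl : ∀ {x y} → x ≈ y → x < y → ⊥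
      <-irrefl = SPO.irrefl

      <-resp-≈ : ∀ {x x′ y y′} → x ≈ x′ → y ≈ y′ → x < y → x′ < y′
      <-resp-≈ p q r = SPO.<-respˡ-≈ p (SPO.<-respʳ-≈ q r)

      <-cotrans : ∀ {x y} → x < y → ∀ z → x < z ⊎ z < y
      <-cotrans x<y z with HF.#-cotrans (inj₁ x<y) z
      ... | inj₁ (inj₁ x<z) = inj₁ x<z
      ... | inj₁ (inj₂ z<x) = inj₂ (<-trans z<x x<y)
      ... | inj₂ (inj₁ z<y) = inj₂ z<y
      ... | inj₂ (inj₂ y<z) = inj₁ (<-trans x<y y<z)

      ≤-reflexive : ∀ {x y} → x ≈ y → x ≤ y
      ≤-reflexive x≈y = <-irrefl (𝓡.sym x≈y)

      ≤-refl : ∀ {x} → x ≤ x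
      ≤-refl = ≤-reflexive 𝓡.refl

      <⇒≤ : ∀ {x y} → x < y → x ≤ y
      <⇒≤ x<y y<x = <-irrefl 𝓡.refl (<-trans x<y y<x)

      ≤-resp-≈ : ∀ {x x′ y y′} → x ≈ x′ → y ≈ y′ → x ≤ y → x′ ≤ y′
      ≤-resp-≈ p q x≤y y<x = x≤y (<-resp-≈ (𝓡.sym q) (𝓡.sym p) y<x)

      ≤-trans : ∀ {x y z} → x ≤ y → y ≤ z → x ≤ z
      ≤-trans {y = y} x≤y y≤z z<x with <-cotrans z<x y
      ... | inj₁ z<y = y≤z z<y
      ... | inj₂ y<x = x≤y y<x

      <-≤-trans : ∀ {x y z} → x < y → y ≤ z → x < z
      <-≤-trans {z = z} x<y y≤z with <-cotrans x<y z
      ... | inj₁ x<z = x<z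
      ... | inj₂ z<y = ⊥-elim (y≤z z<y)

      ≤-antisym : ∀ {x y} → x ≤ y → y ≤ x → x ≈ y
      ≤-antisym x≤y y≤x = proj₁ (HF.tight _ _) λ where
        (inj₁ x<y) → y≤x x<y
        (inj₂ y<x) → x≤y y<x

      x<y⇒0<y-x : ∀ {x y} → x < y → 0# < y - x
      x<y⇒0<y-x {x} {y} x<y = <-resp-≈ (𝓡.-‿inverseʳ x) 𝓡.refl (+-monoˡ-< (- x) x<y)

      <-by : ∀ {x y d} → 0# < d → y - x ≈ d → x < y
      <-by {x} {y} 0<d eq = <-resp-≈ (𝓡.+-identityˡ x)
        (solve 2 (λ x y → (y :- x) :+ x := y) x y)
        (+-monoˡ-< x (<-resp-≈ 𝓡.refl (𝓡.sym eq) 0<d))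

      x≤y⇒0≤y-x : ∀ {x y} → x ≤ y → 0# ≤ y - x
      x≤y⇒0≤y-x {x} {y} x≤y y-x<0 = x≤y (<-resp-≈
        (solve 2 (λ x y → (y :- x) :+ x := y) x y) (𝓡.+-identityˡ x) (+-monoˡ-< x y-x<0))

      ≤-by : ∀ {x y d} → 0# ≤ d → y - x ≈ d → x ≤ y
      ≤-by {x} {y} 0≤d eq y<x = 0≤d (<-resp-≈ eq (𝓡.-‿inverseʳ x) (+-monoˡ-< (- x) y<x))

      0<+ : ∀ {x y} → 0# < x → 0# ≤ y → 0# < x + y
      0<+ {x} {y} 0<x 0≤y with <-cotrans 0<x (x + y)
      ... | inj₁ 0<x+y = 0<x+y
      ... | inj₂ x+y<x = ⊥-elim (0≤y (<-resp-≈
              (solve 2 (λ x y → (x :+ y) :- x := y) x y) (𝓡.-‿inverseʳ x) (+-monoˡ-< (- x) x+y<x)))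

      0≤+ : ∀ {x y} → 0# ≤ x → 0# ≤ y → 0# ≤ x + y
      0≤+ {x} {y} 0≤x 0≤y x+y<0 with <-cotrans x+y<0 x
      ... | inj₂ x<0 = 0≤x x<0
      ... | inj₁ x+y<x = 0≤y (<-resp-≈
              (solve 2 (λ x y → (x :+ y) :- x := y) x y) (𝓡.-‿inverseʳ x) (+-monoˡ-< (- x) x+y<x))

      0<+⇒⊎ : ∀ {x y} → 0# < x + y → 0# < x ⊎ 0# < y
      0<+⇒⊎ {x} {y} 0<x+y with <-cotrans 0<x+y x
      ... | inj₁ 0<x   = inj₁ 0<x
      ... | inj₂ x<x+y = inj₂ (<-resp-≈ 𝓡.refl (solve 2 (λ x y → (x :+ y) :- x := y) x y) (x<y⇒0<y-x x<x+y))

      recip-inverseʳ : ∀ y y#0 → y * recip y y#0 ≈ 1#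
      recip-inverseʳ y y#0 = 𝓡.trans (𝓡.*-congʳ (𝓡.sym (H.x-0≈x y))) (proj₂ (proj₂ (#⇒invertible y#0)))

      invertible⇒#0 : ∀ {x y} → x * y ≈ 1# → x # 0#
      invertible⇒#0 {x} {y} xy≈1 = H.invertibleʳ⇒# (y , 𝓡.trans (𝓡.*-congʳ (H.x-0≈x x)) xy≈1)

      -- An inverse of the product yields an inverse of the factor, and invertible elements are
      -- apart from 0. This recovers a sign dichotomy for x from information about a product.
      *#0⇒#0 : ∀ {x y} → x * y # 0# → x # 0#
      *#0⇒#0 {x} {y} xy#0 = invertible⇒#0 (𝓡.trans (𝓡.sym (𝓡.*-assoc _ _ _)) (recip-inverseʳ (x * y) xy#0))

      -- The goal is a negation, so xy < 0 may be assumed; it makes both factors apart from 0, and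
      -- only then can their signs be compared.
      0≤* : ∀ {x y} → 0# ≤ x → 0# ≤ y → 0# ≤ x * y
      0≤* {x} {y} 0≤x 0≤y xy<0
        with *#0⇒#0 (inj₁ xy<0)
           | *#0⇒#0 {y} {x} (inj₁ (<-resp-≈ (𝓡.*-comm x y) 𝓡.refl xy<0))
      ... | inj₁ x<0 | _        = 0≤x x<0
      ... | inj₂ _   | inj₁ y<0 = 0≤y y<0
      ... | inj₂ 0<x | inj₂ 0<y = <⇒≤ (*-pos 0<x 0<y) xy<0

      #0⇒0<sq : ∀ {x} → x # 0# → 0# < x * x
      #0⇒0<sq {x} (inj₁ x<0) = <-resp-≈ 𝓡.refl (solve 1 (λ x → (con (+ 0) :- x) :* (con (+ 0) :- x) := x :* x) x)
        (*-pos (x<y⇒0<y-x x<0) (x<y⇒0<y-x x<0))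
      #0⇒0<sq (inj₂ 0<x) = *-pos 0<x 0<x

      0≤sq : ∀ x → 0# ≤ x * x
      0≤sq x xx<0 = <⇒≤ (#0⇒0<sq (*#0⇒#0 (inj₁ xx<0))) xx<0

      0≤1 : 0# ≤ 1#
      0≤1 = <⇒≤ 0<1

      0<*⁻¹ : ∀ {x y} → 0# < x → 0# < x * y → 0# < y
      0<*⁻¹ {x} {y} 0<x 0<xy with *#0⇒#0 {y} {x} (inj₂ (<-resp-≈ 𝓡.refl (𝓡.*-comm x y) 0<xy))
      ... | inj₂ 0<y = 0<y
      ... | inj₁ y<0 = ⊥-elim (<-irrefl 𝓡.refl (<-trans 0<xy (<-by (*-pos 0<x (x<y⇒0<y-x y<0))
                         (solve 2 (λ x y → con (+ 0) :- x :* y := x :* (con (+ 0) :- y)) x y))))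

      0<recip : ∀ {y} (0<y : 0# < y) → 0# < recip y (inj₂ 0<y)
      0<recip {y} 0<y = 0<*⁻¹ 0<y (<-resp-≈ 𝓡.refl (𝓡.sym (recip-inverseʳ y _)) 0<1)

      recip-unique : ∀ {y z} y#0 → y * z ≈ 1# → z ≈ recip y y#0
      recip-unique {y} {z} y#0 yz≈1 = 𝓡.trans
        (𝓡.trans (𝓡.sym (𝓡.*-identityʳ z)) (𝓡.*-congˡ (𝓡.sym (recip-inverseʳ y y#0))))
        (𝓡.trans (solve 3 (λ y z r → z :* (y :* r) := (y :* z) :* r) y z (recip y y#0))
          (𝓡.trans (𝓡.*-congʳ yz≈1) (𝓡.*-identityˡ _)))

      +-mono-≤ : ∀ {x y z w} → x ≤ y → z ≤ w → x + z ≤ y + w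
      +-mono-≤ {x} {y} {z} {w} p q = ≤-by (0≤+ (x≤y⇒0≤y-x p) (x≤y⇒0≤y-x q))
        (solve 4 (λ x y z w → (y :+ w) :- (x :+ z) := (y :- x) :+ (w :- z)) x y z w)

      *-monoˡ-≤ : ∀ {x y z} → 0# ≤ z → x ≤ y → z * x ≤ z * y
      *-monoˡ-≤ {x} {y} {z} 0≤z x≤y = ≤-by (0≤* 0≤z (x≤y⇒0≤y-x x≤y))
        (solve 3 (λ x y z → z :* y :- z :* x := z :* (y :- x)) x y z)

      *-mono-≤ : ∀ {x y z w} → 0# ≤ x → 0# ≤ w → x ≤ y → z ≤ w → x * z ≤ y * w
      *-mono-≤ {x} {y} {z} {w} 0≤x 0≤w x≤y z≤w = ≤-by
        (0≤+ (0≤* (x≤y⇒0≤y-x x≤y) 0≤w) (0≤* 0≤x (x≤y⇒0≤y-x z≤w)))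
        (solve 4 (λ x y z w → y :* w :- x :* z := (y :- x) :* w :+ x :* (w :- z)) x y z w)

      sq≤sq⇒≤ : ∀ {x y} → 0# ≤ y → x * x ≤ y * y → x ≤ y
      sq≤sq⇒≤ {x} {y} 0≤y xx≤yy y<x = xx≤yy (<-by
        -- The factor x + y is written as (x - y) + 2y, a positive number plus a nonnegative one.
        (*-pos (x<y⇒0<y-x y<x) (0<+ (x<y⇒0<y-x y<x) (0≤+ 0≤y 0≤y)))
        (solve 2 (λ x y → x :* x :- y :* y := (x :- y) :* ((x :- y) :+ (y :+ y))) x y))

      ∣x∣≤y⇒sq≤sq : ∀ {x y} → x ≤ y → - x ≤ y → x * x ≤ y * y
      ∣x∣≤y⇒sq≤sq {x} {y} x≤y -x≤y = ≤-by (0≤* (x≤y⇒0≤y-x x≤y) (x≤y⇒0≤y-x -x≤y))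
        (solve 2 (λ x y → y :* y :- x :* x := (y :- x) :* (y :- (:- x))) x y)

      inverse⁺ : ∀ {y} → 0# < y → ∃[ r ] 0# < r × y * r ≈ 1#
      inverse⁺ {y} 0<y = recip y (inj₂ 0<y) , 0<recip 0<y , recip-inverseʳ y (inj₂ 0<y)

      half : ∀ {ε} → 0# < ε → ∃[ δ ] 0# < δ × δ + δ ≈ ε
      half {ε} 0<ε = halve (inverse⁺ (0<+ 0<1 0≤1))
        where
        halve : ∃[ r ] 0# < r × (1# + 1#) * r ≈ 1# → ∃[ δ ] 0# < δ × δ + δ ≈ ε
        halve (r , 0<r , 2r≈1) = ε * r , *-pos 0<ε 0<r , 𝓡.trans
          (solve 2 (λ e r → e :* r :+ e :* r := e :* ((con (+ 1) :+ con (+ 1)) :* r)) ε r)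
          (𝓡.trans (𝓡.*-congˡ 2r≈1) (𝓡.*-identityʳ ε))

      ≤+ε⇒≤ : ∀ {x y} → (∀ ε → 0# < ε → x ≤ y + ε) → x ≤ y
      ≤+ε⇒≤ {x} {y} x≤y+ε y<x = contradict (half (x<y⇒0<y-x y<x))
        where
        contradict : ∃[ δ ] 0# < δ × δ + δ ≈ x - y → ⊥
        contradict (δ , 0<δ , δ+δ≈x-y) = x≤y+ε δ 0<δ (<-by 0<δ (𝓡.trans
          (solve 3 (λ x y d → x :- (y :+ d) := (x :- y) :- d) x y δ)
          (𝓡.trans (𝓡.+-congʳ (𝓡.sym δ+δ≈x-y)) (solve 1 (λ d → d :+ d :- d := d) δ))))

      x≈x*yr : ∀ x {y r} → y * r ≈ 1# → x ≈ x * (y * r)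
      x≈x*yr x yr≈1 = 𝓡.trans (𝓡.sym (𝓡.*-identityʳ x)) (𝓡.*-congˡ (𝓡.sym yr≈1))

      -- The witness xy/(x + y) lies below both numbers without a decision as to which of them is
      -- smaller.
      lower-bound : ∀ {x y} → 0# < x → 0# < y → ∃[ m ] 0# < m × m ≤ x × m ≤ y
      lower-bound {x} {y} 0<x 0<y = bound (inverse⁺ (0<+ 0<x (<⇒≤ 0<y)))
        where
        bound : ∃[ r ] 0# < r × (x + y) * r ≈ 1# → ∃[ m ] 0# < m × m ≤ x × m ≤ y
        bound (r , 0<r , [x+y]r≈1) = x * y * r , *-pos (*-pos 0<x 0<y) 0<r
          , ≤-by (<⇒≤ (*-pos (*-pos 0<x 0<x) 0<r)) (𝓡.trans (𝓡.+-congʳ (x≈x*yr x [x+y]r≈1))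
              (solve 3 (λ x y r → x :* ((x :+ y) :* r) :- x :* y :* r := x :* x :* r) x y r))
          , ≤-by (<⇒≤ (*-pos (*-pos 0<y 0<y) 0<r)) (𝓡.trans (𝓡.+-congʳ (x≈x*yr y [x+y]r≈1))
              (solve 3 (λ x y r → y :* ((x :+ y) :* r) :- x :* y :* r := y :* y :* r) x y r))

      -- The witness is ε/(1 + K); the added 1 keeps the denominator invertible when K is 0.
      scaled-below : ∀ {K ε} → 0# ≤ K → 0# < ε → ∃[ δ ] 0# < δ × K * δ ≤ ε
      scaled-below {K} {ε} 0≤K 0<ε = bound (inverse⁺ (0<+ 0<1 0≤K))
        where
        bound : ∃[ r ] 0# < r × (1# + K) * r ≈ 1# → ∃[ δ ] 0# < δ × K * δ ≤ ε
        bound (r , 0<r , [1+K]r≈1) = ε * r , *-pos 0<ε 0<r , ≤-by (<⇒≤ (*-pos 0<ε 0<r)) (𝓡.trans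
          (𝓡.+-congʳ (x≈x*yr ε [1+K]r≈1))
          (solve 3 (λ K e r → e :* ((con (+ 1) :+ K) :* r) :- K :* (e :* r) := e :* r) K ε r))

  open OrderedField

  -- Squared moduli and componentwise bounds

  module ComplexNorm where

    2# : ℝ
    2# = 1# + 1#

    -- A bound in the sup norm of the two components. It is additive under sums, unlike bounds on
    -- ∣z∣², and is stated without absolute values or roots.
    record Box (z : ℂ) (B : ℝ) : Set ℓ₂ where
      constructor box
      field
        re≤ : re z ≤ B
        -re≤ : - re z ≤ B
        im≤ : im z ≤ B
        -im≤ : - im z ≤ B
    open Box

    abstract
      0<2 : 0# < 2#
      0<2 = 0<+ 0<1 0≤1

      0≤2 : 0# ≤ 2#
      0≤2 = <⇒≤ 0<2

      0≤ᴺ : ∀ z → 0# ≤ ∣ z ∣²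
      0≤ᴺ z = 0≤+ (0≤sq (re z)) (0≤sq (im z))

      ᴺ-cong : ∀ {z w} → z ≈ᶜ w → ∣ z ∣² ≈ ∣ w ∣²
      ᴺ-cong (p , q) = 𝓡.+-cong (𝓡.*-cong p p) (𝓡.*-cong q q)

      ᴺ-* : ∀ z w → ∣ z *ᶜ w ∣² ≈ ∣ z ∣² * ∣ w ∣²
      ᴺ-* z w = solve 4 (λ a b d e →
        (a :* d :- b :* e) :* (a :* d :- b :* e) :+ (a :* e :+ b :* d) :* (a :* e :+ b :* d)
        := (a :* a :+ b :* b) :* (d :* d :+ e :* e)) (re z) (im z) (re w) (im w)

      ᴺ-ι : ∀ x → ∣ ι x ∣² ≈ x * x
      ᴺ-ι x = solve 1 (λ x → x :* x :+ con (+ 0) :* con (+ 0) := x :* x) x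

      ᴺ-neg : ∀ z → ∣ -ᶜ z ∣² ≈ ∣ z ∣²
      ᴺ-neg z = solve 2 (λ a b → (:- a) :* (:- a) :+ (:- b) :* (:- b) := a :* a :+ b :* b) (re z) (im z)

      -- Parallelogram law: the two sides differ by ∣z - w∣².
      ᴺ-+ : ∀ z w → ∣ z +ᶜ w ∣² ≤ 2# * (∣ z ∣² + ∣ w ∣²)
      ᴺ-+ z w = ≤-by (0≤ᴺ (z -ᶜ w)) (solve 4 (λ a b d e →
        (con (+ 1) :+ con (+ 1)) :* ((a :* a :+ b :* b) :+ (d :* d :+ e :* e)) :-
          ((a :+ d) :* (a :+ d) :+ (b :+ e) :* (b :+ e))
        := (a :- d) :* (a :- d) :+ (b :- e) :* (b :- e)) (re z) (im z) (re w) (im w))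

      Box-cong : ∀ {z w B} → z ≈ᶜ w → Box z B → Box w B
      Box-cong (p , q) (box a b d e) = box (≤-resp-≈ p 𝓡.refl a) (≤-resp-≈ (𝓡.-‿cong p) 𝓡.refl b)
        (≤-resp-≈ q 𝓡.refl d) (≤-resp-≈ (𝓡.-‿cong q) 𝓡.refl e)

      Box-mono : ∀ {z A B} → A ≤ B → Box z A → Box z B
      Box-mono p (box a b d e) = box (≤-trans a p) (≤-trans b p) (≤-trans d p) (≤-trans e p)

      -‿+ : ∀ x y → - x + - y ≈ - (x + y)
      -‿+ = solve 2 (λ x y → :- x :+ :- y := :- (x :+ y))

      -0≈0 : - 0# ≈ 0#
      -0≈0 = solve 0 (:- con (+ 0) := con (+ 0))

      Box-0 : Box (ι 0#) 0#
      Box-0 = box ≤-refl (≤-reflexive -0≈0) ≤-refl (≤-reflexive -0≈0)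

      Box-+ : ∀ {z w A B} → Box z A → Box w B → Box (z +ᶜ w) (A + B)
      Box-+ (box a b d e) (box a′ b′ d′ e′) = box (+-mono-≤ a a′) (≤-resp-≈ (-‿+ _ _) 𝓡.refl (+-mono-≤ b b′))
        (+-mono-≤ d d′) (≤-resp-≈ (-‿+ _ _) 𝓡.refl (+-mono-≤ e e′))

      Box-neg : ∀ {z B} → Box z B → Box (-ᶜ z) B
      Box-neg (box a b d e) = box b (≤-resp-≈ (x≈-‿-x _) 𝓡.refl a) e (≤-resp-≈ (x≈-‿-x _) 𝓡.refl d)
        where
        x≈-‿-x : ∀ x → x ≈ - - x
        x≈-‿-x = solve 1 (λ x → x := :- (:- x))

      Box-*ι : ∀ {z B w} → 0# ≤ w → Box z B → Box (z *ᶜ ι w) (B * w)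
      Box-*ι {z} {B} {w} 0≤w (box a b d e) = box
        (≤-by (0≤* 0≤w (x≤y⇒0≤y-x a)) (solve 4 (λ x y B w → B :* w :- (x :* w :- y :* con (+ 0)) := w :* (B :- x)) x y B w))
        (≤-by (0≤* 0≤w (x≤y⇒0≤y-x b)) (solve 4 (λ x y B w → B :* w :- (:- (x :* w :- y :* con (+ 0))) := w :*
          (B :- (:- x))) x y B w))
        (≤-by (0≤* 0≤w (x≤y⇒0≤y-x d)) (solve 4 (λ x y B w → B :* w :- (x :* con (+ 0) :+ y :* w) := w :* (B :- y)) x y B w))
        (≤-by (0≤* 0≤w (x≤y⇒0≤y-x e)) (solve 4 (λ x y B w → B :* w :- (:- (x :* con (+ 0) :+ y :* w)) := w :*
          (B :- (:- y))) x y B w))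
        where
        x y : ℝ
        x = re z
        y = im z

      ᴺ⇒Box : ∀ {z B} → 0# ≤ B → ∣ z ∣² ≤ B * B → Box z B
      ᴺ⇒Box {z} {B} 0≤B N≤ = box
        (sq≤sq⇒≤ 0≤B re²≤) (sq≤sq⇒≤ 0≤B (≤-resp-≈ (neg-sq (re z)) 𝓡.refl re²≤))
        (sq≤sq⇒≤ 0≤B im²≤) (sq≤sq⇒≤ 0≤B (≤-resp-≈ (neg-sq (im z)) 𝓡.refl im²≤))
        where
        neg-sq : ∀ x → x * x ≈ - x * - x
        neg-sq = solve 1 (λ x → x :* x := (:- x) :* (:- x))
        re²≤ : re z * re z ≤ B * B
        re²≤ = ≤-trans (≤-by (0≤sq (im z)) (solve 2 (λ x y → (x :+ y) :- x := y) (re z * re z) (im z * im z))) N≤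
        im²≤ : im z * im z ≤ B * B
        im²≤ = ≤-trans (≤-by (0≤sq (re z)) (solve 2 (λ x y → (x :+ y) :- y := x) (re z * re z) (im z * im z))) N≤

      Box⇒ᴺ : ∀ {z B} → Box z B → ∣ z ∣² ≤ 2# * (B * B)
      Box⇒ᴺ {z} {B} (box a b d e) = ≤-resp-≈ 𝓡.refl (solve 1 (λ B → B :+ B := (con (+ 1) :+ con (+ 1)) :* B) (B * B))
        (+-mono-≤ (∣x∣≤y⇒sq≤sq a b) (∣x∣≤y⇒sq≤sq d e))

      x≤[1+x]² : ∀ {x} → 0# ≤ x → x ≤ (1# + x) * (1# + x)
      x≤[1+x]² {x} 0≤x = ≤-by (0≤+ 0≤1 (0≤+ 0≤x (0≤* 0≤x 0≤x)))
        (solve 1 (λ x → (con (+ 1) :+ x) :* (con (+ 1) :+ x) :- x := con (+ 1) :+ (x :+ x :* x)) x)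

      -- Since M ≤ (1 + M)², the factor 1 + M serves in place of the square root of M.
      ᴺ≤scaled⇒Box : ∀ {z M B} → 0# ≤ M → 0# ≤ B → ∣ z ∣² ≤ M * (B * B) → Box z ((1# + M) * B)
      ᴺ≤scaled⇒Box {z} {M} {B} 0≤M 0≤B N≤ = ᴺ⇒Box (0≤* (0≤+ 0≤1 0≤M) 0≤B) (≤-trans N≤ (≤-resp-≈
        (𝓡.*-comm _ _)
        (solve 2 (λ K B → B :* B :* (K :* K) := K :* B :* (K :* B)) (1# + M) B)
        (*-monoˡ-≤ (0≤sq B) (x≤[1+x]² 0≤M))))

      Box-* : ∀ {z B} w → 0# ≤ B → Box z B → Box (w *ᶜ z) ((1# + ∣ w ∣² * 2#) * B)
      Box-* {z} {B} w 0≤B zB = ᴺ≤scaled⇒Box (0≤* (0≤ᴺ w) 0≤2) 0≤B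
        (≤-resp-≈ (𝓡.sym (ᴺ-* w z)) (𝓡.sym (𝓡.*-assoc _ _ _)) (*-monoˡ-≤ (0≤ᴺ w) (Box⇒ᴺ zB)))

      Box-≤+ε : ∀ {z B} → (∀ ε → 0# < ε → Box z (B + ε)) → Box z B
      Box-≤+ε h = box (≤+ε⇒≤ λ ε p → re≤ (h ε p)) (≤+ε⇒≤ λ ε p → -re≤ (h ε p))
        (≤+ε⇒≤ λ ε p → im≤ (h ε p)) (≤+ε⇒≤ λ ε p → -im≤ (h ε p))

      Box-0⇒≈0 : ∀ {z} → Box z 0# → z ≈ᶜ ι 0#
      Box-0⇒≈0 (box a b d e) = ≤-antisym a (flip b) , ≤-antisym d (flip e)
        where
        flip : ∀ {x} → - x ≤ 0# → 0# ≤ x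
        flip {x} p = ≤-by (x≤y⇒0≤y-x p) (solve 1 (λ x → x :- con (+ 0) := con (+ 0) :- (:- x)) x)

      ᴺ≤0⇒≈0 : ∀ {z} → ∣ z ∣² ≤ 0# → z ≈ᶜ ι 0#
      ᴺ≤0⇒≈0 p = Box-0⇒≈0 (ᴺ⇒Box ≤-refl (≤-resp-≈ 𝓡.refl (𝓡.sym (𝓡.zeroˡ 0#)) p))

      recipᶜ-inverseʳ : ∀ z z#0 → z *ᶜ recipᶜ z z#0 ≈ᶜ ι 1#
      recipᶜ-inverseʳ z z#0 = 𝓒.trans (𝓒.sym (𝓒.*-assoc z (conj z) _))
        (𝓒.trans (𝓒.*-congʳ z*conj)
          ( 𝓡.trans (solve 2 (λ n r → n :* r :- con (+ 0) :* con (+ 0) := n :* r) ∣ z ∣² r) (recip-inverseʳ ∣ z ∣² z#0)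
          , solve 2 (λ n r → n :* con (+ 0) :+ con (+ 0) :* r := con (+ 0)) ∣ z ∣² r))
        where
        r : ℝ
        r = recip ∣ z ∣² z#0
        z*conj : z *ᶜ conj z ≈ᶜ ι ∣ z ∣²
        z*conj = solve 2 (λ a b → a :* a :- b :* (:- b) := a :* a :+ b :* b) (re z) (im z)
               , solve 2 (λ a b → a :* (:- b) :+ b :* a := con (+ 0)) (re z) (im z)

      *ᶜ-cancelʳ : ∀ {z w x y} → x *ᶜ y ≈ᶜ ι 1# → z *ᶜ x ≈ᶜ w *ᶜ x → z ≈ᶜ w
      *ᶜ-cancelʳ {z} {w} {x} {y} xy≈1 zx≈wx = 𝓒.trans (expand z) (𝓒.trans (𝓒.*-congʳ zx≈wx) (𝓒.sym (expand w)))
        where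
        expand : ∀ z → z ≈ᶜ z *ᶜ x *ᶜ y
        expand z = 𝓒.trans (𝓒.sym (𝓒.*-identityʳ z)) (𝓒.trans (𝓒.*-congˡ (𝓒.sym xy≈1)) (𝓒.sym (𝓒.*-assoc z x y)))

  open ComplexNorm

  -- Riemann integration on the unit interval

  module Integration where

    -- Every integral is pulled back to [0,1]. Bundling a parameter with its bounds turns a partial
    -- integrand into a total function, the domain proof being supplied by the bounds.
    record 𝕀 : Set (c ⊔ ℓ₂) where
      constructor point
      field
        val   : ℝ
        0≤val : 0# ≤ val
        val≤1 : val ≤ 1#
    open 𝕀 public

    𝟘 𝟙 : 𝕀
    𝟘 = point 0# ≤-refl 0≤1
    𝟙 = point 1# 0≤1 ≤-refl

    abstract
      ι-- : ∀ x y → ι (x - y) ≈ᶜ ι x -ᶜ ι y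
      ι-- x y = 𝓡.refl , solve 0 (con (+ 0) := con (+ 0) :- con (+ 0))

      monotone-low : ∀ {n} (p : Fin (suc n) → ℝ) → (∀ j → p (inject₁ j) ≤ p (fsuc j)) → ∀ j → p fzero ≤ p j
      monotone-low p mono fzero = ≤-refl
      monotone-low {suc n} p mono (fsuc j) =
        ≤-trans (mono fzero) (monotone-low (λ i → p (fsuc i)) (λ i → mono (fsuc i)) j)

      monotone-high : ∀ {n} (p : Fin (suc n) → ℝ) → (∀ j → p (inject₁ j) ≤ p (fsuc j)) → ∀ j → p j ≤ p (fromℕ n)
      monotone-high {zero}  p mono fzero = ≤-refl
      monotone-high {suc n} p mono fzero =
        ≤-trans (mono fzero) (monotone-high (λ i → p (fsuc i)) (λ i → mono (fsuc i)) fzero)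
      monotone-high {suc n} p mono (fsuc j) = monotone-high (λ i → p (fsuc i)) (λ i → mono (fsuc i)) j

      -- The type `X` is left free because the division points appear both as elements of `𝕀` and as
      -- mere indices.
      sum-telescope : ∀ {a} {X : Set a} (F : X → ℂ) {n} (p : Fin (suc n) → X) →
                      sumᶜ (λ j → F (p (fsuc j)) -ᶜ F (p (inject₁ j))) ≈ᶜ F (p (fromℕ n)) -ᶜ F (p fzero)
      sum-telescope F {zero}  p = 𝓒.sym (𝓒.-‿inverseʳ (F (p fzero)))
      sum-telescope F {suc n} p = 𝓒.trans (𝓒.+-congˡ (sum-telescope F (λ j → p (fsuc j))))
        (solveᶜ 3 (λ x y z → (y ⊖ x) ⊕ (z ⊖ y) ⊜ z ⊖ x) (F (p fzero)) (F (p (fsuc fzero))) (F (p (fromℕ (suc n)))))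

      sum-Box : ∀ {n} (z : Fin n → ℂ) (w : Fin n → ℝ) {B} →
                (∀ j → Box (z j) (B * w j)) → Box (sumᶜ z) (B * re (sumᶜ (λ j → ι (w j))))
      sum-Box {zero}  z w {B} h = Box-mono (≤-reflexive (𝓡.sym (𝓡.zeroʳ B))) Box-0
      sum-Box {suc n} z w {B} h = Box-mono (≤-reflexive (𝓡.sym (𝓡.distribˡ B _ _)))
        (Box-+ (h fzero) (sum-Box (λ j → z (fsuc j)) (λ j → w (fsuc j)) (λ j → h (fsuc j))))

      sum-- : ∀ {n} (z w : Fin n → ℂ) → sumᶜ z -ᶜ sumᶜ w ≈ᶜ sumᶜ (λ j → z j -ᶜ w j)
      sum-- {zero}  z w = 𝓒.-‿inverseʳ _
      sum-- {suc n} z w = 𝓒.trans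
        (solveᶜ 4 (λ a b x y → (a ⊕ x) ⊖ (b ⊕ y) ⊜ (a ⊖ b) ⊕ (x ⊖ y)) (z fzero) (w fzero) _ _)
        (𝓒.+-congˡ (sum-- (λ j → z (fsuc j)) (λ j → w (fsuc j))))

    module Partition (P : TaggedPartition) where
      open TaggedPartition P using (size; first; last; lower; upper) renaming (point to p; tag to τ; width to w)

      abstract
        mono : ∀ j → p (inject₁ j) ≤ p (fsuc j)
        mono j = ≤-trans (lower j) (upper j)

        0≤w : ∀ j → 0# ≤ w j
        0≤w j = x≤y⇒0≤y-x (mono j)

        0≤p : ∀ j → 0# ≤ p j
        0≤p j = ≤-trans (≤-reflexive (𝓡.sym first)) (monotone-low p mono j)

        p≤1 : ∀ j → p j ≤ 1#
        p≤1 j = ≤-trans (monotone-high p mono j) (≤-reflexive last)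

        0≤τ : ∀ j → 0# ≤ τ j
        0≤τ j = ≤-trans (0≤p (inject₁ j)) (lower j)

        τ≤1 : ∀ j → τ j ≤ 1#
        τ≤1 j = ≤-trans (upper j) (p≤1 (fsuc j))

      p𝕀 : Fin (suc size) → 𝕀
      p𝕀 j = point (p j) (0≤p j) (p≤1 j)

      τ𝕀 : Fin size → 𝕀
      τ𝕀 j = point (τ j) (0≤τ j) (τ≤1 j)

      abstract
        Σw≈1 : re (sumᶜ (λ j → ι (w j))) ≈ 1#
        Σw≈1 = re-≈ (𝓒.trans (Sumᶜ.sum-cong-≋ (λ j → ι-- (p (fsuc j)) (p (inject₁ j))))
          (𝓒.trans (sum-telescope (λ j → ι (p j)) (λ j → j))
            (𝓒.trans (𝓒.sym (ι-- _ _))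
              (𝓡.trans (𝓡.+-cong last (𝓡.-‿cong first)) (solve 0 (con (+ 1) :- con (+ 0) := con (+ 1))) , 𝓡.refl))))

      sum : (𝕀 → ℂ) → ℂ
      sum φ = sumᶜ (λ j → φ (τ𝕀 j) *ᶜ ι (w j))

      abstract
        sum-bounded : ∀ {φ B} → (∀ t → Box (φ t) B) → Box (sum φ) B
        sum-bounded {φ} {B} h = Box-mono (≤-reflexive (𝓡.trans (𝓡.*-congˡ Σw≈1) (𝓡.*-identityʳ B)))
          (sum-Box _ w (λ j → Box-*ι (0≤w j) (h (τ𝕀 j))))

        sum-cong : ∀ {φ ψ} → (∀ t → φ t ≈ᶜ ψ t) → sum φ ≈ᶜ sum ψ
        sum-cong h = Sumᶜ.sum-cong-≋ (λ j → 𝓒.*-congʳ (h (τ𝕀 j)))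

        sum-+ : ∀ φ ψ → sum (λ t → φ t +ᶜ ψ t) ≈ᶜ sum φ +ᶜ sum ψ
        sum-+ φ ψ = 𝓒.trans (Sumᶜ.sum-cong-≋ (λ j → 𝓒.distribʳ (ι (w j)) (φ (τ𝕀 j)) (ψ (τ𝕀 j))))
          (Sumᶜ.∑-distrib-+ (λ j → φ (τ𝕀 j) *ᶜ ι (w j)) (λ j → ψ (τ𝕀 j) *ᶜ ι (w j)))

        sum-* : ∀ z φ → sum (λ t → z *ᶜ φ t) ≈ᶜ z *ᶜ sum φ
        sum-* z φ = 𝓒.trans (Sumᶜ.sum-cong-≋ (λ j → 𝓒.*-assoc z (φ (τ𝕀 j)) (ι (w j))))
          (𝓒.sym (Sumᶜ.*-distribˡ-sum z (λ j → φ (τ𝕀 j) *ᶜ ι (w j))))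

    open Partition using (sum)

    record Int (φ : 𝕀 → ℂ) (I : ℂ) : Set (c ⊔ ℓ₁ ⊔ ℓ₂) where
      constructor int
      field
        approach : ∀ ε → 0# < ε → ∃[ δ ] 0# < δ × (∀ P → (∀ j → width P j < δ) → Box (sum P φ -ᶜ I) ε)

    abstract
      fromNat-pos : ∀ n → 0# ≤ fromNat n
      fromNat-pos zero    = ≤-refl
      fromNat-pos (suc n) = 0≤+ 0≤1 (fromNat-pos n)

      -- Convergence speaks only of fine partitions, so bounds on an integral, and hence its
      -- uniqueness, depend on the existence of one. Equal parts suffice, their number coming from
      -- the Archimedean property.
      fine-partition : ∀ {δ} → 0# < δ → ∃[ P ] (∀ j → width P j < δ)
      fine-partition {δ} 0<δ = uniform (inverse⁺ 0<δ)
        where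
        module _ (n : ℕ) (1<δn : 1# < δ * fromNat (suc n)) (s : ℝ) (0<s : 0# < s) (ns≈1 : fromNat (suc n) * s ≈ 1#) where
          p : Fin (suc (suc n)) → ℝ
          p j = fromNat (toℕ j) * s

          p-inject₁ : ∀ j → p (inject₁ j) ≡ fromNat (toℕ j) * s
          p-inject₁ j = ≡.cong (λ k → fromNat k * s) (toℕ-inject₁ j)

          step : ∀ j → p (fsuc j) - p (inject₁ j) ≈ s
          step j = 𝓡.trans (𝓡.+-congˡ (𝓡.-‿cong (𝓡.reflexive (p-inject₁ j))))
            (solve 2 (λ m s → (con (+ 1) :+ m) :* s :- m :* s := s) (fromNat (toℕ j)) s)

          P : TaggedPartition
          P = record
            { size = suc n ; point = p ; tag = λ j → p (inject₁ j)
            ; first = 𝓡.zeroˡ s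
            ; last = 𝓡.trans (𝓡.reflexive (≡.cong (λ k → fromNat k * s) (toℕ-fromℕ (suc n)))) ns≈1
            ; lower = λ j → ≤-refl
            ; upper = λ j → ≤-by (<⇒≤ 0<s) (step j)
            }

          s<δ : s < δ
          s<δ = <-by (*-pos 0<s (x<y⇒0<y-x 1<δn))
            (𝓡.trans (𝓡.+-congʳ (x≈x*yr δ ns≈1))
              (solve 3 (λ s d n → d :* (n :* s) :- s := s :* (d :* n :- con (+ 1))) s δ (fromNat (suc n))))

          fine : ∃[ P ] (∀ j → width P j < δ)
          fine = P , λ j → <-resp-≈ (𝓡.sym (step j)) 𝓡.refl s<δ

        invert : ∀ n → 1# < δ * fromNat (suc n) → ∃[ s ] 0# < s × fromNat (suc n) * s ≈ 1# → ∃[ P ] (∀ j → width P j < δ)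
        invert n 1<δn (s , 0<s , ns≈1) = fine n 1<δn s 0<s ns≈1

        large : ∀ r → 0# < r → δ * r ≈ 1# → ∃[ n ] r < fromNat n → ∃[ P ] (∀ j → width P j < δ)
        -- From r = 1/δ < n follows 1 < δ(n + 1); n + 1 parts are taken so that their number is
        -- invertible.
        large r 0<r δr≈1 (n , r<n) = invert n
          (<-resp-≈ δr≈1 𝓡.refl (<-by (*-pos 0<δ (0<+ 0<1 (<⇒≤ (x<y⇒0<y-x r<n))))
            (solve 3 (λ d r n → d :* (con (+ 1) :+ n) :- d :* r := d :* (con (+ 1) :+ (n :- r))) δ r (fromNat n))))
          (inverse⁺ (0<fromNat (suc n)))

        uniform : ∃[ r ] 0# < r × δ * r ≈ 1# → ∃[ P ] (∀ j → width P j < δ)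
        uniform (r , 0<r , δr≈1) = large r 0<r δr≈1 (archimedean r)

      Int-cong : ∀ {φ ψ I J} → (∀ t → φ t ≈ᶜ ψ t) → I ≈ᶜ J → Int φ I → Int ψ J
      Int-cong {φ} {ψ} φ≈ψ I≈J (int h) = int λ ε 0<ε → let δ , 0<δ , close = h ε 0<ε in
        δ , 0<δ , λ P fine → Box-cong (𝓒.+-cong (Partition.sum-cong P {φ} {ψ} φ≈ψ) (𝓒.-‿cong I≈J)) (close P fine)

      Int-+ : ∀ {φ ψ I J} → Int φ I → Int ψ J → Int (λ t → φ t +ᶜ ψ t) (I +ᶜ J)
      Int-+ {φ} {ψ} {I} {J} (int hφ) (int hψ) = int λ ε 0<ε → halves ε (half 0<ε)
        where
        combine : ∀ {ε ε′ δ₁ δ₂} → ε′ + ε′ ≈ ε →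
                  (∀ P → (∀ j → width P j < δ₁) → Box (sum P φ -ᶜ I) ε′) →
                  (∀ P → (∀ j → width P j < δ₂) → Box (sum P ψ -ᶜ J) ε′) →
                  ∃[ δ ] 0# < δ × δ ≤ δ₁ × δ ≤ δ₂ →
                  ∃[ δ ] 0# < δ × (∀ P → (∀ j → width P j < δ) → Box (sum P (λ t → φ t +ᶜ ψ t) -ᶜ (I +ᶜ J)) ε)
        combine eq close₁ close₂ (δ , 0<δ , δ≤δ₁ , δ≤δ₂) = δ , 0<δ , λ P fine →
          Box-mono (≤-reflexive eq) (Box-cong
            (𝓒.trans (solveᶜ 4 (λ a b x y → (a ⊖ x) ⊕ (b ⊖ y) ⊜ (a ⊕ b) ⊖ (x ⊕ y)) (sum P φ) (sum P ψ) I J)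
              (𝓒.+-congʳ (𝓒.sym (Partition.sum-+ P φ ψ))))
            (Box-+ (close₁ P (λ j → <-≤-trans (fine j) δ≤δ₁)) (close₂ P (λ j → <-≤-trans (fine j) δ≤δ₂))))

        halves : ∀ ε → ∃[ ε′ ] 0# < ε′ × ε′ + ε′ ≈ ε →
                 ∃[ δ ] 0# < δ × (∀ P → (∀ j → width P j < δ) → Box (sum P (λ t → φ t +ᶜ ψ t) -ᶜ (I +ᶜ J)) ε)
        halves ε (ε′ , 0<ε′ , eq) =
          let δ₁ , 0<δ₁ , close₁ = hφ ε′ 0<ε′
              δ₂ , 0<δ₂ , close₂ = hψ ε′ 0<ε′
          in combine eq close₁ close₂ (lower-bound 0<δ₁ 0<δ₂)

      Int-* : ∀ {φ I} z → Int φ I → Int (λ t → z *ᶜ φ t) (z *ᶜ I)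
      Int-* {φ} {I} z (int h) = int λ ε 0<ε → scale (scaled-below (0≤+ 0≤1 (0≤* (0≤ᴺ z) 0≤2)) 0<ε)
        where
        K : ℝ
        K = 1# + ∣ z ∣² * 2#
        scale : ∀ {ε} → ∃[ ε′ ] 0# < ε′ × K * ε′ ≤ ε →
                ∃[ δ ] 0# < δ × (∀ P → (∀ j → width P j < δ) → Box (sum P (λ t → z *ᶜ φ t) -ᶜ z *ᶜ I) ε)
        scale (ε′ , 0<ε′ , Kε′≤ε) = let δ , 0<δ , close = h ε′ 0<ε′ in δ , 0<δ , λ P fine →
          Box-mono Kε′≤ε (Box-cong
            (𝓒.trans (solveᶜ 3 (λ z s i → z ⊗ (s ⊖ i) ⊜ z ⊗ s ⊖ z ⊗ i) z (sum P φ) I)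
              (𝓒.+-congʳ (𝓒.sym (Partition.sum-* P z φ))))
            (Box-* z (<⇒≤ 0<ε′) (close P fine)))

      Int-- : ∀ {φ ψ I J} → Int φ I → Int ψ J → Int (λ t → φ t -ᶜ ψ t) (I -ᶜ J)
      Int-- {φ} {ψ} {I} {J} hφ hψ = Int-cong (λ t → 𝓒.+-congˡ (-1*x≈-x (ψ t))) (𝓒.+-congˡ (-1*x≈-x J))
        (Int-+ hφ (Int-* (-ᶜ ι 1#) hψ))

      -- The weights of a partition sum to 1, so every Riemann sum obeys the bound `B`; the integral
      -- is within ε of such a sum for each ε.
      Int-bounded : ∀ {φ I B} → Int φ I → (∀ t → Box (φ t) B) → Box I B
      Int-bounded {φ} {I} {B} (int h) bound = Box-≤+ε λ ε 0<ε →
        let δ , 0<δ , close = h ε 0<ε in approximate close (fine-partition 0<δ)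
        where
        approximate : ∀ {δ ε} → (∀ P → (∀ j → width P j < δ) → Box (sum P φ -ᶜ I) ε) →
                      ∃[ P ] (∀ j → width P j < δ) → Box I (B + ε)
        approximate close (P , fine) = Box-cong (solveᶜ 2 (λ s i → s ⊕ ⊝ (s ⊖ i) ⊜ i) (sum P φ) I)
          (Box-+ (Partition.sum-bounded P {φ} bound) (Box-neg (close P fine)))

      -- I - J is an integral of the zero function, so it is bounded by 0.
      Int-unique : ∀ {φ ψ I J} → (∀ t → φ t ≈ᶜ ψ t) → Int φ I → Int ψ J → I ≈ᶜ J
      Int-unique {φ} {ψ} {I} {J} φ≈ψ hφ hψ = 𝓒.trans
        (solveᶜ 2 (λ i j → i ⊜ (i ⊖ j) ⊕ j) I J)
        (𝓒.trans (𝓒.+-congʳ (Box-0⇒≈0 (Int-bounded (Int-- hφ hψ) λ t → Box-cong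
          (𝓒.sym (𝓒.trans (𝓒.+-congʳ (φ≈ψ t)) (𝓒.-‿inverseʳ (ψ t)))) Box-0)))
          (𝓒.+-identityˡ J))

  open Integration

  -- Uniform differentiability and the fundamental theorem of calculus

  module Differentiation where

    Bounded : (𝕀 → ℂ) → Set (c ⊔ ℓ₂)
    Bounded F = ∃[ M ] 0# ≤ M × (∀ t → ∣ F t ∣² ≤ M)

    Δ : 𝕀 → 𝕀 → ℝ
    Δ s t = val t - val s

    Quadratic : (𝕀 → 𝕀 → ℂ) → Set (c ⊔ ℓ₂)
    Quadratic E = ∃[ M ] 0# ≤ M × (∀ s t → ∣ E s t ∣² ≤ M * (Δ s t * Δ s t * (Δ s t * Δ s t)))

    remainder : (F f : 𝕀 → ℂ) → 𝕀 → 𝕀 → ℂ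
    remainder F f s t = F t -ᶜ F s -ᶜ f s *ᶜ ι (Δ s t)

    -- Every function met here has a uniformly quadratic remainder.  The bounds are on squared moduli because ∣_∣² is
    -- multiplicative and needs no square roots; hence the fourth power of Δ in `Quadratic`.
    record Diff (F f : 𝕀 → ℂ) : Set (c ⊔ ℓ₂) where
      constructor diff
      field
        F-bounded : Bounded F
        f-bounded : Bounded f
        quadratic : Quadratic (remainder F f)

    abstract
      ι-* : ∀ x y → ι (x * y) ≈ᶜ ι x *ᶜ ι y
      ι-* x y = solve 2 (λ x y → x :* y := x :* y :- con (+ 0) :* con (+ 0)) x y
              , solve 2 (λ x y → con (+ 0) := x :* con (+ 0) :+ con (+ 0) :* y) x y

      Bounded-cong : ∀ {F G} → (∀ t → F t ≈ᶜ G t) → Bounded F → Bounded G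
      Bounded-cong F≈G (M , 0≤M , b) = M , 0≤M , λ t → ≤-resp-≈ (ᴺ-cong (F≈G t)) 𝓡.refl (b t)

      Bounded-const : ∀ z → Bounded (λ _ → z)
      Bounded-const z = ∣ z ∣² , 0≤ᴺ z , λ _ → ≤-refl

      Bounded-+ : ∀ {F G} → Bounded F → Bounded G → Bounded (λ t → F t +ᶜ G t)
      Bounded-+ (M , 0≤M , b) (M′ , 0≤M′ , b′) = 2# * (M + M′) , 0≤* 0≤2 (0≤+ 0≤M 0≤M′) ,
        λ t → ≤-trans (ᴺ-+ _ _) (*-monoˡ-≤ 0≤2 (+-mono-≤ (b t) (b′ t)))

      Bounded-* : ∀ {F G} → Bounded F → Bounded G → Bounded (λ t → F t *ᶜ G t)
      Bounded-* {F} (M , 0≤M , b) (M′ , 0≤M′ , b′) = M * M′ , 0≤* 0≤M 0≤M′ ,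
        λ t → ≤-resp-≈ (𝓡.sym (ᴺ-* _ _)) 𝓡.refl (*-mono-≤ (0≤ᴺ (F t)) 0≤M′ (b t) (b′ t))

      Bounded-val : Bounded (λ t → ι (val t))
      Bounded-val = 1# * 1# , 0≤* 0≤1 0≤1 , λ t → ≤-resp-≈ (𝓡.sym (ᴺ-ι (val t))) 𝓡.refl
        (*-mono-≤ (0≤val t) 0≤1 (val≤1 t) (val≤1 t))

      Quadratic-cong : ∀ {E G} → (∀ s t → E s t ≈ᶜ G s t) → Quadratic E → Quadratic G
      Quadratic-cong E≈G (M , 0≤M , b) = M , 0≤M , λ s t → ≤-resp-≈ (ᴺ-cong (E≈G s t)) 𝓡.refl (b s t)

      Quadratic-+ : ∀ {E G} → Quadratic E → Quadratic G → Quadratic (λ s t → E s t +ᶜ G s t)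
      Quadratic-+ (M , 0≤M , b) (M′ , 0≤M′ , b′) = 2# * (M + M′) , 0≤* 0≤2 (0≤+ 0≤M 0≤M′) ,
        λ s t → ≤-trans (ᴺ-+ _ _) (≤-resp-≈ 𝓡.refl
          (solve 4 (λ k a b h → k :* (a :* h :+ b :* h) := k :* (a :+ b) :* h) 2# M M′ _)
          (*-monoˡ-≤ 0≤2 (+-mono-≤ (b s t) (b′ s t))))

      0≤Δ⁴ : ∀ s t → 0# ≤ Δ s t * Δ s t * (Δ s t * Δ s t)
      0≤Δ⁴ s t = 0≤sq (Δ s t * Δ s t)

      Quadratic-* : ∀ {B E : 𝕀 → 𝕀 → ℂ} M → 0# ≤ M → (∀ s t → ∣ B s t ∣² ≤ M) → Quadratic E →
                    Quadratic (λ s t → B s t *ᶜ E s t)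
      Quadratic-* {B} M 0≤M b (M′ , 0≤M′ , b′) = M * M′ , 0≤* 0≤M 0≤M′ , λ s t →
        ≤-resp-≈ (𝓡.sym (ᴺ-* _ _)) (𝓡.sym (𝓡.*-assoc M M′ _))
          (*-mono-≤ (0≤ᴺ (B s t)) (0≤* 0≤M′ (0≤Δ⁴ s t)) (b s t) (b′ s t))

      Quadratic-Δ² : Quadratic (λ s t → ι (Δ s t) *ᶜ ι (Δ s t))
      Quadratic-Δ² = 1# , 0≤1 , λ s t → ≤-reflexive (𝓡.trans (ᴺ-* _ _)
        (𝓡.trans (𝓡.*-cong (ᴺ-ι _) (ᴺ-ι _)) (𝓡.sym (𝓡.*-identityˡ _))))

      Diff-cong : ∀ {F F′ f f′} → (∀ t → F t ≈ᶜ F′ t) → (∀ t → f t ≈ᶜ f′ t) → Diff F f → Diff F′ f′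
      Diff-cong p q (diff b b′ r) = diff (Bounded-cong p b) (Bounded-cong q b′) (Quadratic-cong
        (λ s t → 𝓒.+-cong (𝓒.+-cong (p t) (𝓒.-‿cong (p s))) (𝓒.-‿cong (𝓒.*-congʳ (q s)))) r)

      Quadratic-0 : Quadratic (λ _ _ → ι 0#)
      Quadratic-0 = 0# , ≤-refl , λ s t → ≤-reflexive (𝓡.trans (ᴺ-ι 0#)
        (solve 1 (λ h → con (+ 0) :* con (+ 0) := con (+ 0) :* h) _))

      Diff-const : ∀ z → Diff (λ _ → z) (λ _ → ι 0#)
      Diff-const z = diff (Bounded-const z) (Bounded-const _)
        (Quadratic-cong (λ s t → solveᶜ 2 (λ z h → conᶜ (+ 0) ⊜ (z ⊖ z) ⊖ conᶜ (+ 0) ⊗ h) z _) Quadratic-0)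

      Diff-line : ∀ z w → Diff (λ t → z +ᶜ ι (val t) *ᶜ w) (λ _ → w)
      Diff-line z w = diff (Bounded-+ (Bounded-const z) (Bounded-* Bounded-val (Bounded-const w))) (Bounded-const w)
        (Quadratic-cong (λ s t → 𝓒.trans
          (solveᶜ 4 (λ z w x y → conᶜ (+ 0) ⊜ ((z ⊕ x ⊗ w) ⊖ (z ⊕ y ⊗ w)) ⊖ w ⊗ (x ⊖ y)) z w (ι (val t)) (ι (val s)))
          (𝓒.+-congˡ (𝓒.-‿cong (𝓒.*-congˡ (𝓒.sym (ι-- (val t) (val s))))))) Quadratic-0)

      Diff-+ : ∀ {F f G g} → Diff F f → Diff G g → Diff (λ t → F t +ᶜ G t) (λ t → f t +ᶜ g t)
      Diff-+ {F} {f} {G} {g} (diff b b′ q) (diff d d′ r) = diff (Bounded-+ b d) (Bounded-+ b′ d′)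
        (Quadratic-cong (λ s t → solveᶜ 7 (λ Ft Fs Gt Gs f g h →
          ((Ft ⊖ Fs) ⊖ f ⊗ h) ⊕ ((Gt ⊖ Gs) ⊖ g ⊗ h) ⊜ ((Ft ⊕ Gt) ⊖ (Fs ⊕ Gs)) ⊖ (f ⊕ g) ⊗ h)
          (F t) (F s) (G t) (G s) (f s) (g s) (ι (Δ s t))) (Quadratic-+ q r))

      -- With h the increment from s to t, the remainder of FG is G(t) times the remainder of F,
      -- plus F(s) + f(s)h times the remainder of G, plus f(s)g(s)h². The boundedness fields of
      -- `Diff` exist to control these coefficients.
      Diff-* : ∀ {F f G g} → Diff F f → Diff G g →
               Diff (λ t → F t *ᶜ G t) (λ t → f t *ᶜ G t +ᶜ F t *ᶜ g t)
      Diff-* {F} {f} {G} {g} (diff b@(A , 0≤A , F≤A) b′@(A′ , 0≤A′ , f≤A′) q)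
        (diff d@(B , 0≤B , G≤B) d′@(B′ , 0≤B′ , g≤B′) r) = diff
        (Bounded-* b d) (Bounded-+ (Bounded-* b′ d) (Bounded-* b d′))
        (Quadratic-cong (λ s t → solveᶜ 7 (λ Ft Fs Gt Gs f g h →
            (Gt ⊗ ((Ft ⊖ Fs) ⊖ f ⊗ h) ⊕ (Fs ⊕ f ⊗ h) ⊗ ((Gt ⊖ Gs) ⊖ g ⊗ h)) ⊕ (f ⊗ g) ⊗ (h ⊗ h)
            ⊜ (Ft ⊗ Gt ⊖ Fs ⊗ Gs) ⊖ (f ⊗ Gs ⊕ Fs ⊗ g) ⊗ h)
            (F t) (F s) (G t) (G s) (f s) (g s) (ι (Δ s t)))
          (Quadratic-+ (Quadratic-+
            (Quadratic-* B 0≤B (λ s t → G≤B t) q)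
            (Quadratic-* (2# * (A + A′ * Δ²)) (0≤* 0≤2 (0≤+ 0≤A (0≤* 0≤A′ 0≤Δ²)))
              (λ s t → ≤-trans (ᴺ-+ _ _) (*-monoˡ-≤ 0≤2 (+-mono-≤ (F≤A s)
                (≤-resp-≈ (𝓡.sym (ᴺ-* _ _)) 𝓡.refl (*-mono-≤ (0≤ᴺ (f s)) 0≤Δ² (f≤A′ s) (Δ-bound s t)))))) r))
            (Quadratic-* (A′ * B′) (0≤* 0≤A′ 0≤B′)
              (λ s t → ≤-resp-≈ (𝓡.sym (ᴺ-* _ _)) 𝓡.refl (*-mono-≤ (0≤ᴺ (f s)) 0≤B′ (f≤A′ s) (g≤B′ s))) Quadratic-Δ²)))
        where
        Δ² : ℝ
        Δ² = 1# * 1#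
        0≤Δ² : 0# ≤ Δ²
        0≤Δ² = 0≤sq 1#
        Δ-bound : ∀ s t → ∣ ι (Δ s t) ∣² ≤ Δ²
        Δ-bound s t = ≤-resp-≈ (𝓡.sym (ᴺ-ι _)) 𝓡.refl (∣x∣≤y⇒sq≤sq
          (≤-by (0≤+ (x≤y⇒0≤y-x (val≤1 t)) (0≤val s))
            (solve 2 (λ s t → con (+ 1) :- (t :- s) := (con (+ 1) :- t) :+ s) (val s) (val t)))
          (≤-by (0≤+ (x≤y⇒0≤y-x (val≤1 s)) (0≤val t))
            (solve 2 (λ s t → con (+ 1) :- (:- (t :- s)) := (con (+ 1) :- s) :+ t) (val s) (val t))))

      -- A quadratic remainder over a zero increment vanishes. This is needed because the extreme
      -- points of a partition are only `≈` to 0 and 1 and carry their own bound proofs.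
      Diff-resp-≈ : ∀ {F f} → Diff F f → ∀ {s t} → val s ≈ val t → F s ≈ᶜ F t
      Diff-resp-≈ {F} {f} (diff _ _ (M , _ , b)) {s} {t} s≈t = 𝓒.trans
        (solveᶜ 3 (λ x y e → x ⊜ y ⊖ (((y ⊖ x) ⊖ e) ⊕ e)) (F s) (F t) (f s *ᶜ ι (Δ s t)))
        (𝓒.trans (𝓒.+-congˡ (𝓒.-‿cong (𝓒.+-cong
            (ᴺ≤0⇒≈0 (≤-trans (b s t) (≤-reflexive (𝓡.trans (𝓡.*-congˡ (𝓡.*-congʳ (𝓡.*-congʳ Δ≈0)))
              (solve 2 (λ M h → M :* (con (+ 0) :* h :* (h :* h)) := con (+ 0)) M (Δ s t))))))
            (𝓒.trans (𝓒.*-congˡ (Δ≈0 , 𝓡.refl)) (𝓒.zeroʳ (f s))))))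
          (solveᶜ 1 (λ y → y ⊖ (conᶜ (+ 0) ⊕ conᶜ (+ 0)) ⊜ y) (F t)))
        where
        Δ≈0 : Δ s t ≈ 0#
        Δ≈0 = 𝓡.trans (𝓡.+-congˡ (𝓡.-‿cong s≈t)) (𝓡.-‿inverseʳ (val t))

      -- On a cell with tag τ and width w, the error f(τ)w - (F(y) - F(x)) is the remainder from τ
      -- to x minus the remainder from τ to y. Both distances are at most w < δ, so each remainder
      -- is at most Kδw, and the errors add up to at most 2Kδ.
      fundamental-theorem : ∀ {F f} → Diff F f → Int f (F 𝟙 -ᶜ F 𝟘)
      fundamental-theorem {F} {f} D@(diff _ _ (M , 0≤M , b)) = int λ ε 0<ε → conclude (scaled-below (0≤* 0≤2 0≤K) 0<ε)
        where
        K : ℝ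
        K = 1# + M
        0≤K : 0# ≤ K
        0≤K = 0≤+ 0≤1 0≤M
        remainder-Box : ∀ s t → Box (remainder F f s t) (K * (Δ s t * Δ s t))
        remainder-Box s t = ᴺ≤scaled⇒Box 0≤M (0≤sq (Δ s t)) (b s t)

        module _ (ε δ : ℝ) (0<δ : 0# < δ) (2Kδ≤ε : 2# * K * δ ≤ ε) (P : TaggedPartition) (fine : ∀ j → width P j < δ) where
          open TaggedPartition P using (size; first; last; lower; upper) renaming (point to p; tag to τ; width to w)
          open Partition P

          square≤ : ∀ j {x} → 0# ≤ x → x ≤ w j → x * x ≤ δ * w j
          square≤ j 0≤x x≤w = *-mono-≤ 0≤x (0≤w j) (≤-trans x≤w (<⇒≤ (fine j))) x≤w

          Box-right : ∀ j → Box (remainder F f (τ𝕀 j) (p𝕀 (fsuc j))) (K * (δ * w j))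
          Box-right j = Box-mono (*-monoˡ-≤ 0≤K (square≤ j (x≤y⇒0≤y-x (upper j))
            (≤-by (x≤y⇒0≤y-x (lower j)) (solve 3 (λ x t y → (y :- x) :- (y :- t) := t :- x) (p (inject₁ j)) (τ j)
              (p (fsuc j))))))
            (remainder-Box _ _)

          Box-left : ∀ j → Box (remainder F f (τ𝕀 j) (p𝕀 (inject₁ j))) (K * (δ * w j))
          Box-left j = Box-mono (*-monoˡ-≤ 0≤K (≤-resp-≈
              (solve 2 (λ x t → (t :- x) :* (t :- x) := (x :- t) :* (x :- t)) (p (inject₁ j)) (τ j)) 𝓡.refl
              (square≤ j (x≤y⇒0≤y-x (lower j))
                (≤-by (x≤y⇒0≤y-x (upper j)) (solve 3 (λ x t y → (y :- x) :- (t :- x) := y :- t) (p (inject₁ j)) (τ j)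
                  (p (fsuc j)))))))
            (remainder-Box _ _)

          error : Fin size → ℂ
          error j = f (τ𝕀 j) *ᶜ ι (w j) -ᶜ (F (p𝕀 (fsuc j)) -ᶜ F (p𝕀 (inject₁ j)))

          error-remainder : ∀ j → remainder F f (τ𝕀 j) (p𝕀 (inject₁ j)) +ᶜ (-ᶜ remainder F f (τ𝕀 j) (p𝕀 (fsuc j))) ≈ᶜ error j
          error-remainder j = 𝓒.trans
            (solveᶜ 6 (λ Fx Ft Fy f h k → ((Fx ⊖ Ft) ⊖ f ⊗ h) ⊕ ⊝ ((Fy ⊖ Ft) ⊖ f ⊗ k) ⊜ f ⊗ (k ⊖ h) ⊖ (Fy ⊖ Fx))
              (F (p𝕀 (inject₁ j))) (F (τ𝕀 j)) (F (p𝕀 (fsuc j))) (f (τ𝕀 j)) _ _)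
            (𝓒.+-congʳ (𝓒.*-congˡ (𝓒.trans (𝓒.sym (ι-- _ _))
              (solve 3 (λ x t y → (y :- t) :- (x :- t) := y :- x) (p (inject₁ j)) (τ j) (p (fsuc j)) , 𝓡.refl))))

          error-Box : ∀ j → Box (error j) (2# * K * δ * w j)
          error-Box j = Box-cong (error-remainder j) (Box-mono
            (≤-reflexive (solve 3 (λ K d w → K :* (d :* w) :+ K :* (d :* w) :=
              (con (+ 1) :+ con (+ 1)) :* K :* d :* w) K δ (w j)))
            (Box-+ (Box-left j) (Box-neg (Box-right j))))

          total : Box (sum f -ᶜ (F 𝟙 -ᶜ F 𝟘)) ε
          total = Box-mono (≤-trans (≤-reflexive (𝓡.trans (𝓡.*-congˡ Σw≈1) (𝓡.*-identityʳ _))) 2Kδ≤ε)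
            (Box-cong (𝓒.trans (𝓒.sym (sum-- (λ j → f (τ𝕀 j) *ᶜ ι (w j)) (λ j → F (p𝕀 (fsuc j)) -ᶜ F (p𝕀 (inject₁ j)))))
                (𝓒.+-congˡ (𝓒.-‿cong (𝓒.trans (sum-telescope F p𝕀)
                  (𝓒.+-cong (Diff-resp-≈ D last) (𝓒.-‿cong (Diff-resp-≈ D first)))))))
              (sum-Box error w error-Box))

        conclude : ∀ {ε} → ∃[ δ ] 0# < δ × 2# * K * δ ≤ ε → ∃[ δ ] 0# < δ ×
          (∀ P → (∀ j → width P j < δ) → Box (Partition.sum P f -ᶜ (F 𝟙 -ᶜ F 𝟘)) ε)
        conclude (δ , 0<δ , 2Kδ≤ε) = δ , 0<δ , total _ δ 0<δ 2Kδ≤ε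

      integrand-term : ∀ z w β → z *ᶜ ι β *ᶜ ι w ≈ᶜ z *ᶜ ι (w * β)
      integrand-term z w β = 𝓒.trans (solveᶜ 3 (λ z w β → z ⊗ β ⊗ w ⊜ z ⊗ (w ⊗ β)) z (ι w) (ι β))
        (𝓒.*-congˡ (𝓒.sym (ι-* w β)))

      -- The factor b - a moves from the cell widths into the integrand, and `inside` fixes the
      -- domain proofs.
      HasIntegral⇒Int : ∀ {D f a b I} (H : HasIntegral D f a b I) →
        Int (λ t → f (HasIntegral.at H (val t)) (HasIntegral.inside H (val t) (0≤val t) (val≤1 t)) *ᶜ ι (b - a)) I
      HasIntegral⇒Int {D} {f} {a} {b} {I} H = int λ ε 0<ε → let δ , 0<δ , close = HasIntegral.converges H ε 0<ε in
        δ , 0<δ , λ P fine →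
          let (r₁ , r₂) , (i₁ , i₂) = close P fine
                (λ j → HasIntegral.inside H (tag P j) (Partition.0≤τ P j) (Partition.τ≤1 P j))
          in Box-cong (𝓒.+-congʳ (𝓒.sym (Sumᶜ.sum-cong-≋ (λ j → integrand-term _ (width P j) (b - a)))))
               (box (upper r₁) (lower r₂) (upper i₁) (lower i₂))
        where
        upper : ∀ {ε x y} → x < y + ε → x - y ≤ ε
        upper {ε} {x} {y} p = ≤-by (x≤y⇒0≤y-x (<⇒≤ p)) (solve 3 (λ x y e → e :- (x :- y) := (y :+ e) :- x) x y ε)
        lower : ∀ {ε x y} → y < x + ε → - (x - y) ≤ ε
        lower {ε} {x} {y} p = ≤-by (x≤y⇒0≤y-x (<⇒≤ p)) (solve 3 (λ x y e → e :- (:- (x :- y)) := (x :+ e) :- y) x y ε)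

      -- A Riemann sum may come with any domain proofs, so agreement with φ is required for all of
      -- them. Passing from ε to its half turns the weak bounds of `Box` into strict ones.
      Int⇒HasIntegral : ∀ {D} {f : Fun D} {a b I φ} → (∀ (t : 𝕀) → D (a + val t * (b - a))) →
        (∀ (t : 𝕀) d → f (a + val t * (b - a)) d *ᶜ ι (b - a) ≈ᶜ φ t) → Int φ I → HasIntegral D f a b I
      Int⇒HasIntegral {D} {f} {a} {b} {I} {φ} inside f≈φ (int h) = record
        { inside = λ s 0≤s s≤1 → inside (point s 0≤s s≤1)
        ; converges = λ ε 0<ε → conclude ε (half 0<ε)
        }
        where
        term : ∀ P (d : ∀ j → D (a + tag P j * (b - a))) j →
               φ (Partition.τ𝕀 P j) *ᶜ ι (width P j) ≈ᶜ f (a + tag P j * (b - a)) (d j) *ᶜ ι (width P j * (b - a))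
        term P d j = 𝓒.trans (𝓒.*-congʳ (𝓒.sym (f≈φ (Partition.τ𝕀 P j) (d j)))) (integrand-term _ (width P j) (b - a))

        upper : ∀ {ε η x y} → 0# < η → η + η ≈ ε → x - y ≤ η → x < y + ε
        upper {ε} {η} {x} {y} 0<η 2η≈ε p = <-by (0<+ 0<η (x≤y⇒0≤y-x p)) (𝓡.trans (𝓡.+-congʳ (𝓡.+-congˡ (𝓡.sym 2η≈ε)))
          (solve 3 (λ x y e → (y :+ (e :+ e)) :- x := e :+ (e :- (x :- y))) x y η))
        lower : ∀ {ε η x y} → 0# < η → η + η ≈ ε → - (x - y) ≤ η → y < x + ε
        lower {ε} {η} {x} {y} 0<η 2η≈ε p = <-by (0<+ 0<η (x≤y⇒0≤y-x p)) (𝓡.trans (𝓡.+-congʳ (𝓡.+-congˡ (𝓡.sym 2η≈ε)))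
          (solve 3 (λ x y e → (x :+ (e :+ e)) :- y := e :+ (e :- (:- (x :- y)))) x y η))

        riemannSum : (P : TaggedPartition) → (∀ j → D (a + tag P j * (b - a))) → ℂ
        riemannSum P d = sumᶜ (λ j → f (a + tag P j * (b - a)) (d j) *ᶜ ι (width P j * (b - a)))

        close : ∀ {ε η} → 0# < η → η + η ≈ ε → ∀ {z} → Box (z -ᶜ I) η → ∣ re z - re I ∣< ε × ∣ im z - im I ∣< ε
        close 0<η eq (box p q r s) = (upper 0<η eq p , lower 0<η eq q) , (upper 0<η eq r , lower 0<η eq s)

        conclude : ∀ ε → ∃[ η ] 0# < η × η + η ≈ ε → ∃[ δ ] 0# < δ ×
                   ((P : TaggedPartition) → (∀ j → width P j < δ) → (d : ∀ j → D (a + tag P j * (b - a))) →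
                     ∣ re (riemannSum P d) - re I ∣< ε × ∣ im (riemannSum P d) - im I ∣< ε)
        conclude ε (η , 0<η , 2η≈ε) = let δ , 0<δ , near = h η 0<η in
          δ , 0<δ , λ P fine d → close 0<η 2η≈ε (Box-cong (𝓒.+-congʳ (Sumᶜ.sum-cong-≋ (term P d))) (near P fine))

  open Differentiation

  -- Segments, half-planes and bounds on inverses

  module Line where

    line : ℂ → ℂ → 𝕀 → ℂ
    line z w t = z +ᶜ ι (val t) *ᶜ (w -ᶜ z)

    abstract
      line-𝟘 : ∀ z w → line z w 𝟘 ≈ᶜ z
      line-𝟘 = solveᶜ 2 (λ z w → z ⊕ conᶜ (+ 0) ⊗ (w ⊖ z) ⊜ z)

      line-𝟙 : ∀ z w → line z w 𝟙 ≈ᶜ w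
      line-𝟙 = solveᶜ 2 (λ z w → z ⊕ conᶜ (+ 1) ⊗ (w ⊖ z) ⊜ w)

      line-cong : ∀ {z z′ w w′} t → z ≈ᶜ z′ → w ≈ᶜ w′ → line z w t ≈ᶜ line z′ w′ t
      line-cong t p q = 𝓒.+-cong p (𝓒.*-congˡ (𝓒.+-cong q (𝓒.-‿cong p)))

      ᴺ-*-≤ : ∀ {z w A B} → 0# ≤ B → ∣ z ∣² ≤ A → ∣ w ∣² ≤ B → ∣ z *ᶜ w ∣² ≤ A * B
      ᴺ-*-≤ {z} {w} 0≤B p q = ≤-resp-≈ (𝓡.sym (ᴺ-* z w)) 𝓡.refl (*-mono-≤ (0≤ᴺ z) 0≤B p q)

      -- F(t) equals F(0) + f(0)t plus the remainder from 0 to t, so its boundedness follows from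
      -- the other two conditions.
      Diff-from-quadratic : ∀ {F f} → Bounded f → Quadratic (remainder F f) → Diff F f
      Diff-from-quadratic {F} {f} b@(A , 0≤A , f≤A) q@(M , 0≤M , r≤) = diff (Bounded-cong
          (λ t → 𝓒.trans (𝓒.+-congˡ (𝓒.+-congˡ (𝓒.*-congˡ (ι-- (val t) 0#))))
            (𝓒.trans (𝓒.+-congʳ (𝓒.+-congˡ (𝓒.-‿cong (𝓒.*-congˡ (ι-- (val t) 0#)))))
              (solveᶜ 4 (λ x y f h → ((x ⊖ y) ⊖ f ⊗ (h ⊖ conᶜ (+ 0))) ⊕ (y ⊕ f ⊗ (h ⊖ conᶜ (+ 0))) ⊜ x) (F t) (F 𝟘)
                (f 𝟘) (ι (val t)))))
          (Bounded-+ remainder-bounded (Bounded-+ (Bounded-const (F 𝟘)) (Bounded-* (Bounded-const (f 𝟘))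
            (Bounded-cong (λ t → solve 1 (λ x → x := x :- con (+ 0)) (val t) , 𝓡.refl) Bounded-val)))))
        b q
        where
        Δ≈val : ∀ t → Δ 𝟘 t ≈ val t
        Δ≈val t = solve 1 (λ x → x :- con (+ 0) := x) (val t)
        sq≤1 : ∀ {x} → 0# ≤ x → x ≤ 1# → x * x ≤ 1#
        sq≤1 0≤x x≤1 = ≤-trans (*-mono-≤ 0≤x 0≤1 x≤1 x≤1) (≤-reflexive (𝓡.*-identityʳ 1#))
        remainder-bounded : Bounded (λ t → remainder F f 𝟘 t)
        remainder-bounded = M , 0≤M , λ t → ≤-trans (r≤ 𝟘 t) (≤-trans
          (*-monoˡ-≤ 0≤M (≤-trans
            (≤-reflexive (𝓡.*-cong (𝓡.*-cong (Δ≈val t) (Δ≈val t)) (𝓡.*-cong (Δ≈val t) (Δ≈val t))))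
            (sq≤1 (0≤sq (val t)) (sq≤1 (0≤val t) (val≤1 t)))))
          (≤-reflexive (𝓡.*-identityʳ M)))

    -- HalfPlane β is convex, contains 1 and avoids (-∞, 0], so it contains the segments that define ln on it.
    slope : ℝ → ℂ → ℝ
    slope β z = re z + β * im z

    HalfPlane : ℝ → ℂ → Set ℓ₂
    HalfPlane β z = 0# < slope β z

    abstract
      HalfPlane-1 : ∀ {β} → HalfPlane β (ι 1#)
      HalfPlane-1 {β} = <-resp-≈ 𝓡.refl (solve 1 (λ β → con (+ 1) := con (+ 1) :+ β :* con (+ 0)) β) 0<1

      HalfPlane⇒Slit : ∀ {β z} → HalfPlane β z → Slit z
      HalfPlane⇒Slit {β} {z} h with 0<+⇒⊎ h
      ... | inj₁ 0<re = inj₁ 0<re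
      ... | inj₂ 0<βim = inj₂ (*#0⇒#0 {im z} {β} (inj₂ (<-resp-≈ 𝓡.refl (𝓡.*-comm β (im z)) 0<βim)))

      slope-line : ∀ {β m z w} t → m ≤ slope β z → m ≤ slope β w → m ≤ slope β (line z w t)
      slope-line {β} {m} {z} {w} t p q = ≤-by
        (0≤+ (0≤* (x≤y⇒0≤y-x (val≤1 t)) (x≤y⇒0≤y-x p)) (0≤* (0≤val t) (x≤y⇒0≤y-x q)))
        (solve 7 (λ β m a b d e t →
          (a :+ (t :* (d :- a) :- con (+ 0) :* (e :- b)) :+ β :* (b :+ (t :* (e :- b) :+ con (+ 0) :* (d :- a)))) :- m
          := (con (+ 1) :- t) :* ((a :+ β :* b) :- m) :+ t :* ((d :+ β :* e) :- m))
          β m (re z) (im z) (re w) (im w) (val t))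

      -- The slope along the segment is a convex combination of two positive numbers. A common lower
      -- bound m of the two makes it positive without deciding which weight is nonzero.
      HalfPlane-line : ∀ {β z w} t → HalfPlane β z → HalfPlane β w → HalfPlane β (line z w t)
      HalfPlane-line {β} {z} {w} t p q = below (lower-bound p q)
        where
        below : ∃[ m ] 0# < m × m ≤ slope β z × m ≤ slope β w → HalfPlane β (line z w t)
        below (m , 0<m , m≤z , m≤w) = <-≤-trans 0<m (slope-line t m≤z m≤w)

      0<1+sq : ∀ β → 0# < 1# + β * β
      0<1+sq β = 0<+ 0<1 (0≤sq β)

      -- The Cauchy-Schwarz inequality for (1, β) and (re z, im z), with the defect given by
      -- Lagrange's identity.
      slope²≤ : ∀ β z → slope β z * slope β z ≤ (1# + β * β) * ∣ z ∣²
      slope²≤ β z = ≤-by (0≤sq (im z - β * re z))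
        (solve 3 (λ β a b → (con (+ 1) :+ β :* β) :* (a :* a :+ b :* b) :- (a :+ β :* b) :* (a :+ β :* b)
          := (b :- β :* a) :* (b :- β :* a)) β (re z) (im z))

      HalfPlane⇒invertible : ∀ {β z} → HalfPlane β z → ∃[ y ] z *ᶜ y ≈ᶜ ι 1#
      HalfPlane⇒invertible {β} {z} h = recipᶜ z (inj₂ 0<N) , recipᶜ-inverseʳ z (inj₂ 0<N)
        where
        0<N : 0# < ∣ z ∣²
        0<N = 0<*⁻¹ (0<1+sq β) (<-≤-trans (*-pos h h) (slope²≤ β z))

      -- Multiply m² ≤ (1 + β²)∣z∣² by ∣y∣² = 1/∣z∣² and by r² = 1/m².
      inverse-bound : ∀ {β m r} → 0# ≤ m → m * r ≈ 1# → ∀ {z y} → m ≤ slope β z → z *ᶜ y ≈ᶜ ι 1# →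
                      ∣ y ∣² ≤ r * r * (1# + β * β)
      inverse-bound {β} {m} {r} 0≤m mr≈1 {z} {y} m≤ zy≈1 = ≤-resp-≈
        (𝓡.trans (solve 3 (λ m r n → r :* r :* (m :* m :* n) := (m :* r) :* (m :* r) :* n) m r ∣ y ∣²)
          (𝓡.trans (𝓡.*-congʳ (𝓡.*-cong mr≈1 mr≈1)) (solve 1 (λ n → con (+ 1) :* con (+ 1) :* n := n) ∣ y ∣²)))
        (𝓡.trans (𝓡.*-congˡ (𝓡.trans (𝓡.*-assoc _ _ _) (𝓡.*-congˡ zyN≈1)))
          (solve 2 (λ r k → r :* (k :* con (+ 1)) := r :* k) (r * r) (1# + β * β)))
        (*-monoˡ-≤ (0≤sq r) (*-mono-≤ (0≤sq m) (0≤ᴺ y)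
          (≤-trans (*-mono-≤ 0≤m (≤-trans 0≤m m≤) m≤ m≤) (slope²≤ β z)) ≤-refl))
        where
        zyN≈1 : ∣ z ∣² * ∣ y ∣² ≈ 1#
        zyN≈1 = 𝓡.trans (𝓡.sym (ᴺ-* z y)) (𝓡.trans (ᴺ-cong zy≈1) (𝓡.trans (ᴺ-ι 1#) (𝓡.*-identityʳ 1#)))

  open Line

  -- Differentiability and multiplicativity of the logarithm

  module Logarithm (ln : ∀ z → Slit z → ℂ) (isLn : IsLn ln) where

    ζ : ℂ → 𝕀 → ℂ
    ζ = line (ι 1#)

    abstract
      at≈val : ∀ t → 0# + val t * (1# - 0#) ≈ val t
      at≈val t = solve 1 (λ t → con (+ 0) :+ t :* (con (+ 1) :- con (+ 0)) := t) (val t)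

      ln-integrand : ∀ z s → Σ[ ψ ∈ (𝕀 → ℂ) ] (∀ t → ψ t *ᶜ ζ z t ≈ᶜ z -ᶜ ι 1#) × Int ψ (ln z s)
      ln-integrand z s = ψ , ψ*ζ , HasIntegral⇒Int (isLn z s)
        where
        ζ-at : 𝕀 → ℂ
        ζ-at t = ι 1# +ᶜ ι (0# + val t * (1# - 0#)) *ᶜ (z -ᶜ ι 1#)
        ζ#0 : ∀ t → ∣ ζ-at t ∣² # 0#
        ζ#0 t = HasIntegral.inside (isLn z s) (val t) (0≤val t) (val≤1 t)
        ψ : 𝕀 → ℂ
        ψ t = recipᶜ (ζ-at t) (ζ#0 t) *ᶜ (z -ᶜ ι 1#) *ᶜ ι (1# - 0#)
        ψ*ζ : ∀ t → ψ t *ᶜ ζ z t ≈ᶜ z -ᶜ ι 1#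
        ψ*ζ t = 𝓒.trans
          (𝓒.*-cong (𝓒.*-congˡ (ι-- 1# 0#)) (𝓒.+-congˡ (𝓒.*-congʳ (𝓡.sym (at≈val t) , 𝓡.refl))))
          (𝓒.trans (solveᶜ 3 (λ x r d → r ⊗ d ⊗ (conᶜ (+ 1) ⊖ conᶜ (+ 0)) ⊗ x ⊜ (x ⊗ r) ⊗ d) (ζ-at t)
            (recipᶜ (ζ-at t) (ζ#0 t)) (z -ᶜ ι 1#))
            (𝓒.trans (𝓒.*-congʳ (recipᶜ-inverseʳ (ζ-at t) (ζ#0 t))) (𝓒.*-identityˡ _)))

      ζ-invertible : ∀ z → Slit z → ∀ t → ∃[ y ] ζ z t *ᶜ y ≈ᶜ ι 1#
      ζ-invertible z s t = recipᶜ (ζ-at) ζ#0 ,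
        𝓒.trans (𝓒.*-congʳ (𝓒.+-congˡ (𝓒.*-congʳ (𝓡.sym (at≈val t) , 𝓡.refl)))) (recipᶜ-inverseʳ ζ-at ζ#0)
        where
        ζ-at : ℂ
        ζ-at = ι 1# +ᶜ ι (0# + val t * (1# - 0#)) *ᶜ (z -ᶜ ι 1#)
        ζ#0 : ∣ ζ-at ∣² # 0#
        ζ#0 = HasIntegral.inside (isLn z s) (val t) (0≤val t) (val≤1 t)

      -- As ζ is invertible along the segment, the product equation determines ψ. Later uses thus
      -- reduce to ring identities free of reciprocals and domain proofs.
      ln-Int : ∀ z s {ψ} → (∀ t → ψ t *ᶜ ζ z t ≈ᶜ z -ᶜ ι 1#) → Int ψ (ln z s)
      ln-Int z s ψ*ζ = let φ , φ*ζ , h = ln-integrand z s in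
        Int-cong (λ t → *ᶜ-cancelʳ (proj₂ (ζ-invertible z s t)) (𝓒.trans (φ*ζ t) (𝓒.sym (ψ*ζ t)))) 𝓒.refl h

      -- With z ≈ w this also gives independence of the slit proof: both values are integrals of the
      -- same integrand.
      ln-cong : ∀ {z w} (s : Slit z) (s′ : Slit w) → z ≈ᶜ w → ln z s ≈ᶜ ln w s′
      ln-cong {z} {w} s s′ z≈w = let φ , φ*ζ , h = ln-integrand z s in
        Int-unique (λ _ → 𝓒.refl) h (ln-Int w s′ λ t → 𝓒.trans (𝓒.*-congˡ (𝓒.sym (line-cong t 𝓒.refl z≈w)))
          (𝓒.trans (φ*ζ t) (𝓒.+-congʳ z≈w)))

    module Estimate (β m r : ℝ) (0<m : 0# < m) (mr≈1 : m * r ≈ 1#) (m≤1 : m ≤ slope β (ι 1#)) where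

      -- K bounds ∣1/ζ∣² where slope β ζ ≥ m, because (slope β ζ)² ≤ (1 + β²)∣ζ∣².
      K M : ℝ
      K = r * r * (1# + β * β)
      M = 1# * 1# * (K * (K * K))

      abstract
        0≤K : 0# ≤ K
        0≤K = 0≤* (0≤sq r) (<⇒≤ (0<1+sq β))

        0≤M : 0# ≤ M
        0≤M = 0≤* (0≤sq 1#) (0≤* 0≤K (0≤* 0≤K 0≤K))

        ᴺ-val≤1 : ∀ t → ∣ ι (val t) ∣² ≤ 1# * 1#
        ᴺ-val≤1 t = ≤-resp-≈ (𝓡.sym (ᴺ-ι (val t))) 𝓡.refl (*-mono-≤ (0≤val t) 0≤1 (val≤1 t) (val≤1 t))

      module _ (z : ℂ) (m≤z : m ≤ slope β z) where

        abstract
          ζ⁻¹ : ∀ t → ∃[ y ] ζ z t *ᶜ y ≈ᶜ ι 1#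
          ζ⁻¹ t = HalfPlane⇒invertible (<-≤-trans 0<m (slope-line t m≤1 m≤z))

        b : 𝕀 → ℂ
        b t = proj₁ (ζ⁻¹ t)

        abstract
          ζb≈1 : ∀ t → ζ z t *ᶜ b t ≈ᶜ ι 1#
          ζb≈1 t = proj₂ (ζ⁻¹ t)

          b≤K : ∀ t → ∣ b t ∣² ≤ K
          b≤K t = inverse-bound (<⇒≤ 0<m) mr≈1 (slope-line t m≤1 m≤z) (ζb≈1 t)

          -- With b = 1/ζ and ζ = 1 + t(z - 1), the quotient rule gives (t/ζ)′ = (ζ - t(z - 1))/ζ² =
          -- 1/ζ². The remainder from s to t is exactly -(z - 1)b(t)b(s)²(t - s)².
          antiderivative : Diff (λ t → ι (val t) *ᶜ b t) (λ t → b t *ᶜ b t)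
          antiderivative = diff (Bounded-* Bounded-val b-bounded) (Bounded-* b-bounded b-bounded)
            (Quadratic-cong identity (Quadratic-* _ (0≤* (0≤ᴺ (-ᶜ (z -ᶜ ι 1#))) (0≤* 0≤K (0≤* 0≤K 0≤K)))
              (λ s t → ᴺ-*-≤ (0≤* 0≤K (0≤* 0≤K 0≤K)) ≤-refl (ᴺ-*-≤ (0≤* 0≤K 0≤K) (b≤K t) (ᴺ-*-≤ 0≤K (b≤K s) (b≤K s))))
              Quadratic-Δ²))
            where
            b-bounded : Bounded b
            b-bounded = K , 0≤K , b≤K
            identity : ∀ s t → (-ᶜ (z -ᶜ ι 1#) *ᶜ (b t *ᶜ (b s *ᶜ b s))) *ᶜ (ι (Δ s t) *ᶜ ι (Δ s t))
                               ≈ᶜ remainder (λ t → ι (val t) *ᶜ b t) (λ t → b t *ᶜ b t) s t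
            identity s t = 𝓒.trans (𝓒.*-congˡ (𝓒.*-cong (ι-- (val t) (val s)) (ι-- (val t) (val s))))
              -- Reciprocals are handled by padding: products ζb, each equal to 1, are inserted
              -- until every term has the factor b(t)b(s)², which leaves a polynomial identity; the
              -- products are then replaced by 1.
              (𝓒.trans (solveᶜ 5 (λ z x y bx by →
                  (⊝ (z ⊖ conᶜ (+ 1)) ⊗ (by ⊗ (bx ⊗ bx))) ⊗ ((y ⊖ x) ⊗ (y ⊖ x)) ⊜
                  (y ⊗ by ⊗ (((conᶜ (+ 1) ⊕ x ⊗ (z ⊖ conᶜ (+ 1))) ⊗ bx) ⊗ ((conᶜ (+ 1) ⊕ x ⊗ (z ⊖ conᶜ (+ 1))) ⊗ bx))
                    ⊖ x ⊗ bx ⊗ (((conᶜ (+ 1) ⊕ y ⊗ (z ⊖ conᶜ (+ 1))) ⊗ by) ⊗ ((conᶜ (+ 1) ⊕ x ⊗ (z ⊖ conᶜ (+ 1))) ⊗ bx)))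
                    ⊖ bx ⊗ bx ⊗ (y ⊖ x) ⊗ ((conᶜ (+ 1) ⊕ y ⊗ (z ⊖ conᶜ (+ 1))) ⊗ by))
                  z (ι (val s)) (ι (val t)) (b s) (b t))
                (𝓒.trans (𝓒.+-cong
                    (𝓒.+-cong (𝓒.*-congˡ (𝓒.*-cong (ζb≈1 s) (ζb≈1 s))) (𝓒.-‿cong (𝓒.*-congˡ (𝓒.*-cong (ζb≈1 t) (ζb≈1 s)))))
                    (𝓒.-‿cong (𝓒.*-cong (𝓒.*-congˡ (𝓒.sym (ι-- (val t) (val s)))) (ζb≈1 t))))
                  (solveᶜ 5 (λ x y bx by h →
                    (y ⊗ by ⊗ (conᶜ (+ 1) ⊗ conᶜ (+ 1)) ⊖ x ⊗ bx ⊗ (conᶜ (+ 1) ⊗ conᶜ (+ 1))) ⊖ bx ⊗ bx ⊗ h ⊗ conᶜ (+ 1)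
                    ⊜ (y ⊗ by ⊖ x ⊗ bx) ⊖ bx ⊗ bx ⊗ h) (ι (val s)) (ι (val t)) (b s) (b t) (ι (Δ s t)))))

          ∫b²≈z⁻¹ : ∀ {y} → z *ᶜ y ≈ᶜ ι 1# → Int (λ t → b t *ᶜ b t) y
          ∫b²≈z⁻¹ {y} zy≈1 = Int-cong (λ _ → 𝓒.refl)
            (𝓒.trans (solveᶜ 2 (λ x w → conᶜ (+ 1) ⊗ x ⊖ conᶜ (+ 0) ⊗ w ⊜ x) (b 𝟙) (b 𝟘))
              (*ᶜ-cancelʳ zy≈1 (𝓒.trans (𝓒.*-comm (b 𝟙) z) (𝓒.trans (𝓒.trans (𝓒.*-congʳ (𝓒.sym (line-𝟙 (ι 1#) z))) (ζb≈1 𝟙))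
                (𝓒.trans (𝓒.sym zy≈1) (𝓒.*-comm z y))))))
            (fundamental-theorem antiderivative)

          ln-Int-b : ∀ s → Int (λ t → (z -ᶜ ι 1#) *ᶜ b t) (ln z s)
          ln-Int-b s = ln-Int z s λ t → 𝓒.trans
            (solveᶜ 3 (λ d b x → d ⊗ b ⊗ x ⊜ d ⊗ (x ⊗ b)) (z -ᶜ ι 1#) (b t) (ζ z t))
            (𝓒.trans (𝓒.*-congˡ (ζb≈1 t)) (𝓒.*-identityʳ _))

      abstract
        -- With A and B the reciprocals of the two segments, the combined integrand is exactly -(w -
        -- z)²tAB². Here `M` bounds ∣tAB²∣² by one factor for t and a factor `K` for each
        -- reciprocal, and the subtracted term integrates to (w - z)/z.
        ln-difference : ∀ {z w y} (s : Slit z) (s′ : Slit w) → m ≤ slope β z → m ≤ slope β w → z *ᶜ y ≈ᶜ ι 1# →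
                        Box (ln w s′ -ᶜ ln z s -ᶜ (w -ᶜ z) *ᶜ y) ((1# + M) * ∣ w -ᶜ z ∣²)
        ln-difference {z} {w} {y} s s′ m≤z m≤w zy≈1 = Int-bounded
          (Int-- (Int-- (ln-Int-b w m≤w s′) (ln-Int-b z m≤z s)) (Int-* (w -ᶜ z) (∫b²≈z⁻¹ z m≤z zy≈1)))
          λ t → Box-cong (identity t) (ᴺ≤scaled⇒Box 0≤M (0≤ᴺ (w -ᶜ z)) (≤-resp-≈ 𝓡.refl (𝓡.*-comm _ M)
            (ᴺ-*-≤ 0≤M (≤-reflexive (𝓡.trans (ᴺ-neg _) (ᴺ-* _ _)))
              (ᴺ-*-≤ (0≤* 0≤K (0≤* 0≤K 0≤K)) (ᴺ-val≤1 t)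
                (ᴺ-*-≤ (0≤* 0≤K 0≤K) (b≤K w m≤w t) (ᴺ-*-≤ 0≤K (b≤K z m≤z t) (b≤K z m≤z t)))))))
          where
          A B : 𝕀 → ℂ
          A = b w m≤w
          B = b z m≤z
          identity : ∀ t → (-ᶜ ((w -ᶜ z) *ᶜ (w -ᶜ z))) *ᶜ (ι (val t) *ᶜ (A t *ᶜ (B t *ᶜ B t)))
                           ≈ᶜ (w -ᶜ ι 1#) *ᶜ A t -ᶜ (z -ᶜ ι 1#) *ᶜ B t -ᶜ (w -ᶜ z) *ᶜ (B t *ᶜ B t)
          identity t = 𝓒.trans (solveᶜ 5 (λ z w x a b →
              (⊝ ((w ⊖ z) ⊗ (w ⊖ z))) ⊗ (x ⊗ (a ⊗ (b ⊗ b))) ⊜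
              ((w ⊖ conᶜ (+ 1)) ⊗ a ⊗ (((conᶜ (+ 1) ⊕ x ⊗ (z ⊖ conᶜ (+ 1))) ⊗ b) ⊗ ((conᶜ (+ 1) ⊕ x ⊗ (z ⊖ conᶜ (+ 1))) ⊗ b))
                ⊖ (z ⊖ conᶜ (+ 1)) ⊗ b ⊗ (((conᶜ (+ 1) ⊕ x ⊗ (w ⊖ conᶜ (+ 1))) ⊗ a) ⊗
                  ((conᶜ (+ 1) ⊕ x ⊗ (z ⊖ conᶜ (+ 1))) ⊗ b)))
                ⊖ (w ⊖ z) ⊗ (b ⊗ b) ⊗ ((conᶜ (+ 1) ⊕ x ⊗ (w ⊖ conᶜ (+ 1))) ⊗ a))
              z w (ι (val t)) (A t) (B t))
            (𝓒.trans (𝓒.+-cong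
                (𝓒.+-cong (𝓒.*-congˡ (𝓒.*-cong (ζb≈1 z m≤z t) (ζb≈1 z m≤z t)))
                  (𝓒.-‿cong (𝓒.*-congˡ (𝓒.*-cong (ζb≈1 w m≤w t) (ζb≈1 z m≤z t)))))
                (𝓒.-‿cong (𝓒.*-congˡ (ζb≈1 w m≤w t))))
              (solveᶜ 4 (λ z w a b →
                ((w ⊖ conᶜ (+ 1)) ⊗ a ⊗ (conᶜ (+ 1) ⊗ conᶜ (+ 1)) ⊖ (z ⊖ conᶜ (+ 1)) ⊗ b ⊗ (conᶜ (+ 1) ⊗ conᶜ (+ 1)))
                  ⊖ (w ⊖ z) ⊗ (b ⊗ b) ⊗ conᶜ (+ 1)
                ⊜ ((w ⊖ conᶜ (+ 1)) ⊗ a ⊖ (z ⊖ conᶜ (+ 1)) ⊗ b) ⊖ (w ⊖ z) ⊗ (b ⊗ b)) z w (A t) (B t)))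

        ln-Diff : ∀ {z w} → m ≤ slope β z → m ≤ slope β w → (s : ∀ t → Slit (line z w t)) →
                  Σ[ y ∈ (𝕀 → ℂ) ] (∀ t → line z w t *ᶜ y t ≈ᶜ ι 1#) × Diff (λ t → ln (line z w t) (s t))
                    (λ t → (w -ᶜ z) *ᶜ y t)
        ln-Diff {z} {w} m≤z m≤w s = y , zy≈1 , Diff-from-quadratic
          (Bounded-* (Bounded-const (w -ᶜ z)) (K , 0≤K , λ t → inverse-bound (<⇒≤ 0<m) mr≈1 (m≤line t) (zy≈1 t)))
          (2# * (C * C) , 0≤* 0≤2 (0≤sq C) , bound)
          where
          m≤line : ∀ t → m ≤ slope β (line z w t)
          m≤line t = slope-line t m≤z m≤w
          inverse : ∀ t → ∃[ y ] line z w t *ᶜ y ≈ᶜ ι 1#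
          inverse t = HalfPlane⇒invertible (<-≤-trans 0<m (m≤line t))
          y : 𝕀 → ℂ
          y t = proj₁ (inverse t)
          zy≈1 : ∀ t → line z w t *ᶜ y t ≈ᶜ ι 1#
          zy≈1 t = proj₂ (inverse t)
          C : ℝ
          C = (1# + M) * ∣ w -ᶜ z ∣²
          increment : ∀ s t → line z w t -ᶜ line z w s ≈ᶜ ι (Δ s t) *ᶜ (w -ᶜ z)
          increment s t = 𝓒.trans
            (solveᶜ 4 (λ z w x y → (z ⊕ y ⊗ (w ⊖ z)) ⊖ (z ⊕ x ⊗ (w ⊖ z)) ⊜ (y ⊖ x) ⊗ (w ⊖ z)) z w (ι (val s)) (ι (val t)))
            (𝓒.*-congʳ (𝓒.sym (ι-- (val t) (val s))))
          bound : ∀ σ τ → ∣ remainder (λ t → ln (line z w t) (s t)) (λ t → (w -ᶜ z) *ᶜ y t) σ τ ∣²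
                          ≤ 2# * (C * C) * (Δ σ τ * Δ σ τ * (Δ σ τ * Δ σ τ))
          bound σ τ = ≤-resp-≈
            (ᴺ-cong (𝓒.+-congˡ (𝓒.-‿cong (𝓒.trans (𝓒.*-congʳ (increment σ τ))
              (solveᶜ 3 (λ h d y → h ⊗ d ⊗ y ⊜ d ⊗ y ⊗ h) (ι (Δ σ τ)) (w -ᶜ z) (y σ))))))
            (𝓡.trans (𝓡.*-congˡ (𝓡.*-cong D D))
              (solve 4 (λ k c n h → k :* (c :* (h :* h :* n) :* (c :* (h :* h :* n))) := k :* (c :* n :* (c :* n)) :*
                (h :* h :* (h :* h)))
                2# (1# + M) ∣ w -ᶜ z ∣² (Δ σ τ)))
            (Box⇒ᴺ (ln-difference (s σ) (s τ) (m≤line σ) (m≤line τ) (zy≈1 σ)))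
            where
            D : (1# + M) * ∣ line z w τ -ᶜ line z w σ ∣² ≈ (1# + M) * (Δ σ τ * Δ σ τ * ∣ w -ᶜ z ∣²)
            D = 𝓡.*-congˡ (𝓡.trans (ᴺ-cong (increment σ τ)) (𝓡.trans (ᴺ-* _ _) (𝓡.*-congʳ (ᴺ-ι _))))

    abstract
      -- The margin m has to lie below the slope at 1 as well as at z and w, because the segments
      -- that define `ln` start at 1.
      ln-differentiable : ∀ {β z w} → HalfPlane β z → HalfPlane β w → (s : ∀ t → Slit (line z w t)) →
        Σ[ y ∈ (𝕀 → ℂ) ] (∀ t → line z w t *ᶜ y t ≈ᶜ ι 1#) × Diff (λ t → ln (line z w t) (s t)) (λ t → (w -ᶜ z) *ᶜ y t)
      ln-differentiable {β} {z} {w} hz hw s = below-z-w (lower-bound hz hw)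
        where
        Goal : Set (c ⊔ ℓ₁ ⊔ ℓ₂)
        Goal = Σ[ y ∈ (𝕀 → ℂ) ] (∀ t → line z w t *ᶜ y t ≈ᶜ ι 1#) × Diff (λ t → ln (line z w t) (s t))
          (λ t → (w -ᶜ z) *ᶜ y t)
        invert : ∀ {m} → 0# < m → m ≤ slope β (ι 1#) → m ≤ slope β z → m ≤ slope β w → ∃[ r ] 0# < r × m * r ≈ 1# → Goal
        invert {m} 0<m m≤1 m≤z m≤w (r , _ , mr≈1) = Estimate.ln-Diff β m r 0<m mr≈1 m≤1 m≤z m≤w s
        below-1 : ∀ {k} → k ≤ slope β z → k ≤ slope β w → ∃[ m ] 0# < m × m ≤ k × m ≤ slope β (ι 1#) → Goal
        below-1 k≤z k≤w (m , 0<m , m≤k , m≤1) = invert 0<m m≤1 (≤-trans m≤k k≤z) (≤-trans m≤k k≤w) (inverse⁺ 0<m)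
        below-z-w : ∃[ m ] 0# < m × m ≤ slope β z × m ≤ slope β w → Goal
        below-z-w (k , 0<k , k≤z , k≤w) = below-1 k≤z k≤w (lower-bound 0<k (HalfPlane-1 {β}))

      -- Both sides are the integral of dζ/ζ along the segment from z to w = zp, which is z times the one from 1 to p.
      ln-* : ∀ {β z w p} → HalfPlane β z → HalfPlane β w → z *ᶜ p ≈ᶜ w →
             (sz : Slit z) (sw : Slit w) (sp : Slit p) → ln w sw ≈ᶜ ln z sz +ᶜ ln p sp
      ln-* {β} {z} {w} {p} hz hw zp≈w sz sw sp = conclude (ln-differentiable hz hw s)
        where
        s : ∀ t → Slit (line z w t)
        s t = HalfPlane⇒Slit (HalfPlane-line t hz hw)
        conclude : Σ[ y ∈ (𝕀 → ℂ) ] (∀ t → line z w t *ᶜ y t ≈ᶜ ι 1#) × Diff (λ t → ln (line z w t) (s t))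
          (λ t → (w -ᶜ z) *ᶜ y t) →
                   ln w sw ≈ᶜ ln z sz +ᶜ ln p sp
        conclude (y , zy≈1 , D) = 𝓒.trans (solveᶜ 2 (λ x y → x ⊜ y ⊕ (x ⊖ y)) (ln w sw) (ln z sz))
          (𝓒.+-congˡ (𝓒.trans (𝓒.+-cong (ln-cong sw (s 𝟙) (𝓒.sym (line-𝟙 z w)))
            (𝓒.-‿cong (ln-cong sz (s 𝟘) (𝓒.sym (line-𝟘 z w)))))
            (Int-unique (λ _ → 𝓒.refl) (fundamental-theorem D) (ln-Int p sp λ t →
              𝓒.trans (𝓒.*-congʳ (𝓒.*-congʳ (𝓒.+-congʳ (𝓒.sym zp≈w))))
                (𝓒.trans (solveᶜ 4 (λ z p x y → (z ⊗ p ⊖ z) ⊗ y ⊗ (conᶜ (+ 1) ⊕ x ⊗ (p ⊖ conᶜ (+ 1)))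
                    ⊜ (p ⊖ conᶜ (+ 1)) ⊗ ((z ⊕ x ⊗ (z ⊗ p ⊖ z)) ⊗ y)) z p (ι (val t)) (y t))
                  (𝓒.trans (𝓒.*-congˡ (𝓒.trans (𝓒.*-congʳ (line-cong t 𝓒.refl zp≈w)) (zy≈1 t))) (𝓒.*-identityʳ _)))))))

  -- Roots of 1 + x^N: unit modulus and position off the cut

  module Root where
    private
      module Eᶜ = Evaluation ℂ-commutativeRing
      module E = Evaluation commutativeRing

    abstract
      ᴺ-^ : ∀ z n → ∣ z ^ᶜ n ∣² ≈ ∣ z ∣² ^ n
      ᴺ-^ z zero    = 𝓡.trans (ᴺ-ι 1#) (𝓡.*-identityʳ 1#)
      ᴺ-^ z (suc n) = 𝓡.trans (ᴺ-* z (z ^ᶜ n)) (𝓡.*-congˡ (ᴺ-^ z n))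

      0≤geometric : ∀ n {t} → 0# ≤ t → 0# ≤ E.geometric n t
      0≤geometric zero    0≤t = ≤-refl
      0≤geometric (suc n) 0≤t = 0≤+ (0≤* 0≤t (0≤geometric n 0≤t)) 0≤1

      -- In (t - 1)(1 + t + ... + tⁿ) = tⁿ⁺¹ - 1 = 0 the second factor is positive for t ≥ 0 and can
      -- be cancelled.
      root-of-unity : ∀ n {t} → 0# ≤ t → t ^ suc n ≈ 1# → t ≈ 1#
      root-of-unity n {t} 0≤t tⁿ≈1 = cancel (inverse⁺ 0<g)
        where
        g : ℝ
        g = E.geometric (suc n) t
        0<g : 0# < g
        0<g = <-resp-≈ 𝓡.refl (𝓡.+-comm 1# _) (0<+ 0<1 (0≤* 0≤t (0≤geometric n 0≤t)))
        [t-1]g≈0 : (t - 1#) * g ≈ 0#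
        [t-1]g≈0 = 𝓡.trans (E.geometric-* (suc n) t) (𝓡.trans (𝓡.+-congʳ tⁿ≈1) (𝓡.-‿inverseʳ 1#))
        cancel : ∃[ r ] 0# < r × g * r ≈ 1# → t ≈ 1#
        cancel (r , _ , gr≈1) = 𝓡.trans (solve 1 (λ t → t := (t :- con (+ 1)) :+ con (+ 1)) t)
          (𝓡.trans (𝓡.+-congʳ (𝓡.trans (x≈x*yr (t - 1#) gr≈1)
            (𝓡.trans (𝓡.sym (𝓡.*-assoc (t - 1#) g r)) (𝓡.trans (𝓡.*-congʳ [t-1]g≈0) (𝓡.zeroˡ r)))))
            (𝓡.+-identityˡ 1#))

    module _ (N : ℕ) (a : ℂ) (a∣ : (X +ₚ const a) ∣ₚ (const (ι 1#) +ₚ X^ N)) where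

      abstract
        [-a]^N≈-1 : (-ᶜ a) ^ᶜ N ≈ᶜ -ᶜ ι 1#
        [-a]^N≈-1 = 𝓒.trans (solveᶜ 2 (λ p z → p ⊜ ((conᶜ (+ 1) ⊕ z ⊗ conᶜ (+ 0)) ⊕ p) ⊖ conᶜ (+ 1)) ((-ᶜ a) ^ᶜ N) (-ᶜ a))
          (𝓒.trans (𝓒.+-congʳ (𝓒.trans (𝓒.+-congˡ (𝓒.sym (Eᶜ.eval-X^ N (-ᶜ a))))
              (𝓒.trans (𝓒.sym (Eᶜ.eval-+ (const (ι 1#)) (X^ N) (-ᶜ a)))
                (Eᶜ.factor⇒root a (const (ι 1#) +ₚ X^ N) (-ᶜ a) a∣ 𝓒.refl))))
            (𝓒.+-identityˡ _))

        ᴺ^N≈1 : ∣ a ∣² ^ N ≈ 1#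
        ᴺ^N≈1 = 𝓡.trans (𝓡.sym (𝓡.trans (ᴺ-^ (-ᶜ a) N) (^-cong N (ᴺ-neg a))))
          (𝓡.trans (ᴺ-cong [-a]^N≈-1) (𝓡.trans (ᴺ-neg (ι 1#)) (𝓡.trans (ᴺ-ι 1#) (𝓡.*-identityʳ 1#))))
          where
          ^-cong : ∀ n {x y} → x ≈ y → x ^ n ≈ y ^ n
          ^-cong zero    x≈y = 𝓡.refl
          ^-cong (suc n) x≈y = 𝓡.*-cong x≈y (^-cong n x≈y)

        root-norm : ∣ a ∣² ≈ 1#
        root-norm = positive N [-a]^N≈-1 ᴺ^N≈1
          where
          positive : ∀ n → (-ᶜ a) ^ᶜ n ≈ᶜ -ᶜ ι 1# → ∣ a ∣² ^ n ≈ 1# → ∣ a ∣² ≈ 1#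
          -- For N = 0 the polynomial is the constant 2; a root would force 1 = -1.
          positive zero    1≈-1 _ = ⊥-elim (<-irrefl (𝓡.sym (𝓡.trans (𝓡.+-congˡ (re-≈ 1≈-1)) (𝓡.-‿inverseʳ 1#))) 0<2)
          positive (suc n) _ ᴺ^≈1 = root-of-unity n (0≤ᴺ a) ᴺ^≈1

        -- For ∣a∣ = 1 one has ∣-a - 1∣² = 2(1 + re a). This is apart from 0 since -a - 1 divides
        -- (-a)ᴺ - 1 = -2, the cofactor being a geometric sum.
        0<1+re : 0# < 1# + re a
        0<1+re = 0<*⁻¹ 0<2 (<-resp-≈ 𝓡.refl
          (𝓡.trans (solve 2 (λ u v → (:- u :- con (+ 1)) :* (:- u :- con (+ 1)) :+ (:- v :- con (+ 0)) :* (:- v :- con (+ 0))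
              := (con (+ 1) :+ con (+ 1)) :* u :+ (con (+ 1) :+ (u :* u :+ v :* v))) (re a) (im a))
            (𝓡.trans (𝓡.+-congˡ (𝓡.+-congˡ root-norm))
              (solve 1 (λ u → (con (+ 1) :+ con (+ 1)) :* u :+ (con (+ 1) :+ con (+ 1)) := (con (+ 1) :+ con (+ 1)) :*
                (con (+ 1) :+ u)) (re a))))
          (positive (*#0⇒#0 {y = ∣ g ∣²} (inj₂ 0<product))))
          where
          g : ℂ
          g = Eᶜ.geometric N (-ᶜ a)
          0<product : 0# < ∣ -ᶜ a -ᶜ ι 1# ∣² * ∣ g ∣²
          0<product = <-resp-≈ 𝓡.refl (𝓡.trans (𝓡.sym (ᴺ-cong
            (𝓒.trans (Eᶜ.geometric-* N (-ᶜ a)) (𝓒.+-congʳ [-a]^N≈-1)))) (ᴺ-* _ g))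
            (<-resp-≈ 𝓡.refl (solve 0 ((con (+ 1) :+ con (+ 1)) :* (con (+ 1) :+ con (+ 1))
                := (:- con (+ 1) :- con (+ 1)) :* (:- con (+ 1) :- con (+ 1)) :+ (:- con (+ 0) :- con (+ 0)) :*
                  (:- con (+ 0) :- con (+ 0))))
              (*-pos 0<2 0<2))
          positive : ∣ -ᶜ a -ᶜ ι 1# ∣² # 0# → 0# < ∣ -ᶜ a -ᶜ ι 1# ∣²
          positive (inj₁ <0) = ⊥-elim (0≤ᴺ (-ᶜ a -ᶜ ι 1#) <0)
          positive (inj₂ 0<) = 0<

        -- Cotransitivity offers 0 < u or u < 1; in the second case v² = (1 - u)(1 + u) is positive,
        -- so v is apart from 0.
        root-slit : Slit a
        root-slit = decide (<-cotrans 0<1 (re a))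
          where
          decide : 0# < re a ⊎ re a < 1# → Slit a
          decide (inj₁ 0<u) = inj₁ 0<u
          decide (inj₂ u<1) = inj₂ (*#0⇒#0 (inj₂ (<-resp-≈ 𝓡.refl
            (𝓡.trans (solve 2 (λ u v → (con (+ 1) :- u) :* (con (+ 1) :+ u) := con (+ 1) :- u :* u) (re a) (im a))
              (𝓡.trans (𝓡.+-congʳ (𝓡.sym root-norm))
                (solve 2 (λ u v → (u :* u :+ v :* v) :- u :* u := v :* v) (re a) (im a))))
            (*-pos (x<y⇒0<y-x u<1) 0<1+re))))

  -- Reciprocal factorials and the sums of the closed form

  module Factorials where
    private
      module Mult = MultProperties 𝓡.semiring

    abstract
      fromNat-1/ : ∀ n .{{_ : NonZero n}} → fromNat n * (1/ n) ≈ 1#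
      fromNat-1/ n = recip-inverseʳ (fromNat n) _

      ι-fromNat-1/ : ∀ n .{{_ : NonZero n}} → ι (1/ n) *ᶜ ι (fromNat n) ≈ᶜ ι 1#
      ι-fromNat-1/ n = 𝓒.trans (𝓒.*-comm _ _) (𝓒.trans (𝓒.sym (ι-* _ _)) (fromNat-1/ n , 𝓡.refl))

      1/0! : 1/ 0 ! ≈ 1#
      1/0! = 𝓡.sym (recip-unique _ (𝓡.trans (𝓡.*-identityʳ _) (𝓡.+-identityʳ 1#)))

      1/suc! : ∀ n → 1/ suc n ! ≈ (1/ suc n) * (1/ n !)
      1/suc! n = 𝓡.sym (recip-unique _ (𝓡.trans (𝓡.*-congʳ (Mult.×1-homo-* (suc n) (n ℕ.!)))
        (𝓡.trans (interchange (fromNat (suc n)) (fromNat (n ℕ.!)) (1/ suc n) (1/ n !))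
          (𝓡.trans (𝓡.*-cong (fromNat-1/ (suc n)) (fromNat-1/ (n ℕ.!) {{ℕ._!≢0 n}})) (𝓡.*-identityʳ 1#)))))
        where
        interchange : ∀ a b x y → a * b * (x * y) ≈ a * x * (b * y)
        interchange = solve 4 (λ a b x y → a :* b :* (x :* y) := a :* x :* (b :* y))

  open Factorials

  module LogarithmSums where

    -- The contribution of a single root to the sum in the theorem, with y = x + a.
    S : ℕ → ℂ → ℂ → ℂ
    S n x y = sum₁ n (λ k → x ^ᶜ k *ᶜ ι (1/ k) *ᶜ y ^ᶜ (n ∸ k))

    abstract
      sum-last : ∀ n (g : ℕ → ℂ) → sumᶜ {suc n} (λ j → g (toℕ j)) ≈ᶜ sumᶜ {n} (λ j → g (toℕ j)) +ᶜ g n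
      sum-last zero    g = 𝓒.+-comm (g 0) (ι 0#)
      sum-last (suc n) g = 𝓒.trans (𝓒.+-congˡ (sum-last n (λ k → g (suc k)))) (𝓒.sym (𝓒.+-assoc _ _ _))

      -- Raising n multiplies each old term by y and adds a last term with y⁰. The recursion of `F`
      -- produces the same new term from `e (suc n)`.
      S-suc : ∀ n x y → S (suc n) x y ≈ᶜ y *ᶜ S n x y +ᶜ ι (1/ suc n) *ᶜ x ^ᶜ suc n
      S-suc n x y = 𝓒.trans (sum-last n term)
        (𝓒.+-cong
          (𝓒.trans (Sumᶜ.sum-cong-≋ (λ j → shift (toℕ j) (toℕ<n j)))
            (𝓒.sym (Sumᶜ.*-distribˡ-sum {n} y (λ j → term′ (toℕ j)))))
          (𝓒.trans (𝓒.*-congˡ (𝓒.reflexive (≡.cong (y ^ᶜ_) (ℕ.n∸n≡0 n))))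
            (𝓒.trans (𝓒.*-identityʳ _) (𝓒.*-comm (x ^ᶜ suc n) (ι (1/ suc n))))))
        where
        term term′ : ℕ → ℂ
        term  j = x ^ᶜ suc j *ᶜ ι (1/ suc j) *ᶜ y ^ᶜ (n ∸ j)
        term′ j = x ^ᶜ suc j *ᶜ ι (1/ suc j) *ᶜ y ^ᶜ (n ∸ suc j)
        shift : ∀ j → j ℕ.< n → term j ≈ᶜ y *ᶜ term′ j
        -- Subtraction is truncated, so n ∸ j = 1 + (n ∸ suc j) requires j < n.
        shift j j<n = 𝓒.trans (𝓒.*-congˡ (𝓒.reflexive (≡.cong (y ^ᶜ_) (ℕ.+-∸-assoc 1 j<n))))
          (solveᶜ 3 (λ t y p → t ⊗ (y ⊗ p) ⊜ y ⊗ (t ⊗ p)) (x ^ᶜ suc j *ᶜ ι (1/ suc j)) y (y ^ᶜ (n ∸ suc j)))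

      S-+ : ∀ n x y z → sum₁ n (λ k → x ^ᶜ k *ᶜ ι (1/ k) *ᶜ (y ^ᶜ (n ∸ k) +ᶜ z ^ᶜ (n ∸ k))) ≈ᶜ S n x y +ᶜ S n x z
      S-+ n x y z = 𝓒.trans
        (Sumᶜ.sum-cong-≋ {n} (λ j → 𝓒.distribˡ (x ^ᶜ suc (toℕ j) *ᶜ ι (1/ suc (toℕ j))) (y ^ᶜ (n ∸ suc (toℕ j)))
          (z ^ᶜ (n ∸ suc (toℕ j)))))
        (Sumᶜ.∑-distrib-+ {n} (λ j → x ^ᶜ suc (toℕ j) *ᶜ ι (1/ suc (toℕ j)) *ᶜ y ^ᶜ (n ∸ suc (toℕ j)))
          (λ j → x ^ᶜ suc (toℕ j) *ᶜ ι (1/ suc (toℕ j)) *ᶜ z ^ᶜ (n ∸ suc (toℕ j))))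

  open LogarithmSums

  -- Iterated integrals of ln(x + a)

  module IteratedLogarithm
    (ln : ∀ z → Slit z → ℂ) (isLn : IsLn ln)
    (D : ℝ → Set ℓ₂) (a : ℂ) (slit-a : Slit a) (slit-x+a : ∀ x → D x → Slit (ι x +ᶜ a))
    (half-plane : ∀ x → D x → ∃[ β ] HalfPlane β a × HalfPlane β (ι x +ᶜ a))
    (segment : ∀ x → D x → ∀ t → D (0# + val t * (x - 0#)))
    where
    open Logarithm ln isLn

    ln-a : ℂ
    ln-a = ln a slit-a

    -- The monomial xⁿ/n!, itself an iterated integral of 1.
    e : ℕ → ℝ → ℂ
    e zero    x = ι 1#
    e (suc n) x = ι (1/ suc n) *ᶜ (ι x *ᶜ e n x)

    -- Fₙ is (1/n!) ((x+a)ⁿ (ln(x+a) - ln a) - Σₖ xᵏ(x+a)ⁿ⁻ᵏ/k + xⁿ ln a), see `F-closed`.  In this recursive form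
    -- F′ₙ₊₁ = Fₙ follows from e′ₙ₊₁ = eₙ by induction, without differentiating the sum.
    F : ℕ → Fun D
    F zero    x d = ln (ι x +ᶜ a) (slit-x+a x d)
    F (suc n) x d = ι (1/ suc n) *ᶜ ((ι x +ᶜ a) *ᶜ F n x d -ᶜ e (suc n) x -ᶜ a *ᶜ ln-a *ᶜ e n x)

    abstract
      e-cong : ∀ n {x x′} → x ≈ x′ → e n x ≈ᶜ e n x′
      e-cong zero    x≈x′ = 𝓒.refl
      e-cong (suc n) x≈x′ = 𝓒.*-congˡ (𝓒.*-cong (x≈x′ , 𝓡.refl) (e-cong n x≈x′))

      F-cong : ∀ n {x x′} d d′ → x ≈ x′ → F n x d ≈ᶜ F n x′ d′
      F-cong zero    d d′ x≈x′ = ln-cong _ _ (𝓒.+-congʳ (x≈x′ , 𝓡.refl))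
      F-cong (suc n) d d′ x≈x′ = 𝓒.*-congˡ (𝓒.+-cong (𝓒.+-cong
        (𝓒.*-cong (𝓒.+-congʳ (x≈x′ , 𝓡.refl)) (F-cong n d d′ x≈x′))
        (𝓒.-‿cong (e-cong (suc n) x≈x′))) (𝓒.-‿cong (𝓒.*-congˡ (e-cong n x≈x′))))

      e-zero : ∀ n {x} → x ≈ 0# → e (suc n) x ≈ᶜ ι 0#
      e-zero n x≈0 = 𝓒.trans (𝓒.*-congˡ (𝓒.*-congʳ (x≈0 , 𝓡.refl)))
        (solveᶜ 2 (λ k e → k ⊗ (conᶜ (+ 0) ⊗ e) ⊜ conᶜ (+ 0)) (ι (1/ suc n)) (e n _))

      -- The term with `ln-a` supplies the constant of integration: at x = 0 it cancels a ln a in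
      -- `F 1` and vanishes in all later steps.
      F-zero : ∀ n {x} d → x ≈ 0# → F (suc n) x d ≈ᶜ ι 0#
      F-zero zero {x} d x≈0 = 𝓒.trans
        (𝓒.*-congˡ (𝓒.+-congʳ (𝓒.+-cong (𝓒.*-cong x+a≈a (ln-cong _ slit-a x+a≈a)) (𝓒.-‿cong (e-zero 0 x≈0)))))
        (solveᶜ 3 (λ k a l → k ⊗ ((a ⊗ l ⊖ conᶜ (+ 0)) ⊖ a ⊗ l ⊗ conᶜ (+ 1)) ⊜ conᶜ (+ 0)) (ι (1/ 1)) a ln-a)
        where
        x+a≈a : ι x +ᶜ a ≈ᶜ a
        x+a≈a = 𝓒.trans (𝓒.+-congʳ (x≈0 , 𝓡.refl)) (𝓒.+-identityˡ a)
      F-zero (suc n) {x} d x≈0 = 𝓒.trans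
        (𝓒.*-congˡ (𝓒.+-cong (𝓒.+-cong (𝓒.*-congˡ (F-zero n d x≈0)) (𝓒.-‿cong (e-zero (suc n) x≈0)))
          (𝓒.-‿cong (𝓒.*-congˡ (e-zero n x≈0)))))
        (solveᶜ 3 (λ k y l → k ⊗ ((y ⊗ conᶜ (+ 0) ⊖ conᶜ (+ 0)) ⊖ l ⊗ conᶜ (+ 0)) ⊜ conᶜ (+ 0)) (ι (1/ suc (suc n)))
          (ι x +ᶜ a) (a *ᶜ ln-a))

    module Along (x : ℝ) (d : D x) where

      s : 𝕀 → ℝ
      s t = 0# + val t * (x - 0#)

      h : ℂ
      h = ι (x - 0#)

      Y : 𝕀 → ℂ
      Y t = ι (s t) +ᶜ a

      G : ℕ → 𝕀 → ℂ
      G n t = F n (s t) (segment x d t)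

      abstract
        ι-s : ∀ t → ι (s t) ≈ᶜ ι 0# +ᶜ ι (val t) *ᶜ h
        ι-s t = 𝓒.trans (𝓡.refl , 𝓡.sym (𝓡.+-identityʳ 0#)) (𝓒.+-congˡ {x = ι 0#} (ι-* (val t) (x - 0#)))

        line-Y : ∀ t → line a (ι x +ᶜ a) t ≈ᶜ Y t
        line-Y t = 𝓒.sym (𝓒.trans (𝓒.+-congʳ (𝓒.trans (ι-s t) (𝓒.+-congˡ (𝓒.*-congˡ (ι-- x 0#)))))
          (solveᶜ 3 (λ t x a → (conᶜ (+ 0) ⊕ t ⊗ (x ⊖ conᶜ (+ 0))) ⊕ a ⊜ a ⊕ t ⊗ ((x ⊕ a) ⊖ a)) (ι (val t)) (ι x) a))

        G₀-Diff : Σ[ y ∈ (𝕀 → ℂ) ] (∀ t → Y t *ᶜ y t ≈ᶜ ι 1#) × Diff (G 0) (λ t → y t *ᶜ h)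
        G₀-Diff = along (half-plane x d)
          where
          along : ∃[ β ] HalfPlane β a × HalfPlane β (ι x +ᶜ a) →
                  Σ[ y ∈ (𝕀 → ℂ) ] (∀ t → Y t *ᶜ y t ≈ᶜ ι 1#) × Diff (G 0) (λ t → y t *ᶜ h)
          along (β , ha , hx+a) = transport (ln-differentiable ha hx+a slit-line)
            where
            slit-line : ∀ t → Slit (line a (ι x +ᶜ a) t)
            slit-line t = HalfPlane⇒Slit (HalfPlane-line t ha hx+a)
            transport : Σ[ y ∈ (𝕀 → ℂ) ] (∀ t → line a (ι x +ᶜ a) t *ᶜ y t ≈ᶜ ι 1#) ×
                          Diff (λ t → ln (line a (ι x +ᶜ a) t) (slit-line t)) (λ t → (ι x +ᶜ a -ᶜ a) *ᶜ y t) →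
                        Σ[ y ∈ (𝕀 → ℂ) ] (∀ t → Y t *ᶜ y t ≈ᶜ ι 1#) × Diff (G 0) (λ t → y t *ᶜ h)
            transport (y , zy≈1 , D) = y , (λ t → 𝓒.trans (𝓒.*-congʳ (𝓒.sym (line-Y t))) (zy≈1 t)) ,
              Diff-cong (λ t → ln-cong _ _ (line-Y t))
                (λ t → 𝓒.trans (solveᶜ 3 (λ x a y → ((x ⊕ a) ⊖ a) ⊗ y ⊜ y ⊗ (x ⊖ conᶜ (+ 0))) (ι x) a (y t))
                  (𝓒.*-congˡ (𝓒.sym (ι-- x 0#)))) D

      y : 𝕀 → ℂ
      y = proj₁ G₀-Diff

      G′ e′ : ℕ → 𝕀 → ℂ
      G′ zero    t = y t
      G′ (suc n) t = G n t
      e′ zero    t = ι 0#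
      e′ (suc n) t = e n (s t)

      abstract
        -- For n = 0 this says that `y` is the reciprocal of `Y`; for larger n it is the recursion
        -- defining `G n`, cleared of 1/n. Differentiating the recursion for `G (suc n)` gives `G n`
        -- plus this left side, all over n + 1, hence `G n` again.
        recurrence : ∀ n t → Y t *ᶜ G′ n t -ᶜ e n (s t) -ᶜ a *ᶜ ln-a *ᶜ e′ n t ≈ᶜ ι (fromNat n) *ᶜ G n t
        recurrence zero t = 𝓒.trans (𝓒.+-congʳ (𝓒.+-congʳ (proj₁ (proj₂ G₀-Diff) t)))
          (solveᶜ 2 (λ k g → (conᶜ (+ 1) ⊖ conᶜ (+ 1)) ⊖ k ⊗ conᶜ (+ 0) ⊜ conᶜ (+ 0) ⊗ g) (a *ᶜ ln-a) (G 0 t))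
        recurrence (suc n) t = 𝓒.sym (𝓒.trans (𝓒.sym (𝓒.*-assoc (ι (fromNat (suc n))) (ι (1/ suc n)) _))
          (𝓒.trans (𝓒.*-congʳ (𝓒.trans (𝓒.*-comm _ _) (ι-fromNat-1/ (suc n)))) (𝓒.*-identityˡ _)))

        ι-s-Diff : Diff (λ t → ι (s t)) (λ _ → h)
        ι-s-Diff = Diff-cong (λ t → 𝓒.sym (ι-s t)) (λ _ → 𝓒.refl) (Diff-line (ι 0#) h)

        scale-Diff : ∀ {F f} k → Diff F f → Diff (λ t → k *ᶜ F t) (λ t → k *ᶜ f t)
        scale-Diff {F} {f} k D = Diff-cong (λ _ → 𝓒.refl)
          (λ t → solveᶜ 3 (λ k f g → conᶜ (+ 0) ⊗ g ⊕ k ⊗ f ⊜ k ⊗ f) k (f t) (F t)) (Diff-* (Diff-const k) D)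

        neg-Diff : ∀ {F f} → Diff F f → Diff (λ t → -ᶜ F t) (λ t → -ᶜ f t)
        neg-Diff {F} {f} D = Diff-cong (λ t → -1*x≈-x (F t)) (λ t → -1*x≈-x (f t)) (scale-Diff (-ᶜ ι 1#) D)

        collect : ∀ n z → ι (1/ suc n) *ᶜ (h *ᶜ (z +ᶜ ι (fromNat n) *ᶜ z)) ≈ᶜ z *ᶜ h
        collect n z = 𝓒.trans
          (solveᶜ 4 (λ k h z n → k ⊗ (h ⊗ (z ⊕ n ⊗ z)) ⊜ (k ⊗ (conᶜ (+ 1) ⊕ n)) ⊗ (z ⊗ h)) (ι (1/ suc n)) h z
            (ι (fromNat n)))
          (𝓒.trans (𝓒.*-congʳ (𝓒.trans (𝓒.*-congˡ (𝓡.refl , 𝓡.+-identityʳ 0#)) (ι-fromNat-1/ (suc n)))) (𝓒.*-identityˡ _))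

        e-Diff : ∀ n → Diff (λ t → e n (s t)) (λ t → e′ n t *ᶜ h)
        e-Diff zero = Diff-cong (λ _ → 𝓒.refl) (λ _ → 𝓒.sym (𝓒.zeroˡ h)) (Diff-const (ι 1#))
        e-Diff (suc n) = Diff-cong (λ _ → 𝓒.refl) derivative (scale-Diff (ι (1/ suc n)) (Diff-* ι-s-Diff (e-Diff n)))
          where
          -- Euler's identity for a homogeneous function of degree n.
          s*e′ : ∀ n t → ι (s t) *ᶜ e′ n t ≈ᶜ ι (fromNat n) *ᶜ e n (s t)
          s*e′ zero    t = solveᶜ 1 (λ x → x ⊗ conᶜ (+ 0) ⊜ conᶜ (+ 0) ⊗ conᶜ (+ 1)) (ι (s t))
          s*e′ (suc n) t = 𝓒.sym (𝓒.trans (𝓒.sym (𝓒.*-assoc (ι (fromNat (suc n))) (ι (1/ suc n)) _))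
            (𝓒.trans (𝓒.*-congʳ (𝓒.trans (𝓒.*-comm _ _) (ι-fromNat-1/ (suc n)))) (𝓒.*-identityˡ _)))
          derivative : ∀ t → ι (1/ suc n) *ᶜ (h *ᶜ e n (s t) +ᶜ ι (s t) *ᶜ (e′ n t *ᶜ h)) ≈ᶜ e n (s t) *ᶜ h
          derivative t = 𝓒.trans
            (𝓒.*-congˡ (solveᶜ 4 (λ h e x e′ → h ⊗ e ⊕ x ⊗ (e′ ⊗ h) ⊜ h ⊗ (e ⊕ x ⊗ e′)) h (e n (s t)) (ι (s t)) (e′ n t)))
            (𝓒.trans (𝓒.*-congˡ (𝓒.*-congˡ (𝓒.+-congˡ (s*e′ n t)))) (collect n (e n (s t))))

        G-Diff : ∀ n → Diff (G n) (λ t → G′ n t *ᶜ h)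
        G-Diff zero    = proj₂ (proj₂ G₀-Diff)
        G-Diff (suc n) = Diff-cong (λ _ → 𝓒.refl) derivative
          (scale-Diff (ι (1/ suc n)) (Diff-+ (Diff-+
            (Diff-* (Diff-+ ι-s-Diff (Diff-const a)) (G-Diff n))
            (neg-Diff (e-Diff (suc n))))
            (neg-Diff (scale-Diff (a *ᶜ ln-a) (e-Diff n)))))
          where
          derivative : ∀ t → ι (1/ suc n) *ᶜ ((h +ᶜ ι 0#) *ᶜ G n t +ᶜ Y t *ᶜ (G′ n t *ᶜ h) -ᶜ e n
            (s t) *ᶜ h -ᶜ a *ᶜ ln-a *ᶜ (e′ n t *ᶜ h))
                             ≈ᶜ G n t *ᶜ h
          derivative t = 𝓒.trans
            (𝓒.*-congˡ (solveᶜ 7 (λ h g y g′ e l e′ → (((h ⊕ conᶜ (+ 0)) ⊗ g ⊕ y ⊗ (g′ ⊗ h)) ⊖ e ⊗ h) ⊖ l ⊗ (e′ ⊗ h)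
              ⊜ h ⊗ (g ⊕ ((y ⊗ g′ ⊖ e) ⊖ l ⊗ e′))) h (G n t) (Y t) (G′ n t) (e n (s t)) (a *ᶜ ln-a) (e′ n t)))
            (𝓒.trans (𝓒.*-congˡ (𝓒.*-congˡ (𝓒.+-congˡ (recurrence n t)))) (collect n (G n t)))

        F-Int : ∀ n → Int (λ t → G n t *ᶜ h) (F (suc n) x d)
        F-Int n = Int-cong (λ _ → 𝓒.refl)
          (𝓒.trans (𝓒.+-cong
              (F-cong (suc n) _ d (solve 1 (λ x → con (+ 0) :+ con (+ 1) :* (x :- con (+ 0)) := x) x))
              (𝓒.-‿cong (F-zero n _ (solve 1 (λ x → con (+ 0) :+ con (+ 0) :* (x :- con (+ 0)) := con (+ 0)) x))))
            (solveᶜ 1 (λ z → z ⊖ conᶜ (+ 0) ⊜ z) (F (suc n) x d)))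
          (fundamental-theorem (G-Diff (suc n)))

    ln[x+a] : Fun D
    ln[x+a] x d = ln (ι x +ᶜ a) (slit-x+a x d)

    abstract
      F-isIteratedIntegrals : IsIteratedIntegrals D ln[x+a] F
      F-isIteratedIntegrals = record
        { start = λ x d → 𝓒.refl
        ; step  = λ n x d → Int⇒HasIntegral (segment x d) (λ t d′ → 𝓒.*-congʳ (F-cong n d′ (segment x d t) 𝓡.refl))
          (Along.F-Int x d n)
        }

      -- By induction the integrands agree along the segment from 0 to x, whatever domain proofs
      -- they receive, and then so do the integrals.
      F-unique : ∀ {f} → IsIteratedIntegrals D ln[x+a] f → ∀ n x d → f n x d ≈ᶜ F n x d
      F-unique isf zero    x d = IsIteratedIntegrals.start isf x d
      F-unique isf (suc n) x d = Int-unique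
        (λ t → 𝓒.*-congʳ (𝓒.trans (F-unique isf n _ _) (F-cong n _ (segment x d t) 𝓡.refl)))
        (HasIntegral⇒Int (IsIteratedIntegrals.step isf n x d)) (Along.F-Int x d n)

      e-closed : ∀ n x → e n x ≈ᶜ ι (1/ n !) *ᶜ ι x ^ᶜ n
      e-closed zero    x = 𝓒.sym (𝓒.trans (𝓒.*-identityʳ _) (1/0! , 𝓡.refl))
      e-closed (suc n) x = 𝓒.trans (𝓒.*-congˡ (𝓒.*-congˡ (e-closed n x)))
        (𝓒.trans (solveᶜ 4 (λ k x f p → k ⊗ (x ⊗ (f ⊗ p)) ⊜ (k ⊗ f) ⊗ (x ⊗ p)) (ι (1/ suc n)) (ι x) (ι (1/ n !)) (ι x ^ᶜ n))
          (𝓒.*-congʳ (𝓒.sym (𝓒.trans (1/suc! n , 𝓡.refl) (ι-* (1/ suc n) (1/ n !))))))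

      F-closed : ∀ n x d → F n x d ≈ᶜ
        ι (1/ n !) *ᶜ ((ι x +ᶜ a) ^ᶜ n *ᶜ (ln[x+a] x d -ᶜ ln-a) -ᶜ S n (ι x) (ι x +ᶜ a) +ᶜ ι x ^ᶜ n *ᶜ ln-a)
      F-closed zero x d = 𝓒.trans
        (solveᶜ 2 (λ l k → l ⊜ conᶜ (+ 1) ⊗ ((conᶜ (+ 1) ⊗ (l ⊖ k) ⊖ conᶜ (+ 0)) ⊕ conᶜ (+ 1) ⊗ k)) (ln[x+a] x d) ln-a)
        (𝓒.*-congʳ (𝓒.sym (1/0! , 𝓡.refl)))
      F-closed (suc n) x d = 𝓒.trans
        (𝓒.*-congˡ (𝓒.+-cong (𝓒.+-cong (𝓒.*-congˡ (F-closed n x d)) (𝓒.-‿cong (𝓒.*-congˡ (𝓒.*-congˡ (e-closed n x)))))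
          (𝓒.-‿cong (𝓒.*-congˡ (e-closed n x)))))
        (𝓒.trans (solveᶜ 9 (λ k f x a p q L l S →
            k ⊗ (((x ⊕ a) ⊗ (f ⊗ ((p ⊗ (L ⊖ l) ⊖ S) ⊕ q ⊗ l)) ⊖ k ⊗ (x ⊗ (f ⊗ q))) ⊖ a ⊗ l ⊗ (f ⊗ q))
            ⊜ (k ⊗ f) ⊗ (((x ⊕ a) ⊗ p ⊗ (L ⊖ l) ⊖ ((x ⊕ a) ⊗ S ⊕ k ⊗ (x ⊗ q))) ⊕ x ⊗ q ⊗ l))
            (ι (1/ suc n)) (ι (1/ n !)) (ι x) a ((ι x +ᶜ a) ^ᶜ n) (ι x ^ᶜ n) (ln[x+a] x d) ln-a (S n (ι x) (ι x +ᶜ a)))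
          (𝓒.*-cong (𝓒.sym (𝓒.trans (1/suc! n , 𝓡.refl) (ι-* (1/ suc n) (1/ n !))))
            (𝓒.+-congʳ (𝓒.+-congˡ (𝓒.-‿cong (𝓒.sym (S-suc n (ι x) (ι x +ᶜ a))))))))

  -- Conjugates, the unit and the arctangent

  module LogarithmIdentities (ln : ∀ z → Slit z → ℂ) (isLn : IsLn ln) where
    open Logarithm ln isLn

    abstract
      0<1+x+x² : ∀ x → 0# < 1# + x + x * x
      0<1+x+x² x = 0<*⁻¹ 0<2 (<-resp-≈ 𝓡.refl
        (solve 1 (λ x → con (+ 1) :+ (x :* x :+ (x :+ con (+ 1)) :* (x :+ con (+ 1)))
          := (con (+ 1) :+ con (+ 1)) :* (con (+ 1) :+ x :+ x :* x)) x)
        (0<+ 0<1 (0≤+ (0≤sq x) (0≤sq (x + 1#)))))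

      slope-0 : ∀ z → slope 0# z ≈ re z
      slope-0 z = solve 2 (λ x y → x :+ con (+ 0) :* y := x) (re z) (im z)

      0<re⇒HalfPlane : ∀ {z} → 0# < re z → HalfPlane 0# z
      0<re⇒HalfPlane {z} = <-resp-≈ 𝓡.refl (𝓡.sym (slope-0 z))

      -- If both real parts are positive, β = 0 works. Otherwise the common imaginary part v is
      -- apart from 0, and β = B/v with B = 1 + (re z)² + (re w)² adds B to either real part, which
      -- outweighs it whatever its sign.
      slit-pair⇒HalfPlane : ∀ {z w} → im z ≈ im w → Slit z → Slit w → ∃[ β ] HalfPlane β z × HalfPlane β w
      slit-pair⇒HalfPlane {z} {w} im≈ = decide
        where
        tilted : im z # 0# → ∃[ β ] HalfPlane β z × HalfPlane β w
        tilted v#0 = B * r ,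
          <-resp-≈ 𝓡.refl
            (𝓡.trans (solve 2 (λ x y → (con (+ 1) :+ x :+ x :* x) :+ y :* y := x :+ (con (+ 1) :+ x :* x :+ y :* y))
              (re z) (re w))
              (𝓡.+-congˡ (𝓡.sym βv≈B)))
            (0<+ (0<1+x+x² (re z)) (0≤sq (re w))) ,
          <-resp-≈ 𝓡.refl
            (𝓡.trans (solve 2 (λ x y → (con (+ 1) :+ y :+ y :* y) :+ x :* x := y :+ (con (+ 1) :+ x :* x :+ y :* y))
              (re z) (re w))
              (𝓡.+-congˡ (𝓡.trans (𝓡.sym βv≈B) (𝓡.*-congˡ im≈))))
            (0<+ (0<1+x+x² (re w)) (0≤sq (re z)))
          where
          B r : ℝ
          B = 1# + re z * re z + re w * re w
          r = recip (im z) v#0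
          βv≈B : B * r * im z ≈ B
          βv≈B = 𝓡.trans (solve 3 (λ B r v → B :* r :* v := B :* (v :* r)) B r (im z))
            (𝓡.sym (x≈x*yr B (recip-inverseʳ (im z) v#0)))
        decide : Slit z → Slit w → ∃[ β ] HalfPlane β z × HalfPlane β w
        decide (inj₁ 0<z) (inj₁ 0<w) = 0# , 0<re⇒HalfPlane 0<z , 0<re⇒HalfPlane 0<w
        decide (inj₂ v#0) _          = tilted v#0
        decide (inj₁ _)   (inj₂ (inj₁ <0)) = tilted (inj₁ (<-resp-≈ (𝓡.sym im≈) 𝓡.refl <0))
        decide (inj₁ _)   (inj₂ (inj₂ 0<)) = tilted (inj₂ (<-resp-≈ 𝓡.refl (𝓡.sym im≈) 0<))

      slit⇒HalfPlane : ∀ {z} → Slit z → ∃[ β ] HalfPlane β z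
      slit⇒HalfPlane s = let β , h , _ = slit-pair⇒HalfPlane 𝓡.refl s s in β , h

      slit⇒0<ᴺ : ∀ {z} → Slit z → 0# < ∣ z ∣²
      slit⇒0<ᴺ {z} (inj₁ 0<re) = 0<+ (*-pos 0<re 0<re) (0≤sq (im z))
      slit⇒0<ᴺ {z} (inj₂ im#0) = <-resp-≈ 𝓡.refl (𝓡.+-comm _ _) (0<+ (#0⇒0<sq im#0) (0≤sq (re z)))

      slit-conj : ∀ {z} → Slit z → Slit (conj z)
      slit-conj (inj₁ 0<re) = inj₁ 0<re
      slit-conj {z} (inj₂ (inj₁ <0)) = inj₂ (inj₂ (<-resp-≈ 𝓡.refl (𝓡.+-identityˡ (- im z)) (x<y⇒0<y-x <0)))
      slit-conj {z} (inj₂ (inj₂ 0<)) = inj₂ (inj₁ (<-by 0< (solve 1 (λ x → con (+ 0) :- (:- x) := x) (im z))))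

      -- The product zz̄ is a positive real and so lies in every `HalfPlane β`; any half-plane
      -- containing z serves for the triangle 1, z, zz̄.
      ln-conj : ∀ {z} (s : Slit z) (s̄ : Slit (conj z)) (p : Slit (ι ∣ z ∣²)) → ln z s +ᶜ ln (conj z) s̄ ≈ᶜ ln (ι ∣ z ∣²) p
      ln-conj {z} s s̄ p = apply (slit⇒HalfPlane s)
        where
        apply : ∃[ β ] HalfPlane β z → ln z s +ᶜ ln (conj z) s̄ ≈ᶜ ln (ι ∣ z ∣²) p
        apply (β , h) = 𝓒.sym (ln-* h
          (<-resp-≈ 𝓡.refl (solve 2 (λ n β → n := n :+ β :* con (+ 0)) ∣ z ∣² β) (slit⇒0<ᴺ s))
          ( solve 2 (λ x y → x :* x :- y :* (:- y) := x :* x :+ y :* y) (re z) (im z)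
          , solve 2 (λ x y → x :* (:- y) :+ y :* x := con (+ 0)) (re z) (im z)) s p s̄)

      ln-1 : (s : Slit (ι 1#)) → ln (ι 1#) s ≈ᶜ ι 0#
      ln-1 s = 𝓒.trans (solveᶜ 1 (λ x → x ⊜ (x ⊕ x) ⊖ x) (ln (ι 1#) s))
        (𝓒.trans (𝓒.+-congʳ (𝓒.sym (ln-* {0#} HalfPlane-1 HalfPlane-1 (𝓒.*-identityʳ (ι 1#)) s s s))) (𝓒.-‿inverseʳ _))

      module _ (arctan : ℝ → ℝ) (isArctan : IsArctan arctan) where

        -- On the segment from 1 to 1 ± iq the form dζ/ζ pulls back to ± iq dt/(1 ± iqt).
        ln-arctan : ∀ q (s : Slit (ι 1# +ᶜ 𝕚 *ᶜ ι q)) (s̄ : Slit (ι 1# -ᶜ 𝕚 *ᶜ ι q)) →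
                    ln (ι 1# +ᶜ 𝕚 *ᶜ ι q) s -ᶜ ln (ι 1# -ᶜ 𝕚 *ᶜ ι q) s̄ ≈ᶜ (𝕚 +ᶜ 𝕚) *ᶜ ι (arctan q)
        ln-arctan q s s̄ = Int-unique
          -- With w = iqt and r = 1/(1 + q²t²) = 1/(1 - w²), the reciprocals of 1 + w and 1 - w are
          -- (1 - w)r and (1 + w)r; in the difference of the integrands the terms in w cancel.
          (λ t → solveᶜ 4 (λ i q r w → i ⊗ q ⊗ (conᶜ (+ 1) ⊖ w) ⊗ r ⊖ ⊝ (i ⊗ q ⊗ (conᶜ (+ 1) ⊕ w) ⊗ r) ⊜ (i ⊕ i) ⊗ (r ⊗ q))
            𝕚 (ι q) (r t) (w t))
          (Int-- (ln-Int _ s int₊) (ln-Int _ s̄ int₋))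
          (Int-* (𝕚 +ᶜ 𝕚) (Int-cong (λ t → 𝓒.*-congˡ (solve 1 (λ q → q :- con (+ 0) := q) q , 𝓡.refl)) 𝓒.refl
            (HasIntegral⇒Int (isArctan q))))
          where
          τ : 𝕀 → ℝ
          τ t = 0# + val t * (q - 0#)
          #0 : ∀ t → 1# + τ t ^ 2 # 0#
          #0 t = HasIntegral.inside (isArctan q) (val t) (0≤val t) (val≤1 t)
          r w : 𝕀 → ℂ
          r t = ι (recip (1# + τ t ^ 2) (#0 t))
          w t = ι (val t) *ᶜ (𝕚 *ᶜ ι q)
          𝕚²≈-1 : 𝕚 *ᶜ 𝕚 ≈ᶜ -ᶜ ι 1#
          𝕚²≈-1 = solve 0 (con (+ 0) :* con (+ 0) :- con (+ 1) :* con (+ 1) := :- con (+ 1))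
                , solve 0 (con (+ 0) :* con (+ 1) :+ con (+ 1) :* con (+ 0) := :- con (+ 0))
          r-inverse : ∀ t → (ι 1# -ᶜ w t *ᶜ w t) *ᶜ r t ≈ᶜ ι 1#
          r-inverse t = 𝓒.trans (𝓒.*-congʳ 1-w²) (𝓒.trans (𝓒.sym (ι-* _ _)) (recip-inverseʳ _ (#0 t) , 𝓡.refl))
            where
            1-w² : ι 1# -ᶜ w t *ᶜ w t ≈ᶜ ι (1# + τ t ^ 2)
            1-w² = 𝓒.trans (solveᶜ 3 (λ t i q → conᶜ (+ 1) ⊖ (t ⊗ (i ⊗ q)) ⊗ (t ⊗ (i ⊗ q)) ⊜ conᶜ (+ 1) ⊖ (i ⊗ i) ⊗
              ((t ⊗ q) ⊗ (t ⊗ q))) (ι (val t)) 𝕚 (ι q))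
              (𝓒.trans (𝓒.+-congˡ (𝓒.-‿cong (𝓒.*-cong 𝕚²≈-1 (𝓒.*-cong (𝓒.sym (ι-* _ _)) (𝓒.sym (ι-* _ _))))))
                (𝓒.trans (solveᶜ 1 (λ x → conᶜ (+ 1) ⊖ (⊝ conᶜ (+ 1)) ⊗ (x ⊗ x) ⊜ conᶜ (+ 1) ⊕ x ⊗ x) (ι (val t * q)))
                  (𝓒.trans (𝓒.+-congˡ (𝓒.sym (ι-* _ _)))
                    (solve 2 (λ t q → con (+ 1) :+ t :* q :* (t :* q) := con (+ 1) :+
                      (con (+ 0) :+ t :* (q :- con (+ 0))) :* ((con (+ 0) :+ t :* (q :- con (+ 0))) :* con (+ 1))) (val t) q
                    , 𝓡.+-identityʳ 0#))))
          int₊ : ∀ t → 𝕚 *ᶜ ι q *ᶜ (ι 1# -ᶜ w t) *ᶜ r t *ᶜ ζ (ι 1# +ᶜ 𝕚 *ᶜ ι q) t ≈ᶜ ι 1# +ᶜ 𝕚 *ᶜ ι q -ᶜ ι 1#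
          int₊ t = 𝓒.trans (solveᶜ 3 (λ p t r → p ⊗ (conᶜ (+ 1) ⊖ t ⊗ p) ⊗ r ⊗
            (conᶜ (+ 1) ⊕ t ⊗ ((conᶜ (+ 1) ⊕ p) ⊖ conᶜ (+ 1)))
              ⊜ p ⊗ ((conᶜ (+ 1) ⊖ (t ⊗ p) ⊗ (t ⊗ p)) ⊗ r)) (𝕚 *ᶜ ι q) (ι (val t)) (r t))
            (𝓒.trans (𝓒.*-congˡ (r-inverse t)) (solveᶜ 1 (λ p → p ⊗ conᶜ (+ 1) ⊜ (conᶜ (+ 1) ⊕ p) ⊖ conᶜ (+ 1)) (𝕚 *ᶜ ι q)))
          int₋ : ∀ t → (-ᶜ (𝕚 *ᶜ ι q *ᶜ (ι 1# +ᶜ w t) *ᶜ r t)) *ᶜ ζ (ι 1# -ᶜ 𝕚 *ᶜ ι q) t ≈ᶜ ι 1# -ᶜ 𝕚 *ᶜ ι q -ᶜ ι 1#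
          int₋ t = 𝓒.trans (solveᶜ 3 (λ p t r → (⊝ (p ⊗ (conᶜ (+ 1) ⊕ t ⊗ p) ⊗ r)) ⊗
            (conᶜ (+ 1) ⊕ t ⊗ ((conᶜ (+ 1) ⊖ p) ⊖ conᶜ (+ 1)))
              ⊜ (⊝ p) ⊗ ((conᶜ (+ 1) ⊖ (t ⊗ p) ⊗ (t ⊗ p)) ⊗ r)) (𝕚 *ᶜ ι q) (ι (val t)) (r t))
            (𝓒.trans (𝓒.*-congˡ (r-inverse t)) (solveᶜ 1 (λ p → (⊝ p) ⊗ conᶜ (+ 1) ⊜ (conᶜ (+ 1) ⊖ p) ⊖ conᶜ (+ 1))
              (𝕚 *ᶜ ι q)))

  -- The contribution of a conjugate pair of roots

  module Contribution
    (ln : ∀ z → Slit z → ℂ) (isLn : IsLn ln) (arctan : ℝ → ℝ) (isArctan : IsArctan arctan)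
    (u v : ℝ) (norm : ∣ u +i v ∣² ≈ 1#) (slit-a : Slit (u +i v))
    where
    open LogarithmIdentities ln isLn
    open Logarithm ln isLn

    a ā : ℂ
    a = u +i v
    ā = conj a

    abstract
      slit-ā : Slit ā
      slit-ā = slit-conj slit-a

      half-plane : ∀ x → Domain a x → ∃[ β ] HalfPlane β a × HalfPlane β (ι x +ᶜ a)
      half-plane x d = slit-pair⇒HalfPlane (𝓡.sym (𝓡.+-identityˡ v)) slit-a (slit d)

      half-plane⁻ : ∀ x → Domain a x → ∃[ β ] HalfPlane β ā × HalfPlane β (ι x +ᶜ ā)
      half-plane⁻ x d = slit-pair⇒HalfPlane (𝓡.sym (𝓡.+-identityˡ (- v))) slit-ā (slit̄ d)

      segment-slit : ∀ z x t → ∃[ β ] HalfPlane β z × HalfPlane β (ι x +ᶜ z) → Slit (ι (0# + val t * (x - 0#)) +ᶜ z)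
      segment-slit z x t (β , hz , hx+z) = HalfPlane⇒Slit {β} (<-resp-≈ 𝓡.refl
        (solve 5 (λ β p q t x → (p :+ (t :* ((x :+ p) :- p) :- con (+ 0) :* ((con (+ 0) :+ q) :- q)))
            :+ β :* (q :+ (t :* ((con (+ 0) :+ q) :- q) :+ con (+ 0) :* ((x :+ p) :- p)))
          := ((con (+ 0) :+ t :* (x :- con (+ 0))) :+ p) :+ β :* (con (+ 0) :+ q)) β (re z) (im z) (val t) x)
        (HalfPlane-line t hz hx+z))

      segment : ∀ x → Domain a x → ∀ t → Domain a (0# + val t * (x - 0#))
      segment x d t = record
        { 0<1+ux = <-resp-≈ 𝓡.refl
            (solve 3 (λ u t x → con (+ 1) :+ (t :* ((con (+ 1) :+ u :* x) :- con (+ 1)) :- con (+ 0) :*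
              (con (+ 0) :- con (+ 0)))
                :+ con (+ 0) :* (con (+ 0) :+ (t :* (con (+ 0) :- con (+ 0)) :+ con (+ 0) :*
                  ((con (+ 1) :+ u :* x) :- con (+ 1))))
              := con (+ 1) :+ u :* (con (+ 0) :+ t :* (x :- con (+ 0)))) u (val t) x)
            (HalfPlane-line {0#} {ι 1#} {ι (1# + u * x)} t HalfPlane-1 (0<re⇒HalfPlane (0<1+ux d)))
        ; slit = segment-slit a x t (half-plane x d)
        ; slit̄ = segment-slit ā x t (half-plane⁻ x d)
        }

    module Fᵃ = IteratedLogarithm ln isLn (Domain a) a slit-a (λ x d → slit d) half-plane segment
    module Fᵃ⁻ = IteratedLogarithm ln isLn (Domain a) ā slit-ā (λ x d → slit̄ d) half-plane⁻ segment

    abstract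
      aā≈1 : a *ᶜ ā ≈ᶜ ι 1#
      aā≈1 = 𝓡.trans (solve 2 (λ u v → u :* u :- v :* (:- v) := u :* u :+ v :* v) u v) norm
           , solve 2 (λ u v → u :* (:- v) :+ v :* u := con (+ 0)) u v

      ln-shift : ∀ {z z̄ x} → z *ᶜ z̄ ≈ᶜ ι 1# → ∃[ β ] HalfPlane β z × HalfPlane β (ι x +ᶜ z) →
                 (s : Slit z) (s′ : Slit (ι x +ᶜ z)) (s″ : Slit (ι 1# +ᶜ z̄ *ᶜ ι x)) →
                 ln (ι x +ᶜ z) s′ ≈ᶜ ln z s +ᶜ ln (ι 1# +ᶜ z̄ *ᶜ ι x) s″
      ln-shift {z} {z̄} {x} zz̄≈1 (β , hz , hx+z) s s′ s″ = ln-* hz hx+z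
        (𝓒.trans (solveᶜ 3 (λ z z̄ x → z ⊗ (conᶜ (+ 1) ⊕ z̄ ⊗ x) ⊜ (z ⊗ z̄) ⊗ x ⊕ z) z z̄ (ι x))
          (𝓒.+-congʳ (𝓒.trans (𝓒.*-congʳ zz̄≈1) (𝓒.*-identityˡ (ι x))))) s s′ s″

      ln-a+ln-ā : ln a slit-a +ᶜ ln ā slit-ā ≈ᶜ ι 0#
      ln-a+ln-ā = 𝓒.trans (ln-conj slit-a slit-ā (inj₁ (slit⇒0<ᴺ slit-a)))
        (𝓒.trans (ln-cong _ (inj₁ 0<1) (norm , 𝓡.refl)) (ln-1 (inj₁ 0<1)))

    module Point (x : ℝ) (d : Domain a x) where

      q : ℝ
      q = (v * x) / 1# + u * x [ inj₂ (0<1+ux d) ]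

      p : ℝ
      p = (1# + u * x) ^ 2 + v ^ 2 * x ^ 2

      L L̄ Λ T : ℂ
      L = ln (ι x +ᶜ a) (slit d)
      L̄ = ln (ι x +ᶜ ā) (slit̄ d)
      Λ = ln (ι p) (pos⇒slit (0<y²+v²x² v x (0<1+ux d)))
      T = ι (arctan q)

      abstract
        -- Because u² + v² = 1, both sides equal x² + 2ux + 1.
        p≈ᴺ : ∣ ι x +ᶜ a ∣² ≈ p
        p≈ᴺ = 𝓡.trans
          (solve 3 (λ u v x → (x :+ u) :* (x :+ u) :+ (con (+ 0) :+ v) :* (con (+ 0) :+ v)
            := (x :* x :+ (con (+ 1) :+ con (+ 1)) :* u :* x) :+ (u :* u :+ v :* v)) u v x)
          (𝓡.trans (𝓡.+-congˡ norm)
            (𝓡.trans (solve 2 (λ u x → (x :* x :+ (con (+ 1) :+ con (+ 1)) :* u :* x) :+ con (+ 1)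
                := (con (+ 1) :+ (con (+ 1) :+ con (+ 1)) :* u :* x) :+ con (+ 1) :* (x :* x)) u x)
              (𝓡.trans (𝓡.+-congˡ (𝓡.*-congʳ (𝓡.sym norm)))
                (solve 3 (λ u v x → (con (+ 1) :+ (con (+ 1) :+ con (+ 1)) :* u :* x) :+ (u :* u :+ v :* v) :* (x :* x)
                  := (con (+ 1) :+ u :* x) :* ((con (+ 1) :+ u :* x) :* con (+ 1)) :+ v :* (v :* con (+ 1)) :*
                    (x :* (x :* con (+ 1)))) u v x))))

        L+L̄ : L +ᶜ L̄ ≈ᶜ Λ
        L+L̄ = 𝓒.trans (𝓒.+-congˡ (ln-cong (slit̄ d) slit-conj-x+a
          (𝓡.refl , solve 1 (λ v → con (+ 0) :+ (:- v) := :- (con (+ 0) :+ v)) v)))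
          (𝓒.trans (ln-conj (slit d) slit-conj-x+a (inj₁ (slit⇒0<ᴺ (slit d)))) (ln-cong _ _ (p≈ᴺ , 𝓡.refl)))
          where
          slit-conj-x+a : Slit (conj (ι x +ᶜ a))
          slit-conj-x+a = slit-conj (slit d)

        0<re[1+ax] : 0# < re (ι 1# +ᶜ a *ᶜ ι x)
        0<re[1+ax] = <-resp-≈ 𝓡.refl
          (solve 3 (λ u v x → con (+ 1) :+ u :* x := con (+ 1) :+ (u :* x :- v :* con (+ 0))) u v x) (0<1+ux d)

        0<re[1+āx] : 0# < re (ι 1# +ᶜ ā *ᶜ ι x)
        0<re[1+āx] = <-resp-≈ 𝓡.refl
          (solve 3 (λ u v x → con (+ 1) :+ u :* x := con (+ 1) :+ (u :* x :- (:- v) :* con (+ 0))) u v x) (0<1+ux d)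

        slit₊ : Slit (ι 1# +ᶜ a *ᶜ ι x)
        slit₊ = inj₁ 0<re[1+ax]

        slit₋ : Slit (ι 1# +ᶜ ā *ᶜ ι x)
        slit₋ = inj₁ 0<re[1+āx]

        0<re₊ : 0# < re (ι 1# +ᶜ 𝕚 *ᶜ ι q)
        0<re₊ = <-resp-≈ 𝓡.refl (solve 1 (λ q → con (+ 1) := con (+ 1) :+ (con (+ 0) :* q :- con (+ 1) :* con (+ 0))) q) 0<1

        0<re₋ : 0# < re (ι 1# -ᶜ 𝕚 *ᶜ ι q)
        0<re₋ = <-resp-≈ 𝓡.refl (solve 1 (λ q → con (+ 1) := con (+ 1) :+ :-
          (con (+ 0) :* q :- con (+ 1) :* con (+ 0))) q) 0<1

        q[1+ux]≈vx : q * (1# + u * x) ≈ v * x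
        q[1+ux]≈vx = 𝓡.trans (cancel (v * x) (recip (1# + u * x) (inj₂ (0<1+ux d))) (1# + u * x))
          (𝓡.sym (x≈x*yr (v * x) (recip-inverseʳ (1# + u * x) (inj₂ (0<1+ux d)))))
          where
          cancel : ∀ w r y → w * r * y ≈ w * (y * r)
          cancel = solve 3 (λ w r y → w :* r :* y := w :* (y :* r))

        factor₊ : (ι 1# +ᶜ 𝕚 *ᶜ ι q) *ᶜ ι (1# + u * x) ≈ᶜ ι 1# +ᶜ a *ᶜ ι x
        factor₊ = solve 4 (λ q u v x → (con (+ 1) :+ (con (+ 0) :* q :- con (+ 1) :* con (+ 0))) :* (con (+ 1) :+ u :* x)
                    :- (con (+ 0) :+ (con (+ 0) :* con (+ 0) :+ con (+ 1) :* q)) :* con (+ 0)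
                    := con (+ 1) :+ (u :* x :- v :* con (+ 0))) q u v x
                , 𝓡.trans (solve 2 (λ q r → (con (+ 1) :+ (con (+ 0) :* q :- con (+ 1) :* con (+ 0))) :* con (+ 0)
                    :+ (con (+ 0) :+ (con (+ 0) :* con (+ 0) :+ con (+ 1) :* q)) :* r := q :* r) q (1# + u * x))
                  (𝓡.trans q[1+ux]≈vx (solve 3 (λ u v x → v :* x := con (+ 0) :+ (u :* con (+ 0) :+ v :* x)) u v x))

        factor₋ : (ι 1# -ᶜ 𝕚 *ᶜ ι q) *ᶜ ι (1# + u * x) ≈ᶜ ι 1# +ᶜ ā *ᶜ ι x
        factor₋ = solve 4 (λ q u v x → (con (+ 1) :+ :- (con (+ 0) :* q :- con (+ 1) :* con (+ 0))) :* (con (+ 1) :+ u :* x)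
                    :- (con (+ 0) :+ :- (con (+ 0) :* con (+ 0) :+ con (+ 1) :* q)) :* con (+ 0)
                    := con (+ 1) :+ (u :* x :- (:- v) :* con (+ 0))) q u v x
                , 𝓡.trans (solve 2 (λ q r → (con (+ 1) :+ :- (con (+ 0) :* q :- con (+ 1) :* con (+ 0))) :* con (+ 0)
                    :+ (con (+ 0) :+ :- (con (+ 0) :* con (+ 0) :+ con (+ 1) :* q)) :* r := :- (q :* r)) q (1# + u * x))
                  (𝓡.trans (𝓡.-‿cong q[1+ux]≈vx) (solve 3
                    (λ u v x → :- (v :* x) := con (+ 0) :+ (u :* con (+ 0) :+ (:- v) :* x)) u v x))

        -- The positive real factor 1 + ux is common to 1 + ax and 1 + āx, so ln(1 + ux) cancels.
        ln-quotient : ln (ι 1# +ᶜ a *ᶜ ι x) slit₊ -ᶜ ln (ι 1# +ᶜ ā *ᶜ ι x) slit₋ ≈ᶜ (𝕚 +ᶜ 𝕚) *ᶜ T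
        ln-quotient = 𝓒.trans
          (𝓒.+-cong
            (ln-* (0<re⇒HalfPlane 0<re₊) (0<re⇒HalfPlane 0<re[1+ax]) factor₊ (inj₁ 0<re₊) slit₊ (inj₁ (0<1+ux d)))
            (𝓒.-‿cong (ln-* (0<re⇒HalfPlane 0<re₋) (0<re⇒HalfPlane 0<re[1+āx]) factor₋
              (inj₁ 0<re₋) slit₋ (inj₁ (0<1+ux d)))))
          (𝓒.trans (solveᶜ 3 (λ a b r → (a ⊕ r) ⊖ (b ⊕ r) ⊜ a ⊖ b) _ _ _)
            (ln-arctan arctan isArctan q (inj₁ 0<re₊) (inj₁ 0<re₋)))

        ln-sum : (L -ᶜ Fᵃ.ln-a) +ᶜ (L̄ -ᶜ Fᵃ⁻.ln-a) ≈ᶜ Λ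
        ln-sum = 𝓒.trans (solveᶜ 4 (λ L M l m → (L ⊖ l) ⊕ (M ⊖ m) ⊜ (L ⊕ M) ⊖ (l ⊕ m)) L L̄ Fᵃ.ln-a Fᵃ⁻.ln-a)
          (𝓒.trans (𝓒.+-cong L+L̄ (𝓒.-‿cong ln-a+ln-ā)) (solveᶜ 1 (λ x → x ⊖ conᶜ (+ 0) ⊜ x) Λ))

        -- The shift by a produces 1 + āx and the shift by ā produces 1 + ax. The difference is
        -- therefore taken with the conjugate first to obtain +2i arctan q.
        ln-difference : (L̄ -ᶜ Fᵃ⁻.ln-a) -ᶜ (L -ᶜ Fᵃ.ln-a) ≈ᶜ (𝕚 +ᶜ 𝕚) *ᶜ T
        ln-difference = 𝓒.trans
          (𝓒.+-cong
            (𝓒.+-congʳ (ln-shift (𝓒.trans (𝓒.*-comm ā a) aā≈1) (half-plane⁻ x d) slit-ā (slit̄ d) slit₊))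
            (𝓒.-‿cong (𝓒.+-congʳ (ln-shift aā≈1 (half-plane x d) slit-a (slit d) slit₋))))
          (𝓒.trans (solveᶜ 4 (λ l m a b → ((l ⊕ a) ⊖ l) ⊖ ((m ⊕ b) ⊖ m) ⊜ a ⊖ b) Fᵃ⁻.ln-a Fᵃ.ln-a _ _) ln-quotient)

        half*2 : ι (1/ 2) *ᶜ (ι 1# +ᶜ ι 1#) ≈ᶜ ι 1#
        half*2 = 𝓒.trans (𝓒.*-congˡ (𝓡.+-congˡ (𝓡.sym (𝓡.+-identityʳ 1#)) , 𝓡.+-identityʳ 0#)) (ι-fromNat-1/ 2)

        1/𝕚≈-𝕚 : recipᶜ 𝕚 ∣𝕚∣²#0 ≈ᶜ -ᶜ 𝕚
        1/𝕚≈-𝕚 = *ᶜ-cancelʳ (recipᶜ-inverseʳ 𝕚 ∣𝕚∣²#0) (𝓒.trans (𝓒.*-comm _ 𝕚) (𝓒.trans (recipᶜ-inverseʳ 𝕚 ∣𝕚∣²#0)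
          ( solve 0 (con (+ 1) := (:- con (+ 0)) :* con (+ 0) :- (:- con (+ 1)) :* con (+ 1))
          , solve 0 (con (+ 0) := (:- con (+ 0)) :* con (+ 1) :+ (:- con (+ 1)) :* con (+ 0)))))

        -- Half of (m + m̄) - (m̄ - m), for m = L - ln a; the term -i arctan q takes the form of a
        -- division by i. In the computation 1/2 is an atom, so a factor 1 is introduced and
        -- rewritten as twice it.
        L-ln-a : L -ᶜ Fᵃ.ln-a ≈ᶜ ι (1/ 2) *ᶜ Λ +ᶜ recipᶜ 𝕚 ∣𝕚∣²#0 *ᶜ T
        L-ln-a = halve ln-sum ln-difference 1/𝕚≈-𝕚
          where
          halve : ∀ {m m̄ Λ k} → m +ᶜ m̄ ≈ᶜ Λ → m̄ -ᶜ m ≈ᶜ (𝕚 +ᶜ 𝕚) *ᶜ T → k ≈ᶜ -ᶜ 𝕚 → m ≈ᶜ ι (1/ 2) *ᶜ Λ +ᶜ k *ᶜ T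
          halve {m} {m̄} {Λ} {k} m+m̄ m̄-m k≈-𝕚 = 𝓒.sym (𝓒.trans
            (𝓒.+-cong (𝓒.*-congˡ (𝓒.sym m+m̄)) (𝓒.*-congʳ k≈-𝕚))
            (𝓒.trans (𝓒.+-congˡ (𝓒.trans (solveᶜ 2 (λ i t → (⊝ i) ⊗ t ⊜ conᶜ (+ 1) ⊗ ((⊝ i) ⊗ t)) 𝕚 T)
              (𝓒.*-congʳ (𝓒.sym half*2))))
              (𝓒.trans (solveᶜ 5 (λ h m n i t → h ⊗ (m ⊕ n) ⊕ (h ⊗ (conᶜ (+ 1) ⊕ conᶜ (+ 1))) ⊗ ((⊝ i) ⊗ t) ⊜ h ⊗
                ((m ⊕ n) ⊖ (i ⊕ i) ⊗ t))
                  (ι (1/ 2)) m m̄ 𝕚 T)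
                (𝓒.trans (𝓒.*-congˡ (𝓒.+-congˡ (𝓒.-‿cong (𝓒.sym m̄-m))))
                  (𝓒.trans (solveᶜ 3 (λ h m n → h ⊗ ((m ⊕ n) ⊖ (n ⊖ m)) ⊜ (h ⊗ (conᶜ (+ 1) ⊕ conᶜ (+ 1))) ⊗ m)
                    (ι (1/ 2)) m m̄)
                    (𝓒.trans (𝓒.*-congʳ half*2) (𝓒.*-identityˡ m)))))))

        contribution : ∀ n → Fᵃ.F n x d +ᶜ Fᵃ⁻.F n x d ≈ᶜ
          -ᶜ (ι (1/ n !) *ᶜ sum₁ n (λ k → ι x ^ᶜ k *ᶜ ι (1/ k) *ᶜ ((ι x +ᶜ a) ^ᶜ (n ∸ k) +ᶜ (ι x +ᶜ ā) ^ᶜ (n ∸ k))))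
          +ᶜ recipᶜ 𝕚 ∣𝕚∣²#0 *ᶜ ι (1/ n !) *ᶜ ((ι x +ᶜ a) ^ᶜ n -ᶜ (ι x +ᶜ ā) ^ᶜ n) *ᶜ T
          +ᶜ ((ι x +ᶜ a) ^ᶜ n +ᶜ (ι x +ᶜ ā) ^ᶜ n) *ᶜ ι (1/ 2) *ᶜ ι (1/ n !) *ᶜ Λ
        contribution n = 𝓒.trans (𝓒.+-cong (Fᵃ.F-closed n x d) (Fᵃ⁻.F-closed n x d))
          (𝓒.trans (collect ln-sum ln-a+ln-ā L-ln-a)
            (𝓒.+-congʳ (𝓒.+-congʳ (𝓒.-‿cong (𝓒.*-congˡ (𝓒.sym (S-+ n (ι x) (ι x +ᶜ a) (ι x +ᶜ ā))))))))
          where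
          f A B Xⁿ S₁ S₂ r h : ℂ
          f = ι (1/ n !)
          A = (ι x +ᶜ a) ^ᶜ n
          B = (ι x +ᶜ ā) ^ᶜ n
          Xⁿ = ι x ^ᶜ n
          S₁ = S n (ι x) (ι x +ᶜ a)
          S₂ = S n (ι x) (ι x +ᶜ ā)
          r = recipᶜ 𝕚 ∣𝕚∣²#0
          h = ι (1/ 2)
          collect : ∀ {m m̄ l l̄ Λ} → m +ᶜ m̄ ≈ᶜ Λ → l +ᶜ l̄ ≈ᶜ ι 0# → m ≈ᶜ h *ᶜ Λ +ᶜ r *ᶜ T →
            f *ᶜ (A *ᶜ m -ᶜ S₁ +ᶜ Xⁿ *ᶜ l) +ᶜ f *ᶜ (B *ᶜ m̄ -ᶜ S₂ +ᶜ Xⁿ *ᶜ l̄) ≈ᶜ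
            -ᶜ (f *ᶜ (S₁ +ᶜ S₂)) +ᶜ r *ᶜ f *ᶜ (A -ᶜ B) *ᶜ T +ᶜ (A +ᶜ B) *ᶜ h *ᶜ f *ᶜ Λ
          collect {m} {m̄} {l} {l̄} {Λ} m+m̄ l+l̄≈0 m≈ = 𝓒.trans
            -- Am + Bm̄ is regrouped as (A - B)m + B(m + m̄), so that only m and the sum need
            -- values; the factor 1 before m + m̄ becomes 2 · 1/2, and the two multiples of Λ
            -- combine to (A + B)Λ/2.
            (solveᶜ 10 (λ f A B Xⁿ S₁ S₂ m m̄ l l̄ →
              f ⊗ ((A ⊗ m ⊖ S₁) ⊕ Xⁿ ⊗ l) ⊕ f ⊗ ((B ⊗ m̄ ⊖ S₂) ⊕ Xⁿ ⊗ l̄)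
              ⊜ (f ⊗ (A ⊖ B) ⊗ m ⊕ f ⊗ B ⊗ (conᶜ (+ 1) ⊗ (m ⊕ m̄))) ⊖ f ⊗ (S₁ ⊕ S₂) ⊕ f ⊗ Xⁿ ⊗
                (l ⊕ l̄)) f A B Xⁿ S₁ S₂ m m̄ l l̄)
            (𝓒.trans (𝓒.+-cong
                (𝓒.+-congʳ (𝓒.+-cong (𝓒.*-congˡ m≈) (𝓒.*-congˡ (𝓒.*-cong (𝓒.sym half*2) m+m̄))))
                (𝓒.*-congˡ l+l̄≈0))
              (solveᶜ 10 (λ f A B Xⁿ S₁ S₂ r h T Λ →
                (f ⊗ (A ⊖ B) ⊗ (h ⊗ Λ ⊕ r ⊗ T) ⊕ f ⊗ B ⊗ ((h ⊗ (conᶜ (+ 1) ⊕ conᶜ (+ 1))) ⊗ Λ)) ⊖ f ⊗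
                  (S₁ ⊕ S₂) ⊕ f ⊗ Xⁿ ⊗ conᶜ (+ 0)
                ⊜ (⊝ (f ⊗ (S₁ ⊕ S₂)) ⊕ r ⊗ f ⊗ (A ⊖ B) ⊗ T) ⊕ (A ⊕ B) ⊗ h ⊗ f ⊗ Λ) f A B Xⁿ S₁ S₂ r h T Λ))

theorem3p2 :
  ∀ {c ℓ₁ ℓ₂} (R : Reals c ℓ₁ ℓ₂) →
  let open Analysis R in
  (ln : ∀ z → Slit z → ℂ) → IsLn ln →
  (arctan : ℝ → ℝ) → IsArctan arctan →
  (N : ℕ) (u v : ℝ) →
  let a = u +i v
      ā = conj a
      ln[x+a] = λ x (d : Domain a x) → ln (ι x +ᶜ a) (slit d)
      ln[x+ā] = λ x (d : Domain a x) → ln (ι x +ᶜ ā) (slit̄ d)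
  in
  (X +ₚ const a) ∣ₚ (const (ι 1#) +ₚ X^ N) →
  (∃[ f ] IsIteratedIntegrals (Domain a) ln[x+a] f) ×
  (∃[ g ] IsIteratedIntegrals (Domain a) ln[x+ā] g) ×
  (∀ f g →
   IsIteratedIntegrals (Domain a) ln[x+a] f →
   IsIteratedIntegrals (Domain a) ln[x+ā] g →
   ∀ n x (d : Domain a x) →
   f n x d +ᶜ g n x d ≈ᶜ
     -ᶜ (ι (1/ n !) *ᶜ
         sum₁ n (λ k → ι x ^ᶜ k *ᶜ ι (1/ k) *ᶜ
                       ((ι x +ᶜ a) ^ᶜ (n ∸ k) +ᶜ (ι x +ᶜ ā) ^ᶜ (n ∸ k))))
     +ᶜ recipᶜ 𝕚 ∣𝕚∣²#0 *ᶜ ι (1/ n !) *ᶜ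
        ((ι x +ᶜ a) ^ᶜ n -ᶜ (ι x +ᶜ ā) ^ᶜ n) *ᶜ
        ι (arctan ((v * x) / 1# + u * x [ inj₂ (0<1+ux d) ]))
     +ᶜ ((ι x +ᶜ a) ^ᶜ n +ᶜ (ι x +ᶜ ā) ^ᶜ n) *ᶜ ι (1/ 2) *ᶜ ι (1/ n !) *ᶜ
        ln (ι ((1# + u * x) ^ 2 + v ^ 2 * x ^ 2))
           (pos⇒slit (0<y²+v²x² v x (0<1+ux d))))
theorem3p2 R ln isLn arctan isArctan N u v a∣1+X^N =
  -- The explicit families witness existence; uniqueness then carries their closed form over to
  -- arbitrary f and g.
  (Fᵃ.F , Fᵃ.F-isIteratedIntegrals) , (Fᵃ⁻.F , Fᵃ⁻.F-isIteratedIntegrals) , λ f g f-iterated g-iterated n x d →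
    𝓒.trans (𝓒.+-cong (Fᵃ.F-unique f-iterated n x d) (Fᵃ⁻.F-unique g-iterated n x d)) (Point.contribution x d n)
  where
  open Analysis R using (_+i_; ℂ-commutativeRing)
  module 𝓒 = CommutativeRing ℂ-commutativeRing
  open Contribution R ln isLn arctan isArctan u v
    (Root.root-norm R N (u +i v) a∣1+X^N) (Root.root-slit R N (u +i v) a∣1+X^N)
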